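{- There is an $O\big((\log^{3/2}U)\,\log(1/\delta)/\varepsilon\big)$-word turnstile streaming algorithm for $\mathsf{AR}(\varepsilon,\delta,n,U)$. Similarly, there is an $O\big((\log^{3/2}U)\,\log(1/(\varepsilon\delta))/\varepsilon+\log\log U\big)$-word turnstile streaming algorithm for $\mathsf{AQ}(\varepsilon,\delta,n,U)$.
   Context: Fix $\varepsilon\in(0,1)$ and $\delta\in(0,1)$. In a strict turnstile stream over $[U]=\{1,\dots,U\}$, a vector $x$ starts at $0$ and receives updates $x_u\leftarrow x_u+\Delta$ ($\Delta$ may be negative), with $x_u\ge0$ for all $u$; the stream produces $x\in\mathbb{R}_{\ge0}^U$ of size $n=\lceil\|x\|_1\rceil$. Write $\mathrm{rank}(u)=\sum_{v\le u}x_v$. Approximate rank, $\mathsf{AR}(\varepsilon,\delta,n,U)$: for each $u\in[U]$, the query $\mathsf{rank}(u)$ must be answered with a value within additive error $\pm\varepsilon n$ of $\mathrm{rank}(u)$, with probability at least $1-\delta$. Approximate quantile, $\mathsf{AQ}(\varepsilon,\delta,n,U)$: each query $q\in[n]$ must be answered by an index $u\in[U]$ with $\mathrm{rank}(u)\ge q-\varepsilon n$ and $\mathrm{rank}(u-1)\le q+\varepsilon n$, with probability at least $1-\delta$. In both problems the success probability is for each query individually, not simultaneously for all queries. Memory is counted in machine words, one word storing one counter. Hidden constants are absolute.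
   Formalization: For AQ the guarantee is required only for queries q that have an admissible answer (for non-integer ‖x‖₁ some have none, e.g. x=0.1, n=q=1, ε=1/2), and "O(f) words" is read as at most C(1+f), since f is 0 at U=1 and tends to 0 as δ tends to 1. -}

module Defs where

open import Algebra.Bundles using (CommutativeRing; Semiring)
open import Algebra.Structures using (IsCommutativeRing)
import Algebra.Definitions.RawSemiring as RawSemiringDefinitions
open import Data.Bool.Base using (if_then_else_)
open import Data.Fin.Base using (Fin; toℕ)
open import Data.List.Base using (List; []; _∷_; allFin; cartesianProduct; filter; length; foldl)
open import Data.Nat.Base as ℕ using (ℕ; suc; NonZero)
import Data.Nat.Properties as ℕ
open import Data.Product.Base using (_×_; _,_; ∃; ∃-syntax)
open import Data.Vec.Functional using (Vector; updateAt)
open import Level using (0ℓ)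
open import Relation.Binary.Core using (Rel)
open import Relation.Binary.Structures using (IsDecTotalOrder)
open import Relation.Binary.PropositionalEquality using (_≡_; _≢_)
open import Relation.Nullary.Decidable using (does; _×-dec_)
open import Relation.Unary using (Pred; Decidable)

-- The real numbers, axiomatised as the complete ordered field, with the
-- classical order (comparisons are decidable).  `sup` is total, with an
-- unspecified value on sets that are empty or not bounded above.
-- `archimedean` follows classically from completeness; it is a field so
-- that the natural number is available as a witness.
record RealField : Set₁ where
  infix  9 _⁻¹
  infix  8 -_
  infixl 7 _*_
  infixl 6 _+_
  infix  4 _≤_
  field
    ℝ       : Set
    _+_ _*_ : ℝ → ℝ → ℝ
    -_ _⁻¹  : ℝ → ℝ
    0# 1#   : ℝ
    _≤_     : Rel ℝ 0ℓ
    sup     : (ℝ → Set) → ℝ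

    isCommutativeRing : IsCommutativeRing _≡_ _+_ _*_ -_ 0# 1#
    0≢1               : 0# ≢ 1#
    ⁻¹-inverseʳ       : ∀ x → x ≢ 0# → x * x ⁻¹ ≡ 1#

    isDecTotalOrder   : IsDecTotalOrder _≡_ _≤_
    +-monoʳ-≤         : ∀ x {y z} → y ≤ z → x + y ≤ x + z
    *-nonNegative     : ∀ {x y} → 0# ≤ x → 0# ≤ y → 0# ≤ x * y

  IsUpperBound : (ℝ → Set) → ℝ → Set
  IsUpperBound P b = ∀ x → P x → x ≤ b

  field
    sup-upper   : ∀ P → ∃ P → ∃ (IsUpperBound P) → IsUpperBound P (sup P)
    sup-least   : ∀ P → ∃ P → ∀ b → IsUpperBound P b → sup P ≤ b

  commutativeRing : CommutativeRing 0ℓ 0ℓ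
  commutativeRing = record { isCommutativeRing = isCommutativeRing }

  open CommutativeRing commutativeRing public using (semiring; _-_)
  open RawSemiringDefinitions (Semiring.rawSemiring semiring) public
    using (_^_; sum) renaming (_×_ to _·_)
  open IsDecTotalOrder isDecTotalOrder public using (_≤?_)

  fromℕ : ℕ → ℝ
  fromℕ n = n · 1#

  field
    archimedean : ∀ x → ∃[ n ] x ≤ fromℕ n

  infix 4 _<_
  _<_ : Rel ℝ 0ℓ
  x < y = x ≤ y × x ≢ y

  infixl 6 _⊔_
  _⊔_ : ℝ → ℝ → ℝ
  x ⊔ y = if does (x ≤? y) then y else x

  ∣_∣ : ℝ → ℝ
  ∣ x ∣ = x ⊔ (- x)

  -- For y ≥ 0.
  infix 9 √_
  √_ : ℝ → ℝ
  √ y = sup λ z → z * z ≤ y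

  -- For y ≥ 1: the supremum of the fractions p / q, q ≥ 1, for which
  -- 2 ^ p ≤ y ^ q.
  log₂ : ℝ → ℝ
  log₂ y = sup λ z → ∃[ p ] ∃[ q ]
    fromℕ (suc q) * z ≡ fromℕ p × fromℕ 2 ^ p ≤ y ^ suc q

  infix 9 _^3/2
  _^3/2 : ℝ → ℝ
  x ^3/2 = x * √ x

  IsCeiling : ℝ → ℕ → Set
  IsCeiling x n = x ≤ fromℕ n × fromℕ n < x + 1#

module Streaming (R : RealField) where
  open RealField R

  -- The element i : Fin U stands for suc (toℕ i) ∈ {1, …, U}.
  index : ∀ {U} → Fin U → ℕ
  index i = suc (toℕ i)

  -- (u , Δ) stands for x_u ← x_u + Δ.
  Update : ℕ → Set
  Update U = Fin U × ℝ

  Stream : ℕ → Set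
  Stream U = List (Update U)

  module _ {U : ℕ} where

    0ᵥ : Vector ℝ U
    0ᵥ _ = 0#

    apply : Vector ℝ U → Update U → Vector ℝ U
    apply x (u , Δ) = updateAt x u (_+ Δ)

    produced : Stream U → Vector ℝ U
    produced = foldl apply 0ᵥ

    NonNegative : Vector ℝ U → Set
    NonNegative x = ∀ u → 0# ≤ x u

    StaysNonNegative : Vector ℝ U → Stream U → Set
    StaysNonNegative x []      = NonNegative x
    StaysNonNegative x (e ∷ σ) = NonNegative x × StaysNonNegative (apply x e) σ

    StrictTurnstile : Stream U → Set
    StrictTurnstile = StaysNonNegative 0ᵥ

    ‖_‖₁ : Vector ℝ U → ℝ
    ‖ x ‖₁ = sum λ u → ∣ x u ∣

    HasSize : Vector ℝ U → ℕ → Set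
    HasSize x = IsCeiling ‖ x ‖₁

    -- rank x k is the sum of the coordinates with index at most k, so that
    -- rank (u) and rank (u - 1) are rank x (index u) and rank x (toℕ u).
    rank : Vector ℝ U → ℕ → ℝ
    rank x k = sum λ v → if does (index v ℕ.≤? k) then x v else 0#

  -- Memory consists of machine words of two kinds: control words of w bits
  -- (hash seeds, loop state, …) and counters.  A counter holds a real, since
  -- updates are real, but it can only be changed by adding or subtracting
  -- the current increment Δ.  With unrestricted real-valued words the
  -- whole vector could be packed into a single word.
  record Memory (w words counters : ℕ) : Set where
    constructor ⟨_,_⟩
    field
      word    : Vector (Fin (2 ℕ.^ w)) words
      counter : Vector ℝ counters

  data Action : Set where
    add subtract keep : Action

  act : Action → ℝ → ℝ → ℝ
  act add      Δ c = c + Δ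
  act subtract Δ c = c - Δ
  act keep     Δ c = c

  -- A randomised algorithm over [U] with w-bit control words.  A uniform
  -- seed, accessible only through the control words, is drawn at the start,
  -- and a fresh uniform coin when a query is answered.
  record Algorithm (U w : ℕ) (Query Answer : Set) : Set where
    field
      words counters : ℕ
      seeds coins    : ℕ
      seeds≢0        : NonZero seeds
      coins≢0        : NonZero coins

    State : Set
    State = Memory w words counters

    field
      initial  : Fin seeds → Vector (Fin (2 ℕ.^ w)) words
      nextWord : State → Update U → Vector (Fin (2 ℕ.^ w)) words
      action   : State → Update U → Fin counters → Action
      answer   : State → Fin coins → Query → Answer

    space : ℕ
    space = words ℕ.+ counters

    start : Fin seeds → State
    start s = ⟨ initial s , (λ _ → 0#) ⟩

    step : State → Update U → State
    step M e@(_ , Δ) =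
      ⟨ nextWord M e , (λ i → act (action M e i) Δ (Memory.counter M i)) ⟩

    output : Stream U → Query → Fin seeds × Fin coins → Answer
    output σ query (s , c) = answer (foldl step (start s) σ) c query

    outcomes : List (Fin seeds × Fin coins)
    outcomes = cartesianProduct (allFin seeds) (allFin coins)

    -- On stream σ, the answer to the query satisfies Good with probability
    -- at least p.
    AnswersWithProbability≥ : ℝ → Stream U → Query → {Good : Pred Answer 0ℓ} →
                              Decidable Good → Set
    AnswersWithProbability≥ p σ query good? =
      p * fromℕ (length outcomes) ≤
      fromℕ (length (filter (λ ω → good? (output σ query ω)) outcomes))

  module _ {U : ℕ} where

    IsApproxRank : (ε : ℝ) (n : ℕ) (x : Vector ℝ U) (u : Fin U) → Pred ℝ 0ℓ
    IsApproxRank ε n x u r = ∣ r - rank x (index u) ∣ ≤ ε * fromℕ n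

    isApproxRank? : ∀ ε n x u → Decidable (IsApproxRank ε n x u)
    isApproxRank? ε n x u r = _ ≤? _

    IsApproxQuantile : (ε : ℝ) (n : ℕ) (x : Vector ℝ U) (q : ℕ) → Pred (Fin U) 0ℓ
    IsApproxQuantile ε n x q u =
      fromℕ q - ε * fromℕ n ≤ rank x (index u) ×
      rank x (toℕ u) ≤ fromℕ q + ε * fromℕ n

    isApproxQuantile? : ∀ ε n x q → Decidable (IsApproxQuantile ε n x q)
    isApproxQuantile? ε n x q u = (_ ≤? _) ×-dec (_ ≤? _)

  SolvesAR : (ε δ : ℝ) {U w : ℕ} → Algorithm U w (Fin U) ℝ → Set
  SolvesAR ε δ {U} A =
    ∀ (σ : Stream U) n → StrictTurnstile σ → HasSize (produced σ) n → ∀ u →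
    AnswersWithProbability≥ (1# - δ) σ u (isApproxRank? ε n (produced σ) u)
    where open Algorithm A

  -- Since n rounds ‖x‖₁ up, a query q with q - εn > ‖x‖₁ can occur when
  -- ‖x‖₁ is not an integer; no index is a correct answer to it, so it is
  -- exempted.  Every query q ≤ ‖x‖₁ + εn has a correct answer.
  SolvesAQ : (ε δ : ℝ) {U w : ℕ} → Algorithm U w ℕ (Fin U) → Set
  SolvesAQ ε δ {U} A =
    ∀ (σ : Stream U) n → StrictTurnstile σ → HasSize (produced σ) n →
    ∀ q → 1 ℕ.≤ q → q ℕ.≤ n → ∃ (IsApproxQuantile ε n (produced σ) q) →
    AnswersWithProbability≥ (1# - δ) σ q (isApproxQuantile? ε n (produced σ) q)
    where open Algorithm A

  -- "O (f) words", with C the hidden constant.  An algorithm uses a whole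
  -- number of words, so f counts as at least a constant; this matters only
  -- where f tends to 0, that is for U = 1 or as δ or ε tends to 1.
  UsesO : ∀ {U w Query Answer} → ℕ → Algorithm U w Query Answer → ℝ → Set
  UsesO C A f = fromℕ (Algorithm.space A) ≤ fromℕ C * (1# + f)

  -- The inner maximum with 1 gives log log 1 = 0 and log log U is
  -- otherwise unchanged.
  loglog₂ : ℕ → ℝ
  loglog₂ U = log₂ (1# ⊔ log₂ (fromℕ U))

{-# OPTIONS --safe #-}

-- Every level of the dyadic decomposition of [U] is sketched independently.
-- Its nodes are hashed twice into 2 ^ k buckets, each of which is split by a
-- pairwise independent sign, and the mass of a node is estimated by the signed
-- count of the lighter of its two buckets.  As x ≥ 0, the error is at most the
-- mass that collides with the node in either bucket.  The two hash functions
-- are independent and the choice of the bucket does not depend on the signs, so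
-- the error has mean zero and second moment at most (‖x‖₁ / 2 ^ k)².  With 2 ^ k
-- of order √(log U) / ε, Kolmogorov's inequality keeps all partial sums of the
-- errors along a fixed path of the tree below ε‖x‖₁ with constant probability,
-- and the median of O(log (1/δ)) repetitions makes this likely.
--
-- A rank is a sum along one path.  A quantile is found by descending the tree,
-- comparing q with the estimated ranks.  Compared with the exact paths for the
-- ranks q - εn and q + εn, the descent can leave either of them only towards the
-- other, so that the estimates need to be accurate on these two paths only.
module Submission where

open import Defs
open import Algebra.Bundles using (CommutativeRing)
import Algebra.Properties.CommutativeSemiring.Exp
import Algebra.Properties.Ring
import Algebra.Properties.Semiring.Exp
import Algebra.Properties.Semiring.Mult
import Algebra.Properties.Semiring.Sum
import Algebra.Solver.Ring as RingSolver
open import Algebra.Solver.Ring.AlmostCommutativeRing using (fromCommutativeRing; _-Raw-AlmostCommutative⟶_)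
open import Data.Bool.Base using (Bool; true; false; if_then_else_; not; T; _∧_; _xor_)
open import Data.Bool.Properties using (T?; T-≡)
open import Data.Fin.Base as Fin using (Fin; zero; suc; toℕ; fromℕ<; inject₁; splitAt; remQuot; combine; _↑ˡ_; _↑ʳ_)
import Data.Fin.Properties as Fin
open import Data.Integer.Base as ℤ using (ℤ; -[1+_]; _⊖_)
import Data.Integer.Properties as ℤ
open import Data.List.Base as List using (List; []; _∷_; allFin; cartesianProduct; filter; length; foldl)
import Data.List.Properties as List
import Data.List.Relation.Unary.Any as Any
import Data.List.Relation.Unary.Any.Properties as Any
open import Data.Maybe.Base using (Maybe; just; nothing)
open import Data.Nat.Base as ℕ using (ℕ; zero; suc; NonZero; ⌊_/2⌋)
import Data.Nat.DivMod as ℕ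
import Data.Nat.Properties as ℕ
open import Data.Nat.Tactic.RingSolver using (solve-∀)
open import Data.Product.Base as Product using (_×_; _,_; ∃; ∃-syntax; Σ-syntax; proj₁; proj₂; uncurry)
open import Data.Sum.Base as Sum using (_⊎_; inj₁; inj₂)
open import Data.Unit.Base using (⊤; tt)
open import Data.Vec.Base as Vec using (Vec; []; _∷_; lookup; head; tail)
open import Data.Vec.Functional using (Vector; updateAt; _++_)
open import Data.Vec.Functional.Properties using (lookup-++ˡ; lookup-++ʳ)
open import Function.Base using (_∘_)
open import Function.Bundles using (Equivalence)
open import Level using (0ℓ)
open import Relation.Binary.Bundles using (Poset)
open import Relation.Binary.PropositionalEquality
open import Relation.Binary.Structures using (IsDecTotalOrder)
import Relation.Binary.Reasoning.PartialOrder
open import Relation.Nullary using (¬_; yes; no; contradiction; Dec; does; proof; ofʸ; ofⁿ)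
open import Relation.Nullary.Decidable using (dec-true; dec-false; _×-dec_)
open import Relation.Unary using (Pred; Decidable)

-- The exponent 3/2 depends on unbiased estimates. There are about log U levels with order 2 ^ k
-- counters each. Nonnegative collision errors of size ‖x‖₁ / 2 ^ k would add up linearly along a
-- path and force 2 ^ k of order (log U) / ε. Independent errors of mean zero add up in variance, so
-- a square root of log U is saved. A single signed bucket would not do: one heavy colliding node
-- makes its second moment as large as ‖x‖₁² / 2 ^ k. With two independent buckets, both must be hit
-- before the lighter one is disturbed.
--
-- The second obstacle is uniformity of the constant. As δ tends to 1, log (1/δ) tends to 0, and the
-- bound no longer pays for even one repetition at accuracy ε. For ranks, the estimates are then
-- made m times coarser and a coin guesses the remaining offset, which is right often enough because
-- a success probability of only 1 - δ is required. For quantiles, log (1/(εδ)) is at least 1 if ε <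
-- 1/2, and for ε ≥ 1/2 an extreme element is a valid answer.

module OrderedField (R : RealField) where
  open RealField R public

  open CommutativeRing commutativeRing public using
    ( +-assoc; +-comm; +-identityˡ; +-identityʳ; *-assoc; *-comm; *-identityˡ; *-identityʳ
    ; zeroˡ; zeroʳ; distribˡ; distribʳ; -‿inverseʳ; -‿inverseˡ )
  open Algebra.Properties.Ring (CommutativeRing.ring commutativeRing) public using
    (-‿distribˡ-*; -‿+-comm; -0#≈0#; -‿involutive)
  open Algebra.Properties.Semiring.Sum semiring public using
    ( sum-replicate; sum-replicate-zero; ∑-distrib-+; ∑-comm; *-distribˡ-sum; *-distribʳ-sum )
  open Algebra.Properties.Semiring.Exp semiring public using (^-assocʳ)
  open Algebra.Properties.CommutativeSemiring.Exp
    (CommutativeRing.commutativeSemiring commutativeRing) public using (^-distrib-*)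
  open Algebra.Properties.Semiring.Mult semiring using (×1-homo-*; ×-homo-+; ×-assoc-*)
  open IsDecTotalOrder isDecTotalOrder public using () renaming
    ( refl to ≤-refl; trans to ≤-trans; antisym to ≤-antisym; total to ≤-total; reflexive to ≤-reflexive
    ; _≟_ to _≟ᵣ_ )

  ℝ-poset : Poset 0ℓ 0ℓ 0ℓ
  ℝ-poset = record { isPartialOrder = IsDecTotalOrder.isPartialOrder isDecTotalOrder }

  module ≤-Reasoning = Relation.Binary.Reasoning.PartialOrder ℝ-poset

  fromℕ-+ : ∀ m n → fromℕ (m ℕ.+ n) ≡ fromℕ m + fromℕ n
  fromℕ-+ = ×-homo-+ 1#

  fromℕ-* : ∀ m n → fromℕ (m ℕ.* n) ≡ fromℕ m * fromℕ n
  fromℕ-* = ×1-homo-*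

  fromℕ-1 : fromℕ 1 ≡ 1#
  fromℕ-1 = +-identityʳ 1#

  fromℕ-^ : ∀ m n → fromℕ (m ℕ.^ n) ≡ fromℕ m ^ n
  fromℕ-^ m zero    = fromℕ-1
  fromℕ-^ m (suc n) = trans (fromℕ-* m (m ℕ.^ n)) (cong (fromℕ m *_) (fromℕ-^ m n))

  ·≡fromℕ* : ∀ n x → n · x ≡ fromℕ n * x
  ·≡fromℕ* n x = sym (trans (×-assoc-* n 1# x) (cong (n ·_) (*-identityˡ x)))

  fromℤ : ℤ → ℝ
  fromℤ (ℤ.+ n)    = fromℕ n
  fromℤ -[1+ n ] = - fromℕ (suc n)

  fromℤ-neg : ∀ i → fromℤ (ℤ.- i) ≡ - fromℤ i
  fromℤ-neg (ℤ.+ zero)  = sym -0#≈0#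
  fromℤ-neg (ℤ.+ suc n) = refl
  fromℤ-neg -[1+ n ]  = sym (-‿involutive (fromℕ (suc n)))

  fromℤ-⊖ : ∀ m n → fromℤ (m ⊖ n) ≡ fromℕ m - fromℕ n
  fromℤ-⊖ m zero = trans (cong fromℤ (ℤ.⊖-≥ {m} {0} ℕ.z≤n))
    (sym (trans (cong (fromℕ m +_) -0#≈0#) (+-identityʳ _)))
  fromℤ-⊖ zero (suc n) = sym (+-identityˡ _)
  fromℤ-⊖ (suc m) (suc n) = begin
    fromℤ (suc m ⊖ suc n)                   ≡⟨ cong fromℤ (ℤ.[1+m]⊖[1+n]≡m⊖n m n) ⟩
    fromℤ (m ⊖ n)                           ≡⟨ fromℤ-⊖ m n ⟩
    a - b                                   ≡⟨ cong (_- b) (+-identityʳ a) ⟨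
    a + 0# - b                              ≡⟨ cong (λ z → a + z - b) (-‿inverseʳ 1#) ⟨
    a + (1# - 1#) - b                       ≡⟨ cong (_- b) (+-assoc a 1# (- 1#)) ⟨
    a + 1# + - 1# + - b                     ≡⟨ +-assoc (a + 1#) (- 1#) (- b) ⟩
    a + 1# + (- 1# + - b)                   ≡⟨ cong₂ _+_ (+-comm a 1#) (-‿+-comm 1# b) ⟩
    (1# + a) - (1# + b)                     ∎
    where
    open ≡-Reasoning
    a = fromℕ m
    b = fromℕ n

  fromℤ-+ : ∀ i j → fromℤ (i ℤ.+ j) ≡ fromℤ i + fromℤ j
  fromℤ-+ (ℤ.+ m)    (ℤ.+ n)    = fromℕ-+ m n
  fromℤ-+ (ℤ.+ m)    -[1+ n ] = fromℤ-⊖ m (suc n)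
  fromℤ-+ -[1+ m ] (ℤ.+ n)    = trans (fromℤ-⊖ n (suc m)) (+-comm _ _)
  fromℤ-+ -[1+ m ] -[1+ n ] = trans
    (cong -_ (trans (cong (λ z → fromℕ (suc z)) (sym (ℕ.+-suc m n))) (fromℕ-+ (suc m) (suc n))))
    (sym (-‿+-comm _ _))

  fromℤ-+* : ∀ m j → fromℤ (ℤ.+ m ℤ.* j) ≡ fromℕ m * fromℤ j
  fromℤ-+* m (ℤ.+ n)    = trans (cong fromℤ (sym (ℤ.pos-* m n))) (fromℕ-* m n)
  fromℤ-+* m -[1+ n ] = begin
    fromℤ (ℤ.+ m ℤ.* -[1+ n ])            ≡⟨ cong fromℤ (ℤ.*-comm (ℤ.+ m) -[1+ n ]) ⟩
    fromℤ (-[1+ n ] ℤ.* ℤ.+ m)            ≡⟨ cong fromℤ (ℤ.neg-distribˡ-* (ℤ.+ suc n) (ℤ.+ m)) ⟨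
    fromℤ (ℤ.- (ℤ.+ suc n ℤ.* ℤ.+ m))       ≡⟨ fromℤ-neg (ℤ.+ suc n ℤ.* ℤ.+ m) ⟩
    - fromℤ (ℤ.+ suc n ℤ.* ℤ.+ m)           ≡⟨ cong -_ (fromℤ-+* (suc n) (ℤ.+ m)) ⟩
    - (fromℕ (suc n) * fromℕ m)         ≡⟨ -‿distribˡ-* _ _ ⟩
    - fromℕ (suc n) * fromℕ m           ≡⟨ *-comm _ _ ⟩
    fromℕ m * - fromℕ (suc n)           ∎
    where open ≡-Reasoning

  fromℤ-* : ∀ i j → fromℤ (i ℤ.* j) ≡ fromℤ i * fromℤ j
  fromℤ-* (ℤ.+ m)    j = fromℤ-+* m j
  fromℤ-* -[1+ m ] j = begin
    fromℤ (-[1+ m ] ℤ.* j)         ≡⟨ cong fromℤ (ℤ.neg-distribˡ-* (ℤ.+ suc m) j) ⟨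
    fromℤ (ℤ.- (ℤ.+ suc m ℤ.* j))    ≡⟨ fromℤ-neg (ℤ.+ suc m ℤ.* j) ⟩
    - fromℤ (ℤ.+ suc m ℤ.* j)        ≡⟨ cong -_ (fromℤ-+* (suc m) j) ⟩
    - (fromℕ (suc m) * fromℤ j)    ≡⟨ -‿distribˡ-* _ _ ⟩
    - fromℕ (suc m) * fromℤ j      ∎
    where open ≡-Reasoning

  -- fromℤ, but with 1 sent to 1# itself instead of 1# + 0#, so that the ring
  -- solver can be used on terms that contain 1#.
  coefficient : ℤ → ℝ
  coefficient (ℤ.+ 1) = 1#
  coefficient i       = fromℤ i

  coefficient≡fromℤ : ∀ i → coefficient i ≡ fromℤ i
  coefficient≡fromℤ (ℤ.+ 0)           = refl
  coefficient≡fromℤ (ℤ.+ 1)           = sym fromℕ-1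
  coefficient≡fromℤ (ℤ.+ suc (suc n)) = refl
  coefficient≡fromℤ -[1+ n ]          = refl

  coefficient-homomorphism : ℤ.+-*-rawRing -Raw-AlmostCommutative⟶ fromCommutativeRing commutativeRing
  coefficient-homomorphism = record
    { ⟦_⟧    = coefficient
    ; +-homo = λ i j → homo₂ (i ℤ.+ j) i j _+_ (fromℤ-+ i j)
    ; *-homo = λ i j → homo₂ (i ℤ.* j) i j _*_ (fromℤ-* i j)
    ; -‿homo = λ i → trans (coefficient≡fromℤ (ℤ.- i)) (trans (fromℤ-neg i) (cong -_ (sym (coefficient≡fromℤ i))))
    ; 0-homo = refl
    ; 1-homo = refl
    }
    where
    homo₂ : ∀ k i j (_∙_ : ℝ → ℝ → ℝ) → fromℤ k ≡ fromℤ i ∙ fromℤ j → coefficient k ≡ coefficient i ∙ coefficient j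
    homo₂ k i j _∙_ eq = trans (coefficient≡fromℤ k)
      (trans eq (sym (cong₂ _∙_ (coefficient≡fromℤ i) (coefficient≡fromℤ j))))

  coefficient-≟ : ∀ i j → Maybe (coefficient i ≡ coefficient j)
  coefficient-≟ i j with i ℤ.≟ j
  ... | yes i≡j = just (cong coefficient i≡j)
  ... | no  _   = nothing

  open RingSolver ℤ.+-*-rawRing (fromCommutativeRing commutativeRing) coefficient-homomorphism coefficient-≟
    public using (Polynomial; solve; _:=_; _:+_; _:*_; _:-_; :-_) renaming (con to conℤ)

  con : ∀ {n} → ℕ → Polynomial n
  con k = conℤ (ℤ.+ k)

  -- Reduces an inequality to a ring identity with an explicit nonnegative remainder, so that
  -- `solve` can check the algebra.
  ≤-by : ∀ {x y} d → 0# ≤ d → y ≡ x + d → x ≤ y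
  ≤-by {x} d 0≤d refl = subst (_≤ x + d) (+-identityʳ x) (+-monoʳ-≤ x 0≤d)

  ≤⇒0≤- : ∀ {x y} → x ≤ y → 0# ≤ y - x
  ≤⇒0≤- {x} {y} x≤y =
    subst₂ _≤_ (-‿inverseˡ x) (+-comm (- x) y) (+-monoʳ-≤ (- x) x≤y)

  0≤-⇒≤ : ∀ {x y} → 0# ≤ y - x → x ≤ y
  0≤-⇒≤ {x} {y} p = ≤-by (y - x) p (solve 2 (λ x y → y := x :+ (y :- x)) refl x y)

  +-mono-≤ : ∀ {x y u v} → x ≤ y → u ≤ v → x + u ≤ y + v
  +-mono-≤ {x} {y} {u} {v} x≤y u≤v = ≤-trans (+-monoʳ-≤ x u≤v)
    (subst₂ _≤_ (+-comm v x) (+-comm v y) (+-monoʳ-≤ v x≤y))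

  +-monoˡ-≤ : ∀ z {x y} → x ≤ y → x + z ≤ y + z
  +-monoˡ-≤ z x≤y = +-mono-≤ x≤y ≤-refl

  neg-mono-≤ : ∀ {x y} → x ≤ y → - y ≤ - x
  neg-mono-≤ {x} {y} x≤y = ≤-by (y - x) (≤⇒0≤- x≤y) (solve 2 (λ x y → :- x := :- y :+ (y :- x)) refl x y)

  0≤+ : ∀ {x y} → 0# ≤ x → 0# ≤ y → 0# ≤ x + y
  0≤+ p q = subst (_≤ _) (+-identityˡ 0#) (+-mono-≤ p q)

  *-monoˡ-≤ : ∀ {z} → 0# ≤ z → ∀ {x y} → x ≤ y → z * x ≤ z * y
  *-monoˡ-≤ {z} 0≤z {x} {y} x≤y = ≤-by (z * (y - x)) (*-nonNegative 0≤z (≤⇒0≤- x≤y))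
    (solve 3 (λ x y z → z :* y := z :* x :+ z :* (y :- x)) refl x y z)

  *-monoʳ-≤ : ∀ {z} → 0# ≤ z → ∀ {x y} → x ≤ y → x * z ≤ y * z
  *-monoʳ-≤ {z} 0≤z x≤y = subst₂ _≤_ (*-comm z _) (*-comm z _) (*-monoˡ-≤ 0≤z x≤y)

  *-mono-≤ : ∀ {x y u v} → 0# ≤ x → 0# ≤ v → x ≤ y → u ≤ v → x * u ≤ y * v
  *-mono-≤ 0≤x 0≤v x≤y u≤v = ≤-trans (*-monoˡ-≤ 0≤x u≤v) (*-monoʳ-≤ 0≤v x≤y)

  ≰⇒≥ : ∀ {x y} → ¬ x ≤ y → y ≤ x
  ≰⇒≥ {x} {y} x≰y with ≤-total x y
  ... | inj₁ x≤y = contradiction x≤y x≰y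
  ... | inj₂ y≤x = y≤x

  ≰⇒> : ∀ {x y} → ¬ x ≤ y → y < x
  ≰⇒> x≰y = ≰⇒≥ x≰y , λ y≡x → x≰y (≤-reflexive (sym y≡x))

  <⇒≱ : ∀ {x y} → x < y → ¬ y ≤ x
  <⇒≱ (x≤y , x≢y) y≤x = x≢y (≤-antisym x≤y y≤x)

  <-≤-trans : ∀ {x y z} → x < y → y ≤ z → x < z
  <-≤-trans x<y y≤z = ≤-trans (proj₁ x<y) y≤z , λ { refl → <⇒≱ x<y y≤z }

  0≤x² : ∀ x → 0# ≤ x * x
  0≤x² x with ≤-total 0# x
  ... | inj₁ 0≤x = *-nonNegative 0≤x 0≤x
  ... | inj₂ x≤0 = subst (0# ≤_) (solve 1 (λ x → (:- x) :* (:- x) := x :* x) refl x)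
    (*-nonNegative 0≤-x 0≤-x)
    where
    0≤-x = subst (_≤ - x) -0#≈0# (neg-mono-≤ x≤0)

  0≤1 : 0# ≤ 1#
  0≤1 = subst (0# ≤_) (*-identityˡ 1#) (0≤x² 1#)

  0<1 : 0# < 1#
  0<1 = 0≤1 , 0≢1

  0≤fromℕ : ∀ n → 0# ≤ fromℕ n
  0≤fromℕ zero    = ≤-refl
  0≤fromℕ (suc n) = 0≤+ 0≤1 (0≤fromℕ n)

  fromℕ-mono : ∀ {m n} → m ℕ.≤ n → fromℕ m ≤ fromℕ n
  fromℕ-mono {n = n} ℕ.z≤n = 0≤fromℕ n
  fromℕ-mono (ℕ.s≤s m≤n) = +-monoʳ-≤ 1# (fromℕ-mono m≤n)

  1≤fromℕ : ∀ n → .{{NonZero n}} → 1# ≤ fromℕ n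
  1≤fromℕ (suc n) = ≤-by (fromℕ n) (0≤fromℕ n) refl

  0<fromℕ : ∀ n → .{{NonZero n}} → 0# < fromℕ n
  0<fromℕ n = <-≤-trans 0<1 (1≤fromℕ n)

  fromℕ-cancel-≤ : ∀ m n → fromℕ m ≤ fromℕ n → m ℕ.≤ n
  fromℕ-cancel-≤ zero    n       _ = ℕ.z≤n
  fromℕ-cancel-≤ (suc m) zero    p = contradiction p (<⇒≱ (0<fromℕ (suc m)))
  fromℕ-cancel-≤ (suc m) (suc n) p = ℕ.s≤s (fromℕ-cancel-≤ m n (0≤-⇒≤ (subst (0# ≤_)
    (solve 2 (λ x y → con 1 :+ y :- (con 1 :+ x) := y :- x) refl (fromℕ m) (fromℕ n)) (≤⇒0≤- p))))

  ⁻¹-inverseˡ : ∀ {x} → 0# < x → x ⁻¹ * x ≡ 1#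
  ⁻¹-inverseˡ {x} (_ , 0≢x) = trans (*-comm _ _) (⁻¹-inverseʳ x (0≢x ∘ sym))

  *-cancelˡ-≤ : ∀ {z} → 0# < z → ∀ {x y} → z * x ≤ z * y → x ≤ y
  *-cancelˡ-≤ {z} 0<z {x} {y} zx≤zy with x ≤? y
  ... | yes x≤y = x≤y
  ... | no  x≰y = ≤-reflexive (trans (sym (unit x)) (trans (cong (z ⁻¹ *_) zx≡zy) (unit y)))
    where
    zx≡zy = ≤-antisym zx≤zy (*-monoˡ-≤ (proj₁ 0<z) (≰⇒≥ x≰y))
    unit : ∀ u → z ⁻¹ * (z * u) ≡ u
    unit u = trans (sym (*-assoc _ _ _)) (trans (cong (_* u) (⁻¹-inverseˡ 0<z)) (*-identityˡ u))

  ⁻¹-nonNegative : ∀ {x} → 0# < x → 0# ≤ x ⁻¹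
  ⁻¹-nonNegative {x} 0<x = *-cancelˡ-≤ 0<x
    (subst₂ _≤_ (sym (zeroʳ x)) (trans (sym (⁻¹-inverseˡ 0<x)) (*-comm _ _)) 0≤1)

  ⁻¹-positive : ∀ {x} → 0# < x → 0# < x ⁻¹
  ⁻¹-positive {x} 0<x = ⁻¹-nonNegative 0<x , λ 0≡x⁻¹ → 0≢1 (begin
    0#         ≡⟨ zeroˡ x ⟨
    0# * x     ≡⟨ cong (_* x) 0≡x⁻¹ ⟩
    x ⁻¹ * x   ≡⟨ ⁻¹-inverseˡ 0<x ⟩
    1#         ∎)
    where open ≡-Reasoning

  *-positive : ∀ {x y} → 0# < x → 0# < y → 0# < x * y
  *-positive {x} {y} 0<x 0<y = *-nonNegative (proj₁ 0<x) (proj₁ 0<y) , λ 0≡xy →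
    proj₂ 0<y (≤-antisym (proj₁ 0<y) (*-cancelˡ-≤ 0<x (≤-reflexive (trans (sym 0≡xy) (sym (zeroʳ x))))))

  ≤⊔ʳ : ∀ x y → y ≤ x ⊔ y
  ≤⊔ʳ x y with x ≤? y
  ... | yes _   = ≤-refl
  ... | no  x≰y = ≰⇒≥ x≰y

  ≤⊔ˡ : ∀ x y → x ≤ x ⊔ y
  ≤⊔ˡ x y with x ≤? y
  ... | yes x≤y = x≤y
  ... | no  _   = ≤-refl

  ∣∣≤ : ∀ {x a} → x ≤ a → - x ≤ a → ∣ x ∣ ≤ a
  ∣∣≤ {x} x≤a -x≤a with x ≤? - x
  ... | yes _ = -x≤a
  ... | no  _ = x≤a

  0≤⇒∣∣≡ : ∀ {x} → 0# ≤ x → ∣ x ∣ ≡ x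
  0≤⇒∣∣≡ {x} 0≤x = ≤-antisym
    (∣∣≤ ≤-refl (≤-trans (subst (- x ≤_) -0#≈0# (neg-mono-≤ 0≤x)) 0≤x)) (≤⊔ˡ x (- x))

  square-mono : ∀ {x y} → 0# ≤ x → x ≤ y → x * x ≤ y * y
  square-mono 0≤x x≤y = *-mono-≤ 0≤x (≤-trans 0≤x x≤y) x≤y x≤y

  ∣∣≤⇒²≤² : ∀ {x a} → ∣ x ∣ ≤ a → x * x ≤ a * a
  ∣∣≤⇒²≤² {x} {a} ∣x∣≤a = ≤-by ((a - x) * (a + x))
    (*-nonNegative (≤⇒0≤- (≤-trans (≤⊔ˡ x (- x)) ∣x∣≤a))
      (subst (λ z → 0# ≤ a + z) (-‿involutive x) (≤⇒0≤- (≤-trans (≤⊔ʳ x (- x)) ∣x∣≤a))))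
    (solve 2 (λ x a → a :* a := x :* x :+ (a :- x) :* (a :+ x)) refl x a)

  ∣∣≰⇒²≤² : ∀ {x a} → 0# ≤ a → ¬ ∣ x ∣ ≤ a → a * a ≤ x * x
  ∣∣≰⇒²≤² {x} {a} 0≤a ∣x∣≰a with x ≤? - x | ≰⇒≥ ∣x∣≰a
  ... | yes _ | a≤-x = subst (a * a ≤_) (solve 1 (λ x → (:- x) :* (:- x) := x :* x) refl x)
    (square-mono 0≤a a≤-x)
  ... | no  _ | a≤x  = square-mono 0≤a a≤x

  sum-cong : ∀ {n} {f g : Vector ℝ n} → (∀ i → f i ≡ g i) → sum f ≡ sum g
  sum-cong {zero}  f≗g = refl
  sum-cong {suc n} f≗g = cong₂ _+_ (f≗g zero) (sum-cong (f≗g ∘ suc))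

  sum-mono : ∀ {n} {f g : Vector ℝ n} → (∀ i → f i ≤ g i) → sum f ≤ sum g
  sum-mono {zero}  f≤g = ≤-refl
  sum-mono {suc n} f≤g = +-mono-≤ (f≤g zero) (sum-mono (f≤g ∘ suc))

  sum-nonNegative : ∀ {n} {f : Vector ℝ n} → (∀ i → 0# ≤ f i) → 0# ≤ sum f
  sum-nonNegative {zero}  0≤f = ≤-refl
  sum-nonNegative {suc n} 0≤f = 0≤+ (0≤f zero) (sum-nonNegative (0≤f ∘ suc))

  sum-const : ∀ n c → sum {n} (λ _ → c) ≡ fromℕ n * c
  sum-const n c = trans (sum-replicate n) (·≡fromℕ* n c)

-- The search walks down from `n` and stops once the predecessor fails, so the result need not be
-- the least element of `P`. That failure is what later bounds a chosen depth, number of repetitions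
-- or number of buckets from above.
first-from : {P : Pred ℕ 0ℓ} → Decidable P → ∀ n → P n → ∃[ m ] P m × (∀ k → m ≡ suc k → ¬ P k)
first-from P? zero    p = 0 , p , λ _ ()
first-from P? (suc n) p with P? n
... | yes q = first-from P? n q
... | no ¬q = suc n , p , λ { _ refl → ¬q }

-- Powers, square roots and logarithms, bounded from below.

module Logarithm (R : RealField) where
  open OrderedField R

  2# : ℝ
  2# = fromℕ 2

  0≤2 : 0# ≤ 2#
  0≤2 = 0≤fromℕ 2

  ^-nonNegative : ∀ {x} → 0# ≤ x → ∀ n → 0# ≤ x ^ n
  ^-nonNegative 0≤x zero    = 0≤1
  ^-nonNegative 0≤x (suc n) = *-nonNegative 0≤x (^-nonNegative 0≤x n)

  ^-positive : ∀ {x} → 0# < x → ∀ n → 0# < x ^ n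
  ^-positive 0<x zero    = 0<1
  ^-positive 0<x (suc n) = *-positive 0<x (^-positive 0<x n)

  ^-mono : ∀ {x y} → 0# ≤ x → x ≤ y → ∀ n → x ^ n ≤ y ^ n
  ^-mono 0≤x x≤y zero    = ≤-refl
  ^-mono 0≤x x≤y (suc n) = *-mono-≤ 0≤x (^-nonNegative (≤-trans 0≤x x≤y) n) x≤y (^-mono 0≤x x≤y n)

  1≤^ : ∀ {x} → 1# ≤ x → ∀ n → 1# ≤ x ^ n
  1≤^ 1≤x zero = ≤-refl
  1≤^ {x} 1≤x (suc n) = subst (_≤ x * x ^ n) (*-identityʳ 1#)
    (*-mono-≤ 0≤1 (^-nonNegative (≤-trans 0≤1 1≤x) n) 1≤x (1≤^ 1≤x n))

  fromℕ≤2^ : ∀ n → fromℕ n ≤ 2# ^ n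
  fromℕ≤2^ zero    = 0≤1
  fromℕ≤2^ (suc n) = subst (1# + fromℕ n ≤_)
    (solve 1 (λ x → x :+ x := con 2 :* x) refl (2# ^ n))
    (+-mono-≤ (1≤^ (1≤fromℕ 2) n) (fromℕ≤2^ n))

  2^-cancel-≤ : ∀ m n → 2# ^ m ≤ 2# ^ n → m ℕ.≤ n
  2^-cancel-≤ m n p = ℕ.≮⇒≥ λ n<m → ℕ.<⇒≱ (ℕ.^-monoʳ-< 2 (ℕ.s≤s (ℕ.s≤s ℕ.z≤n)) n<m)
    (fromℕ-cancel-≤ _ _ (subst₂ _≤_ (sym (fromℕ-^ 2 m)) (sym (fromℕ-^ 2 n)) p))

  -- An element lies below `sup` only once its set is known to be bounded: with y ≤ 2 ^ N from the
  -- Archimedean axiom, 2 ^ p ≤ y ^ suc q forces p ≤ N * suc q. Lower bounds are the relevant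
  -- direction for `log₂` and `√_`, because both occur in the word bound that is to be reached.
  log₂-lower : ∀ {y z} p q → 0# ≤ y → fromℕ (suc q) * z ≡ fromℕ p → 2# ^ p ≤ y ^ suc q → z ≤ log₂ y
  log₂-lower {y} {z} p q 0≤y qz≡p 2^p≤y^q =
    sup-upper _ (z , p , q , qz≡p , 2^p≤y^q) (fromℕ N , bound) z (p , q , qz≡p , 2^p≤y^q)
    where
    N = proj₁ (archimedean y)
    y≤2^N : y ≤ 2# ^ N
    y≤2^N = ≤-trans (proj₂ (archimedean y)) (fromℕ≤2^ N)
    bound : ∀ z → (∃[ p ] ∃[ q ] fromℕ (suc q) * z ≡ fromℕ p × 2# ^ p ≤ y ^ suc q) → z ≤ fromℕ N
    bound z (p , q , qz≡p , 2^p≤y^q) = *-cancelˡ-≤ (0<fromℕ (suc q))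
      (subst₂ _≤_ (sym qz≡p) (trans (fromℕ-* N (suc q)) (*-comm _ _)) (fromℕ-mono
        (2^-cancel-≤ p (N ℕ.* suc q) (≤-trans 2^p≤y^q
          (subst (y ^ suc q ≤_) (^-assocʳ 2# N (suc q)) (^-mono 0≤y y≤2^N (suc q)))))))

  log₂-lower-ℕ : ∀ {y} p → 0# ≤ y → 2# ^ p ≤ y → fromℕ p ≤ log₂ y
  log₂-lower-ℕ {y} p 0≤y 2^p≤y = log₂-lower p 0 0≤y
    (trans (cong (_* fromℕ p) fromℕ-1) (*-identityˡ _)) (subst (2# ^ p ≤_) (sym (*-identityʳ y)) 2^p≤y)

  log₂-nonNegative : ∀ {y} → 1# ≤ y → 0# ≤ log₂ y
  log₂-nonNegative 1≤y = log₂-lower-ℕ 0 (≤-trans 0≤1 1≤y) 1≤y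

  1≤log₂ : ∀ {y} → 2# ≤ y → 1# ≤ log₂ y
  1≤log₂ 2≤y = subst (_≤ log₂ _) fromℕ-1
    (log₂-lower-ℕ 1 (≤-trans 0≤2 2≤y) (subst (_≤ _) (sym (*-identityʳ 2#)) 2≤y))

  y<y+1 : ∀ y → y < y + 1#
  y<y+1 y = ≤-by 1# 0≤1 refl , λ y≡y+1 → 0≢1 (begin
    0#           ≡⟨ -‿inverseʳ y ⟨
    y - y        ≡⟨ cong (_- y) y≡y+1 ⟩
    y + 1# - y   ≡⟨ solve 1 (λ y → y :+ con 1 :- y := con 1) refl y ⟩
    1#           ∎)
    where open ≡-Reasoning

  √-lower : ∀ {y z} → 0# ≤ y → z * z ≤ y → z ≤ √ y
  √-lower {y} {z} 0≤y z²≤y = sup-upper _ (z , z²≤y) (1# + y , bound) z z²≤y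
    where
    0≤1+y = 0≤+ 0≤1 0≤y
    bound : ∀ z → z * z ≤ y → z ≤ 1# + y
    bound z z²≤y with z ≤? 1# + y
    ... | yes z≤1+y = z≤1+y
    ... | no  z≰1+y = contradiction (≤-trans (square-mono 0≤1+y (≰⇒≥ z≰1+y)) z²≤y)
      (<⇒≱ (<-≤-trans (y<y+1 y) (≤-by (y + y * y) (0≤+ 0≤y (0≤x² y))
        (solve 1 (λ y → (con 1 :+ y) :* (con 1 :+ y) := y :+ con 1 :+ (y :+ y :* y)) refl y))))

  √-nonNegative : ∀ {y} → 0# ≤ y → 0# ≤ √ y
  √-nonNegative {y} 0≤y = √-lower 0≤y (subst (_≤ y) (sym (zeroˡ 0#)) 0≤y)

  bernoulli : ∀ {e} → 0# ≤ e → ∀ n → 1# + fromℕ n * e ≤ (1# + e) ^ n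
  bernoulli {e} 0≤e zero    = ≤-reflexive (trans (cong (1# +_) (zeroˡ e)) (+-identityʳ 1#))
  bernoulli {e} 0≤e (suc n) = ≤-trans
    (≤-by (fromℕ n * (e * e)) (*-nonNegative (0≤fromℕ n) (0≤x² e))
      (solve 2 (λ n e → (con 1 :+ e) :* (con 1 :+ n :* e) :=
         con 1 :+ (con 1 :+ n) :* e :+ n :* (e :* e)) refl (fromℕ n) e))
    (*-monoˡ-≤ (0≤+ 0≤1 0≤e) (bernoulli 0≤e n))

  0<1-δ : ∀ {δ} → δ < 1# → 0# < 1# - δ
  0<1-δ {δ} δ<1 = ≤⇒0≤- (proj₁ δ<1) , λ 0≡e → proj₂ δ<1 (trans (sym (+-identityˡ δ))
    (trans (cong (_+ δ) 0≡e) (solve 1 (λ δ → con 1 :- δ :+ δ := con 1) refl δ)))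

  -- With e = 1 - δ, the natural number Q is chosen such that 1 ≤ Q e ≤ 2. As δ (1 + e) = 1 - e² ≤
  -- 1, Bernoulli's inequality gives δ⁻¹ ^ Q ≥ (1 + e) ^ Q ≥ 1 + Q e ≥ 2. Hence 1 / Q ≤
  -- `log₂ (δ ⁻¹)`, while e ≤ 2 / Q. This is what the rank bound still offers when δ is close to 1.
  1-δ≤log₂ : ∀ {δ} → 0# < δ → δ < 1# → 1# - δ ≤ 2# * log₂ (δ ⁻¹)
  1-δ≤log₂ {δ} 0<δ δ<1 with first-from (λ n → 1# ≤? fromℕ n * (1# - δ)) N 1≤Ne
    where
    e = 1# - δ
    0<e = 0<1-δ δ<1
    N = proj₁ (archimedean (e ⁻¹))
    1≤Ne : 1# ≤ fromℕ N * e
    1≤Ne = subst (_≤ fromℕ N * e) (⁻¹-inverseˡ 0<e) (*-monoʳ-≤ (proj₁ 0<e) (proj₂ (archimedean (e ⁻¹))))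
  ... | zero  , 1≤0 , _ = contradiction (subst (1# ≤_) (zeroˡ _) 1≤0) (<⇒≱ 0<1)
  ... | suc q , 1≤Qe , qe≱1 = *-cancelˡ-≤ (0<fromℕ (suc q)) (≤-trans Qe≤2
        (subst (2# ≤_) (solve 3 (λ a Q l → a :* (Q :* l) := Q :* (a :* l)) refl 2# Q (log₂ (δ ⁻¹)))
          (subst (_≤ 2# * (Q * log₂ (δ ⁻¹))) (*-identityʳ 2#) (*-monoˡ-≤ 0≤2
            (subst (_≤ Q * log₂ (δ ⁻¹)) (⁻¹-inverseʳ Q (λ Q≡0 → proj₂ 0<Q (sym Q≡0)))
              (*-monoˡ-≤ (proj₁ 0<Q) Q⁻¹≤log))))))
    where
    e = 1# - δ
    Q = fromℕ (suc q)
    0<Q = 0<fromℕ (suc q)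
    0≤e = ≤⇒0≤- (proj₁ δ<1)
    e≤1 : e ≤ 1#
    e≤1 = ≤-by δ (proj₁ 0<δ) (solve 1 (λ δ → con 1 := con 1 :- δ :+ δ) refl δ)
    Qe≤2 : Q * e ≤ 2#
    Qe≤2 = subst (_≤ 2#) (sym (trans (distribʳ e 1# (fromℕ q)) (cong (_+ fromℕ q * e) (*-identityˡ e))))
      (subst (e + fromℕ q * e ≤_) (cong (1# +_) (sym fromℕ-1)) (+-mono-≤ e≤1 (≰⇒≥ (qe≱1 q refl))))
    1+e≤δ⁻¹ : 1# + e ≤ δ ⁻¹
    1+e≤δ⁻¹ = *-cancelˡ-≤ 0<δ (≤-by (e * e) (0≤x² e) (trans (⁻¹-inverseʳ δ (λ δ≡0 → proj₂ 0<δ (sym δ≡0)))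
      (solve 1 (λ δ → con 1 := δ :* (con 1 :+ (con 1 :- δ)) :+ (con 1 :- δ) :* (con 1 :- δ)) refl δ)))
    Q⁻¹≤log : Q ⁻¹ ≤ log₂ (δ ⁻¹)
    Q⁻¹≤log = log₂-lower 1 q (⁻¹-nonNegative 0<δ)
      (trans (⁻¹-inverseʳ Q (λ Q≡0 → proj₂ 0<Q (sym Q≡0))) (sym fromℕ-1))
      (subst (_≤ (δ ⁻¹) ^ suc q) (sym (*-identityʳ 2#))
        (≤-trans (subst (_≤ 1# + Q * e) (cong (1# +_) (sym fromℕ-1)) (+-monoʳ-≤ 1# 1≤Qe))
          (≤-trans (bernoulli 0≤e (suc q)) (^-mono (0≤+ 0≤1 0≤e) 1+e≤δ⁻¹ (suc q)))))

-- Counting outcomes, and sums of indicators.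

length-filter-cartesianProduct :
  {A B : Set} {P : Pred (A × B) 0ℓ} (P? : Decidable P) {H : Pred A 0ℓ} (H? : Decidable H)
  (xs : List A) (ys : List B) → (∀ x → H x → Any.Any (λ y → P (x , y)) ys) →
  length (filter H? xs) ℕ.≤ length (filter P? (cartesianProduct xs ys))
length-filter-cartesianProduct P? H? [] ys h = ℕ.z≤n
length-filter-cartesianProduct P? H? (x ∷ xs) ys h = begin
  length (filter H? (x ∷ xs))
    ≤⟨ first ⟩
  length (filter P? (List.map (x ,_) ys)) ℕ.+ length (filter H? xs)
    ≤⟨ ℕ.+-monoʳ-≤ _ (length-filter-cartesianProduct P? H? xs ys h) ⟩
  length (filter P? (List.map (x ,_) ys)) ℕ.+ length (filter P? (cartesianProduct xs ys))
    ≡⟨ List.length-++ (filter P? (List.map (x ,_) ys)) ⟨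
  length (filter P? (List.map (x ,_) ys) List.++ filter P? (cartesianProduct xs ys))
    ≡⟨ cong length (List.filter-++ P? (List.map (x ,_) ys) _) ⟨
  length (filter P? (List.map (x ,_) ys List.++ cartesianProduct xs ys)) ∎
  where
  open ℕ.≤-Reasoning
  first : length (filter H? (x ∷ xs)) ℕ.≤ length (filter P? (List.map (x ,_) ys)) ℕ.+ length (filter H? xs)
  first with H? x
  ... | yes hx = ℕ.+-monoˡ-≤ (length (filter H? xs)) (List.filter-some P? (Any.map⁺ (h x hx)))
  ... | no  _  = ℕ.m≤n+m _ _

length-cartesianProduct : {A B : Set} (xs : List A) (ys : List B) →
  length (cartesianProduct xs ys) ≡ length xs ℕ.* length ys
length-cartesianProduct []       ys = refl
length-cartesianProduct (x ∷ xs) ys = trans (List.length-++ (List.map (x ,_) ys))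
  (cong₂ ℕ._+_ (List.length-map (x ,_) ys) (length-cartesianProduct xs ys))

module Indicator (R : RealField) where
  open OrderedField R

  𝟙 : Bool → ℝ
  𝟙 b = if b then 1# else 0#

  0≤𝟙 : ∀ b → 0# ≤ 𝟙 b
  0≤𝟙 true  = 0≤1
  0≤𝟙 false = ≤-refl

  𝟙≤1 : ∀ b → 𝟙 b ≤ 1#
  𝟙≤1 true  = ≤-refl
  𝟙≤1 false = 0≤1

  𝟙-not : ∀ b → 𝟙 b + 𝟙 (not b) ≡ 1#
  𝟙-not true  = +-identityʳ 1#
  𝟙-not false = +-identityˡ 1#

  𝟙-* : ∀ b x → 𝟙 b * x ≡ (if b then x else 0#)
  𝟙-* true  x = *-identityˡ x
  𝟙-* false x = zeroˡ x

  length-filter-tabulate : ∀ {A : Set} {H : Pred A 0ℓ} (H? : Decidable H) {n} (f : Fin n → A) →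
    fromℕ (length (filter H? (List.tabulate f))) ≡ sum (λ i → 𝟙 (does (H? (f i))))
  length-filter-tabulate H? {zero}  f = refl
  length-filter-tabulate H? {suc n} f with H? (f zero)
  ... | yes _ = cong (1# +_) (length-filter-tabulate H? (f ∘ suc))
  ... | no  _ = trans (length-filter-tabulate H? (f ∘ suc)) (sym (+-identityˡ _))

  sum-updateAt : ∀ {n} (m : Vector ℝ n) (x : Vector ℝ n) u Δ →
    sum (λ v → m v * updateAt x u (_+ Δ) v) ≡ sum (λ v → m v * x v) + m u * Δ
  sum-updateAt m x zero    Δ = solve 4 (λ a b s d → a :* (b :+ d) :+ s := a :* b :+ s :+ a :* d) refl
    (m zero) (x zero) (sum (λ v → m (suc v) * x (suc v))) Δ
  sum-updateAt m x (suc u) Δ = trans (cong (m zero * x zero +_) (sum-updateAt (m ∘ suc) (x ∘ suc) u Δ))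
    (sym (+-assoc _ _ _))

  sum-splitAt : ∀ m n (f : Fin m ⊎ Fin n → ℝ) → sum (f ∘ splitAt m) ≡ sum (f ∘ inj₁) + sum (f ∘ inj₂)
  sum-splitAt zero    n f = sym (+-identityˡ _)
  sum-splitAt (suc m) n f = trans (cong (f (inj₁ zero) +_) (sum-splitAt m n (f ∘ Sum.map₁ suc)))
    (sym (+-assoc _ _ _))

  sum-remQuot : ∀ m n (f : Fin m × Fin n → ℝ) →
    sum (f ∘ remQuot {m} n) ≡ sum (λ i → sum (λ j → f (i , j)))
  sum-remQuot zero    n f = refl
  sum-remQuot (suc m) n f = begin
    sum (f ∘ remQuot {suc m} n)
      ≡⟨ sum-cong (λ i → cong f (unfold (splitAt n i))) ⟩
    sum (g ∘ splitAt n)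
      ≡⟨ sum-splitAt n (m ℕ.* n) g ⟩
    sum (λ j → f (zero , j)) + sum (g ∘ inj₂)
      ≡⟨ cong (sum (λ j → f (zero , j)) +_) (sum-remQuot m n (f ∘ Product.map₁ suc)) ⟩
    sum (λ i → sum (λ j → f (i , j))) ∎
    where
    open ≡-Reasoning
    branch : Fin n ⊎ Fin (m ℕ.* n) → Fin (suc m) × Fin n
    branch = Sum.[ (zero ,_) , Product.map₁ suc ∘ remQuot {m} n ]′
    g = f ∘ branch
    unfold : ∀ s → Product.swap (Sum.[ (_, zero) , Product.map₂ suc ∘ Fin.quotRem {m} n ]′ s) ≡ branch s
    unfold (inj₁ _) = refl
    unfold (inj₂ _) = refl

-- Finite probability spaces, and linear sketches that keep a random seed.

module Probability (R : RealField) (w : ℕ) where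
  open OrderedField R
  open Indicator R
  open Streaming R

  Word : Set
  Word = Fin (2 ℕ.^ w)

  -- A finite probability space whose points are stored in `size` control words.
  record Space (Carrier : Set) : Set where
    field
      count size : ℕ
      count≢0    : NonZero count
      point      : Fin count → Carrier
      store      : Carrier → Vector Word size
      load       : Vector Word size → Carrier
      -- The hypothesis is pointwise because restricting `store A a ++ store B b` to either half
      -- gives back that half only pointwise.
      load-store : ∀ {v} c → (∀ i → v i ≡ store c i) → load v ≡ c

    cardinality : ℝ
    cardinality = fromℕ count

    -- Expectations are not normalised. Probabilistic inequalities compare totals, with
    -- `cardinality` as a factor on the other side, so that no division occurs.
    total : (Carrier → ℝ) → ℝ
    total f = sum (f ∘ point)

    0<cardinality : 0# < cardinality
    0<cardinality = 0<fromℕ count {{count≢0}}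

    total-cong : ∀ {f g} → (∀ c → f c ≡ g c) → total f ≡ total g
    total-cong f≗g = sum-cong (f≗g ∘ point)

    total-mono : ∀ {f g} → (∀ c → f c ≤ g c) → total f ≤ total g
    total-mono f≤g = sum-mono (f≤g ∘ point)

    total-const : ∀ a → total (λ _ → a) ≡ cardinality * a
    total-const = sum-const count

    total-+ : ∀ f g → total (λ c → f c + g c) ≡ total f + total g
    total-+ f g = ∑-distrib-+ (f ∘ point) (g ∘ point)

    total-*ˡ : ∀ a f → total (λ c → a * f c) ≡ a * total f
    total-*ˡ a f = sym (*-distribˡ-sum a (f ∘ point))

    total-*ʳ : ∀ a f → total (λ c → f c * a) ≡ total f * a
    total-*ʳ a f = sym (*-distribʳ-sum a (f ∘ point))

    total-sum : ∀ {n} (f : Carrier → Fin n → ℝ) → total (λ c → sum (f c)) ≡ sum (λ i → total (λ c → f c i))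
    total-sum f = ∑-comm (f ∘ point)

    total-nonNegative : ∀ {f} → (∀ c → 0# ≤ f c) → 0# ≤ total f
    total-nonNegative 0≤f = sum-nonNegative (0≤f ∘ point)

  open Space

  word : Space Word
  word = record
    { count = 2 ℕ.^ w ; size = 1 ; count≢0 = ℕ.m^n≢0 2 w
    ; point = λ i → i ; store = λ c _ → c ; load = λ v → v zero ; load-store = λ c eq → eq zero }

  trivial : Space ⊤
  trivial = record
    { count = 1 ; size = 0 ; count≢0 = _
    ; point = _ ; store = λ _ () ; load = _ ; load-store = λ _ _ → refl }

  infixr 7 _⊗_
  infixl 8 _⋆_

  _⊗_ : {X Y : Set} → Space X → Space Y → Space (X × Y)
  A ⊗ B = record
    { count      = count A ℕ.* count B
    ; size       = size A ℕ.+ size B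
    ; count≢0    = ℕ.m*n≢0 (count A) (count B) {{count≢0 A}} {{count≢0 B}}
    ; point      = Product.map (point A) (point B) ∘ remQuot {count A} (count B)
    ; store      = λ { (a , b) → store A a ++ store B b }
    ; load       = λ v → load A (λ i → v (i ↑ˡ size B)) , load B (λ i → v (size A ↑ʳ i))
    ; load-store = λ { (a , b) eq → cong₂ _,_
        (load-store A a (λ i → trans (eq _) (lookup-++ˡ (store A a) (store B b) i)))
        (load-store B b (λ i → trans (eq _) (lookup-++ʳ (store A a) (store B b) i))) }
    }

  _⋆_ : {X : Set} → Space X → ∀ n → Space (Vec X n)
  S ⋆ zero  = record
    { count = 1 ; size = 0 ; count≢0 = _
    ; point = λ _ → [] ; store = λ _ () ; load = λ _ → [] ; load-store = λ { [] _ → refl } }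
  S ⋆ suc n = record
    { count      = count S×Sⁿ
    ; size       = size S×Sⁿ
    ; count≢0    = count≢0 S×Sⁿ
    ; point      = uncurry _∷_ ∘ point S×Sⁿ
    ; store      = λ { (c ∷ cs) → store S×Sⁿ (c , cs) }
    ; load       = uncurry _∷_ ∘ load S×Sⁿ
    ; load-store = λ { (c ∷ cs) eq → cong (uncurry _∷_) (load-store S×Sⁿ (c , cs) eq) }
    }
    where
    S×Sⁿ = S ⊗ S ⋆ n

  total-⊗ : ∀ {X Y} (A : Space X) (B : Space Y) f →
    total (A ⊗ B) f ≡ total A (λ a → total B (λ b → f (a , b)))
  total-⊗ A B f = sum-remQuot (count A) (count B) (f ∘ Product.map (point A) (point B))

  total-∷ : ∀ {X} (S : Space X) n f → total (S ⋆ suc n) f ≡ total S (λ c → total (S ⋆ n) (λ cs → f (c ∷ cs)))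
  total-∷ S n f = total-⊗ S (S ⋆ n) (f ∘ uncurry _∷_)

  cardinality-⊗ : ∀ {X Y} (A : Space X) (B : Space Y) → cardinality (A ⊗ B) ≡ cardinality A * cardinality B
  cardinality-⊗ A B = fromℕ-* (count A) (count B)

  size-⋆ : ∀ {X} (S : Space X) n → size (S ⋆ n) ≡ n ℕ.* size S
  size-⋆ S zero    = refl
  size-⋆ S (suc n) = cong (size S ℕ.+_) (size-⋆ S n)

  -- A seed in `H` is credited with a single one of its coins. An answer that is right only for a
  -- guessed coin is therefore admissible, at the price of a factor `coins` in the bound required
  -- for `H`.
  answersWithProbability≥ : ∀ {U Query Answer} (A : Algorithm U w Query Answer) → let open Algorithm A in
    ∀ p σ query {Good} (good? : Decidable Good) {H : Pred (Fin seeds) 0ℓ} (H? : Decidable H) →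
    (∀ s → H s → ∃[ c ] Good (output σ query (s , c))) →
    p * (fromℕ seeds * fromℕ coins) ≤ sum (λ s → 𝟙 (does (H? s))) →
    AnswersWithProbability≥ p σ query good?
  answersWithProbability≥ A p σ query {Good} good? H? good p≤ = subst (λ n → p * n ≤ fromℕ (length (filter correct? outcomes)))
    (sym (trans (cong fromℕ length-outcomes) (fromℕ-* seeds coins)))
    (≤-trans p≤ (subst (_≤ fromℕ (length (filter correct? outcomes))) (length-filter-tabulate H? (λ s → s)) (fromℕ-mono
      (length-filter-cartesianProduct correct? H? (allFin seeds) (allFin coins)
        (λ s h → Any.tabulate⁺ (proj₁ (good s h)) (proj₂ (good s h)))))))
    where
    open Algorithm A
    correct? = λ ω → good? (output σ query ω)
    length-outcomes : length outcomes ≡ seeds ℕ.* coins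
    length-outcomes = trans (length-cartesianProduct (allFin seeds) (allFin coins))
      (cong₂ ℕ._*_ (List.length-tabulate {n = seeds} (λ s → s)) (List.length-tabulate {n = coins} (λ c → c)))

  -- A sketch keeps its seed ω unchanged; counter `suc i` sums the updates at
  -- the elements that `select ω` assigns to it, and counter zero sums all updates.
  module Sketch {U cells m : ℕ} (m≢0 : NonZero m) {X Query Answer : Set} (Ω : Space X)
    (select : X → Fin U → Fin cells → Bool)
    (respond : X → Vector ℝ cells → ℝ → Fin m → Query → Answer) where

    Counts : X → Vector ℝ U → Vector ℝ cells → Set
    Counts ω x cs = ∀ i → cs i ≡ sum (λ v → 𝟙 (select ω v i) * x v)

    algorithm : Algorithm U w Query Answer
    algorithm = record
      { words    = size Ω
      ; counters = suc cells
      ; seeds    = count Ω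
      ; coins    = m
      ; seeds≢0  = count≢0 Ω
      ; coins≢0  = m≢0
      ; initial  = store Ω ∘ point Ω
      ; nextWord = λ M _ → Memory.word M
      ; action   = λ { M (u , _) zero    → add
                     ; M (u , _) (suc i) → if select (load Ω (Memory.word M)) u i then add else keep }
      ; answer   = λ M → respond (load Ω (Memory.word M)) (Memory.counter M ∘ suc) (Memory.counter M zero)
      }

    open Algorithm algorithm using (State; start; step; output; AnswersWithProbability≥)

    word-foldl : ∀ σ M → Memory.word (foldl step M σ) ≡ Memory.word M
    word-foldl []      M = refl
    word-foldl (e ∷ σ) M = word-foldl σ (step M e)

    Correct : State → Vector ℝ U → Set
    Correct M x = Counts (load Ω (Memory.word M)) x (Memory.counter M ∘ suc) × Memory.counter M zero ≡ sum x

    step-correct : ∀ M x e → Correct M x → Correct (step M e) (apply x e)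
    step-correct M x (u , Δ) (counts , all) =
      (λ i → trans (selected (select ω u i) (counts i)) (sym (sum-updateAt (λ v → 𝟙 (select ω v i)) x u Δ))) ,
      trans (cong (_+ Δ) all) (sym (begin
        sum (apply x (u , Δ))                       ≡⟨ sum-cong {U} (λ v → *-identityˡ _) ⟨
        sum (λ v → 1# * apply x (u , Δ) v)          ≡⟨ sum-updateAt (λ _ → 1#) x u Δ ⟩
        sum (λ v → 1# * x v) + 1# * Δ               ≡⟨ cong₂ _+_ (sum-cong (λ v → *-identityˡ (x v))) (*-identityˡ Δ) ⟩
        sum x + Δ                                   ∎))
      where
      open ≡-Reasoning
      ω = load Ω (Memory.word M)
      selected : ∀ b {c s} → c ≡ s → act (if b then add else keep) Δ c ≡ s + 𝟙 b * Δ
      selected true  refl = cong (_ +_) (sym (*-identityˡ Δ))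
      selected false refl = sym (trans (cong (_ +_) (zeroˡ Δ)) (+-identityʳ _))

    foldl-correct : ∀ σ M x → Correct M x → Correct (foldl step M σ) (foldl apply x σ)
    foldl-correct []      M x c = c
    foldl-correct (e ∷ σ) M x c = foldl-correct σ (step M e) (apply x e) (step-correct M x e c)

    start-correct : ∀ s → Correct (start s) 0ᵥ
    start-correct s = (λ i → sym (trans (sum-cong {U} (λ v → zeroʳ _)) (sum-replicate-zero U))) ,
      sym (sum-replicate-zero U)

    answersWithProbability : ∀ p σ query {Good} (good? : Decidable Good) {H : Pred X 0ℓ} (H? : Decidable H) →
      (∀ ω cs → Counts ω (produced σ) cs → H ω → ∃[ c ] Good (respond ω cs (sum (produced σ)) c query)) →
      p * (cardinality Ω * fromℕ m) ≤ total Ω (λ ω → 𝟙 (does (H? ω))) →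
      AnswersWithProbability≥ p σ query good?
    answersWithProbability p σ query {Good} good? {H} H? good p≤ =
      answersWithProbability≥ algorithm p σ query good? (H? ∘ point Ω) good′ p≤
      where
      good′ : ∀ s → H (point Ω s) → ∃[ c ] Good (output σ query (s , c))
      good′ s h with foldl step (start s) σ | word-foldl σ (start s) | foldl-correct σ (start s) 0ᵥ (start-correct s)
      ... | M | word≡ | counts , all rewrite all = good ω (Memory.counter M ∘ suc) counts (subst H (sym ω≡) h)
        where
        ω = load Ω (Memory.word M)
        ω≡ : ω ≡ point Ω s
        ω≡ = load-store Ω (point Ω s) (λ i → cong (λ f → f i) word≡)

-- Pairwise independent bits from inner products modulo 2.

odd : ℕ → Bool
odd zero          = false
odd (suc zero)    = true
odd (suc (suc n)) = odd n

odd-half-injective : ∀ m n → odd m ≡ odd n → ⌊ m /2⌋ ≡ ⌊ n /2⌋ → m ≡ n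
odd-half-injective zero          zero          _  _  = refl
odd-half-injective zero          (suc zero)    () _
odd-half-injective zero          (suc (suc n)) _  ()
odd-half-injective (suc zero)    zero          () _
odd-half-injective (suc zero)    (suc zero)    _  _  = refl
odd-half-injective (suc zero)    (suc (suc n)) _  ()
odd-half-injective (suc (suc m)) zero          _  ()
odd-half-injective (suc (suc m)) (suc zero)    _  ()
odd-half-injective (suc (suc m)) (suc (suc n)) o≡ h≡ =
  cong (λ k → suc (suc k)) (odd-half-injective m n o≡ (ℕ.suc-injective h≡))

⌊n/2⌋<k : ∀ n k → n ℕ.< 2 ℕ.* k → ⌊ n /2⌋ ℕ.< k
⌊n/2⌋<k n k n<2k = ℕ.≰⇒> λ k≤ → ℕ.<⇒≱ n<2k (ℕ.≤-trans
  (ℕ.≤-trans (ℕ.≤-reflexive (cong (k ℕ.+_) (ℕ.+-identityʳ k))) (ℕ.+-mono-≤ k≤ (ℕ.≤-trans k≤ (ℕ.⌊n/2⌋≤⌈n/2⌉ n))))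
  (ℕ.≤-reflexive (ℕ.⌊n/2⌋+⌈n/2⌉≡n n)))

_==_ : Bool → Bool → Bool
true  == b = b
false == b = not b

==-refl : ∀ b → (b == b) ≡ true
==-refl true  = refl
==-refl false = refl

_==ᵥ_ : ∀ {k} → Vec Bool k → Vec Bool k → Bool
[]       ==ᵥ []       = true
(a ∷ as) ==ᵥ (b ∷ bs) = (a == b) ∧ (as ==ᵥ bs)

==ᵥ-refl : ∀ {k} (v : Vec Bool k) → (v ==ᵥ v) ≡ true
==ᵥ-refl []       = refl
==ᵥ-refl (b ∷ bs) = trans (cong (_∧ (bs ==ᵥ bs)) (==-refl b)) (==ᵥ-refl bs)

isOne : Fin 2 → Bool
isOne zero    = false
isOne (suc _) = true

-- The inner product modulo 2 of the binary expansions of r and n.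
bit : ∀ w → Fin (2 ℕ.^ w) → ℕ → Bool
bit zero    r n = false
bit (suc w) r n = (isOne (proj₁ br) ∧ odd n) xor bit w (proj₂ br) ⌊ n /2⌋
  where br = remQuot {2} (2 ℕ.^ w) r

module Characters (R : RealField) where
  open OrderedField R
  open Indicator R
  open Logarithm R using (2#; 0≤2)

  χ : Bool → ℝ
  χ true  = - 1#
  χ false = 1#

  χ-xor : ∀ a b → χ (a xor b) ≡ χ a * χ b
  χ-xor true  true  = solve 0 (con 1 := (:- con 1) :* (:- con 1)) refl
  χ-xor true  false = sym (*-identityʳ _)
  χ-xor false b     = sym (*-identityˡ _)

  𝟙-∧ : ∀ a b → 𝟙 (a ∧ b) ≡ 𝟙 a * 𝟙 b
  𝟙-∧ true  b = sym (*-identityˡ _)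
  𝟙-∧ false b = sym (zeroˡ _)

  -- Orthogonality of Walsh characters. The sum over the first digit of the seed contributes the
  -- factor 1 + `χ (odd m) * χ (odd n)`, which vanishes if the parities differ. If they agree, the
  -- halves of `m` and `n` differ and the induction hypothesis applies to them.
  bit-orthogonal : ∀ w m n → m ℕ.< 2 ℕ.^ w → n ℕ.< 2 ℕ.^ w → m ≢ n →
    sum (λ r → χ (bit w r m) * χ (bit w r n)) ≡ 0#
  bit-orthogonal zero    zero    zero    _ _ m≢n = contradiction refl m≢n
  bit-orthogonal zero    (suc m) n (ℕ.s≤s ()) _ _
  bit-orthogonal zero    zero    (suc n) _ (ℕ.s≤s ()) _
  bit-orthogonal (suc w) m       n       m< n< m≢n = begin
    sum (λ r → χ (bit (suc w) r m) * χ (bit (suc w) r n))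
      ≡⟨ sum-remQuot 2 (2 ℕ.^ w) (λ { (b , r) → χ ((isOne b ∧ odd m) xor bit w r ⌊ m /2⌋) *
                                                χ ((isOne b ∧ odd n) xor bit w r ⌊ n /2⌋) }) ⟩
    row false + (row true + 0#)
      ≡⟨ cong₂ (λ a b → a + (b + 0#)) (factor false) (factor true) ⟩
    1# * 1# * S + (χ (odd m) * χ (odd n) * S + 0#)
      ≡⟨ solve 3 (λ a b s → con 1 :* con 1 :* s :+ (a :* b :* s :+ con 0) := (con 1 :+ a :* b) :* s) refl
           (χ (odd m)) (χ (odd n)) S ⟩
    (1# + χ (odd m) * χ (odd n)) * S
      ≡⟨ vanish (odd m) (odd n) (odd-half-injective m n) ⟩
    0# ∎
    where
    open ≡-Reasoning
    S = sum (λ r → χ (bit w r ⌊ m /2⌋) * χ (bit w r ⌊ n /2⌋))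
    row : Bool → ℝ
    row b = sum (λ r → χ ((b ∧ odd m) xor bit w r ⌊ m /2⌋) * χ ((b ∧ odd n) xor bit w r ⌊ n /2⌋))
    factor : ∀ b → row b ≡ χ (b ∧ odd m) * χ (b ∧ odd n) * S
    factor b = trans (sum-cong (λ r → trans
        (cong₂ _*_ (χ-xor (b ∧ odd m) (bit w r ⌊ m /2⌋)) (χ-xor (b ∧ odd n) (bit w r ⌊ n /2⌋)))
        (solve 4 (λ a p c q → a :* p :* (c :* q) := a :* c :* (p :* q)) refl
          (χ (b ∧ odd m)) (χ (bit w r ⌊ m /2⌋)) (χ (b ∧ odd n)) (χ (bit w r ⌊ n /2⌋)))))
      (sym (*-distribˡ-sum (χ (b ∧ odd m) * χ (b ∧ odd n)) (λ r → χ (bit w r ⌊ m /2⌋) * χ (bit w r ⌊ n /2⌋))))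
    same : ⌊ m /2⌋ ≢ ⌊ n /2⌋ → ∀ a → a * S ≡ 0#
    same h≢ a = trans (cong (a *_)
      (bit-orthogonal w ⌊ m /2⌋ ⌊ n /2⌋ (⌊n/2⌋<k m (2 ℕ.^ w) m<) (⌊n/2⌋<k n (2 ℕ.^ w) n<) h≢)) (zeroʳ a)
    vanish : ∀ a b → (a ≡ b → ⌊ m /2⌋ ≡ ⌊ n /2⌋ → m ≡ n) → (1# + χ a * χ b) * S ≡ 0#
    vanish true  true  inj = same (m≢n ∘ inj refl) _
    vanish false false inj = same (m≢n ∘ inj refl) _
    vanish true  false inj = solve 1 (λ s → (con 1 :+ (:- con 1) :* con 1) :* s := con 0) refl S
    vanish false true  inj = solve 1 (λ s → (con 1 :+ con 1 :* (:- con 1)) :* s := con 0) refl S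

  𝟙-== : ∀ a b → 2# * 𝟙 (a == b) ≡ 1# + χ a * χ b
  𝟙-== true  true  = solve 0 (con 2 :* con 1 := con 1 :+ (:- con 1) :* (:- con 1)) refl
  𝟙-== true  false = solve 0 (con 2 :* con 0 := con 1 :+ (:- con 1) :* con 1) refl
  𝟙-== false true  = solve 0 (con 2 :* con 0 := con 1 :+ con 1 :* (:- con 1)) refl
  𝟙-== false false = solve 0 (con 2 :* con 1 := con 1 :+ con 1 :* con 1) refl

module Hashing (R : RealField) (w : ℕ) where
  open OrderedField R
  open Indicator R
  open Logarithm R
  open Characters R
  open Probability R w
  open Space

  hash : ∀ {k} → Vec Word k → ℕ → Vec Bool k
  hash ρ n = Vec.map (λ r → bit w r n) ρ

  bit-collision : ∀ {m n} → m ℕ.< 2 ℕ.^ w → n ℕ.< 2 ℕ.^ w → m ≢ n →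
    2# * total word (λ r → 𝟙 (bit w r m == bit w r n)) ≡ cardinality word
  bit-collision {m} {n} m< n< m≢n = begin
    2# * total word (λ r → 𝟙 (bit w r m == bit w r n))
      ≡⟨ total-*ˡ word 2# (λ r → 𝟙 (bit w r m == bit w r n)) ⟨
    total word (λ r → 2# * 𝟙 (bit w r m == bit w r n))
      ≡⟨ total-cong word (λ r → 𝟙-== (bit w r m) (bit w r n)) ⟩
    total word (λ r → 1# + χ (bit w r m) * χ (bit w r n))
      ≡⟨ total-+ word (λ _ → 1#) (λ r → χ (bit w r m) * χ (bit w r n)) ⟩
    total word (λ _ → 1#) + total word (λ r → χ (bit w r m) * χ (bit w r n))
      ≡⟨ cong₂ _+_ (trans (total-const word 1#) (*-identityʳ _)) (bit-orthogonal w m n m< n< m≢n) ⟩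
    cardinality word + 0#
      ≡⟨ +-identityʳ _ ⟩
    cardinality word ∎
    where open ≡-Reasoning

  hash-collision : ∀ k {m n} → m ℕ.< 2 ℕ.^ w → n ℕ.< 2 ℕ.^ w → m ≢ n →
    2# ^ k * total (word ⋆ k) (λ ρ → 𝟙 (hash ρ m ==ᵥ hash ρ n)) ≡ cardinality (word ⋆ k)
  hash-collision zero    {m} {n} m< n< m≢n = *-identityˡ _
  hash-collision (suc k) {m} {n} m< n< m≢n = begin
    2# ^ suc k * total (word ⋆ suc k) (λ ρ → 𝟙 (hash ρ m ==ᵥ hash ρ n))
      ≡⟨ cong (2# ^ suc k *_) (total-∷ word k (λ ρ → 𝟙 (hash ρ m ==ᵥ hash ρ n))) ⟩
    2# ^ suc k * total word (λ r → total (word ⋆ k) (λ ρ → 𝟙 (b r ∧ c ρ)))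
      ≡⟨ cong (2# ^ suc k *_) (trans (total-cong word (λ r → trans
           (total-cong (word ⋆ k) (λ ρ → 𝟙-∧ (b r) (c ρ))) (total-*ˡ (word ⋆ k) (𝟙 (b r)) (λ ρ → 𝟙 (c ρ)))))
           (total-*ʳ word C (λ r → 𝟙 (b r)))) ⟩
    2# * 2# ^ k * (total word (λ r → 𝟙 (b r)) * C)
      ≡⟨ solve 4 (λ a p B C → a :* p :* (B :* C) := a :* B :* (p :* C)) refl 2# (2# ^ k) (total word (λ r → 𝟙 (b r))) C ⟩
    2# * total word (λ r → 𝟙 (b r)) * (2# ^ k * C)
      ≡⟨ cong₂ _*_ (bit-collision m< n< m≢n) (hash-collision k m< n< m≢n) ⟩
    cardinality word * cardinality (word ⋆ k)
      ≡⟨ cardinality-⊗ word (word ⋆ k) ⟨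
    cardinality (word ⋆ suc k) ∎
    where
    open ≡-Reasoning
    b : Word → Bool
    b r = bit w r m == bit w r n
    c : Vec Word k → Bool
    c ρ = hash ρ m ==ᵥ hash ρ n
    C = total (word ⋆ k) (λ ρ → 𝟙 (c ρ))

-- The sketch of one level: an unbiased estimate from two buckets.

module LevelSketch (R : RealField) (w k : ℕ) where
  open OrderedField R
  open Indicator R
  open Logarithm R
  open Characters R
  open Probability R w
  open Hashing R w
  open Space

  -- Two hash functions onto Vec Bool k, and a sign function.
  LevelSeed : Set
  LevelSeed = (Vec Word k × Vec Word k) × Word

  hashSpace : Space (Vec Word k)
  hashSpace = word ⋆ k

  levelSpace : Space LevelSeed
  levelSpace = (hashSpace ⊗ hashSpace) ⊗ word

  Cell : Set
  Cell = Vec Bool (2 ℕ.+ k)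

  selects : LevelSeed → ℕ → Cell → Bool
  selects ((ρ₁ , ρ₂) , s) n (row ∷ sign ∷ bucket) =
    (bit w s n == sign) ∧ (hash (if row then ρ₂ else ρ₁) n ==ᵥ bucket)

  -- The row whose bucket is lighter is used.  Its choice depends on the hash
  -- functions only, so the estimate is unbiased although the signs are merely
  -- pairwise independent.
  estimate : LevelSeed → ℕ → (Cell → ℝ) → ℝ
  estimate ((ρ₁ , ρ₂) , s) p c =
    if does (P false ρ₁ + N false ρ₁ ≤? P true ρ₂ + N true ρ₂)
    then P false ρ₁ - N false ρ₁ else P true ρ₂ - N true ρ₂
    where
    P N : Bool → Vec Word k → ℝ
    P row ρ = c (row ∷ bit w s p ∷ hash ρ p)
    N row ρ = c (row ∷ not (bit w s p) ∷ hash ρ p)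

  module Error {U : ℕ} (x : Vector ℝ U) (active : Fin U → Bool) (key : Fin U → ℕ) (p : ℕ) where

    hit : Fin U → Bool
    hit v = active v ∧ (key v ℕ.≡ᵇ p)

    off : Vec Word k → Fin U → Bool
    off ρ v = active v ∧ (not ((key v ℕ.≡ᵇ p)) ∧ (hash ρ (key v) ==ᵥ hash ρ p))

    sign : Word → Fin U → ℝ
    sign s v = χ (bit w s (key v)) * χ (bit w s p)

    mass : ℝ
    mass = sum (λ v → 𝟙 (hit v) * x v)

    noise : Vec Word k → ℝ
    noise ρ = sum (λ v → 𝟙 (off ρ v) * x v)

    signedNoise : Vec Word k → Word → ℝ
    signedNoise ρ s = sum (λ v → 𝟙 (off ρ v) * sign s v * x v)

    -- This compares the noises, since `mass` is common to both buckets. It is written with `mass`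
    -- because bucket contents are what the counters show: after rewriting with `bucket-sum`, the
    -- test in `estimate` is literally this one.
    lighter : Vec Word k → Vec Word k → Bool
    lighter ρ₁ ρ₂ = does (mass + noise ρ₁ ≤? mass + noise ρ₂)

    error : LevelSeed → ℝ
    error ((ρ₁ , ρ₂) , s) = if lighter ρ₁ ρ₂ then signedNoise ρ₁ s else signedNoise ρ₂ s

    Counts : LevelSeed → (Cell → ℝ) → Set
    Counts ω c = ∀ i → c i ≡ sum (λ v → 𝟙 (active v ∧ selects ω (key v) i) * x v)

    private
      -- l: the element is active; q: its key is p; h: its bucket is that of p;
      -- b, b′: the signs of its key and of p.
      cell-sum : ∀ l q h b b′ → (q ≡ true → h ≡ true × b ≡ b′) →
        𝟙 (l ∧ ((b == b′) ∧ h)) + 𝟙 (l ∧ ((b == not b′) ∧ h)) ≡ 𝟙 (l ∧ q) + 𝟙 (l ∧ (not q ∧ h))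
      cell-sum false _     _     _     _     _ = refl
      cell-sum true  true  h     b     b′    eq with eq refl
      cell-sum true  true  .true true  .true  eq | refl , refl = refl
      cell-sum true  true  .true false .false eq | refl , refl = refl
      cell-sum true  false false true  true  _ = refl
      cell-sum true  false false true  false _ = refl
      cell-sum true  false false false true  _ = refl
      cell-sum true  false false false false _ = refl
      cell-sum true  false true  true  true  _ = +-comm _ _
      cell-sum true  false true  true  false _ = refl
      cell-sum true  false true  false true  _ = refl
      cell-sum true  false true  false false _ = +-comm _ _

      cell-difference : ∀ l q h b b′ → (q ≡ true → h ≡ true × b ≡ b′) →
        𝟙 (l ∧ ((b == b′) ∧ h)) - 𝟙 (l ∧ ((b == not b′) ∧ h)) ≡ 𝟙 (l ∧ q) + 𝟙 (l ∧ (not q ∧ h)) * (χ b * χ b′)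
      cell-difference false _     _     b     b′    _ =
        solve 1 (λ c → con 0 :- con 0 := con 0 :+ con 0 :* c) refl (χ b * χ b′)
      cell-difference true  true  h     b     b′    eq with eq refl
      cell-difference true  true  .true true  .true  eq | refl , refl =
        solve 1 (λ c → con 1 :- con 0 := con 1 :+ con 0 :* c) refl (χ true * χ true)
      cell-difference true  true  .true false .false eq | refl , refl =
        solve 1 (λ c → con 1 :- con 0 := con 1 :+ con 0 :* c) refl (χ false * χ false)
      cell-difference true  false false b     b′    _ = no-hit (b == b′) (b == not b′)
        where
        no-hit : ∀ a a′ → 𝟙 (a ∧ false) - 𝟙 (a′ ∧ false) ≡ 0# + 0# * (χ b * χ b′)
        no-hit true  true  = solve 1 (λ c → con 0 :- con 0 := con 0 :+ con 0 :* c) refl (χ b * χ b′)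
        no-hit true  false = solve 1 (λ c → con 0 :- con 0 := con 0 :+ con 0 :* c) refl (χ b * χ b′)
        no-hit false true  = solve 1 (λ c → con 0 :- con 0 := con 0 :+ con 0 :* c) refl (χ b * χ b′)
        no-hit false false = solve 1 (λ c → con 0 :- con 0 := con 0 :+ con 0 :* c) refl (χ b * χ b′)
      cell-difference true  false true  true  true  _ =
        solve 0 (con 1 :- con 0 := con 0 :+ con 1 :* ((:- con 1) :* (:- con 1))) refl
      cell-difference true  false true  true  false _ =
        solve 0 (con 0 :- con 1 := con 0 :+ con 1 :* ((:- con 1) :* con 1)) refl
      cell-difference true  false true  false true  _ =
        solve 0 (con 0 :- con 1 := con 0 :+ con 1 :* (con 1 :* (:- con 1))) refl
      cell-difference true  false true  false false _ =
        solve 0 (con 1 :- con 0 := con 0 :+ con 1 :* (con 1 :* con 1)) refl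

      same-key : ∀ (ρ : Vec Word k) s v → (key v ℕ.≡ᵇ p) ≡ true →
        (hash ρ (key v) ==ᵥ hash ρ p) ≡ true × bit w s (key v) ≡ bit w s p
      same-key ρ s v eq with key v ℕ.≡ᵇ p | proof (key v ℕ.≟ p)
      ... | true | ofʸ key≡p rewrite key≡p = ==ᵥ-refl (hash ρ p) , refl

    module _ (ρ : Vec Word k) (s : Word) where
      private
        A B : Fin U → Bool
        A v = active v ∧ ((bit w s (key v) == bit w s p) ∧ (hash ρ (key v) ==ᵥ hash ρ p))
        B v = active v ∧ ((bit w s (key v) == not (bit w s p)) ∧ (hash ρ (key v) ==ᵥ hash ρ p))

      bucket-sum : sum (λ v → 𝟙 (A v) * x v) + sum (λ v → 𝟙 (B v) * x v) ≡ mass + noise ρ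
      bucket-sum = begin
        sum (λ v → 𝟙 (A v) * x v) + sum (λ v → 𝟙 (B v) * x v)
          ≡⟨ ∑-distrib-+ (λ v → 𝟙 (A v) * x v) (λ v → 𝟙 (B v) * x v) ⟨
        sum (λ v → 𝟙 (A v) * x v + 𝟙 (B v) * x v)
          ≡⟨ sum-cong (λ v → trans (sym (distribʳ (x v) _ _)) (trans
               (cong (_* x v) (cell-sum (active v) ((key v ℕ.≡ᵇ p)) _ (bit w s (key v)) (bit w s p) (same-key ρ s v)))
               (distribʳ (x v) _ _))) ⟩
        sum (λ v → 𝟙 (hit v) * x v + 𝟙 (off ρ v) * x v)
          ≡⟨ ∑-distrib-+ (λ v → 𝟙 (hit v) * x v) (λ v → 𝟙 (off ρ v) * x v) ⟩
        mass + noise ρ ∎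
        where open ≡-Reasoning

      bucket-difference : sum (λ v → 𝟙 (A v) * x v) - sum (λ v → 𝟙 (B v) * x v) ≡ mass + signedNoise ρ s
      bucket-difference = begin
        sum (λ v → 𝟙 (A v) * x v) - sum (λ v → 𝟙 (B v) * x v)
          ≡⟨ solve 2 (λ a b → a :- b := a :+ (:- con 1) :* b) refl _ _ ⟩
        sum (λ v → 𝟙 (A v) * x v) + - 1# * sum (λ v → 𝟙 (B v) * x v)
          ≡⟨ cong (sum (λ v → 𝟙 (A v) * x v) +_) (*-distribˡ-sum (- 1#) (λ v → 𝟙 (B v) * x v)) ⟩
        sum (λ v → 𝟙 (A v) * x v) + sum (λ v → - 1# * (𝟙 (B v) * x v))
          ≡⟨ ∑-distrib-+ (λ v → 𝟙 (A v) * x v) (λ v → - 1# * (𝟙 (B v) * x v)) ⟨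
        sum (λ v → 𝟙 (A v) * x v + - 1# * (𝟙 (B v) * x v))
          ≡⟨ sum-cong (λ v → trans
               (solve 3 (λ a b x → a :* x :+ (:- con 1) :* (b :* x) := (a :- b) :* x) refl (𝟙 (A v)) (𝟙 (B v)) (x v))
               (trans
                 (cong (_* x v) (cell-difference (active v) ((key v ℕ.≡ᵇ p)) _ (bit w s (key v)) (bit w s p) (same-key ρ s v)))
                 (distribʳ (x v) _ _))) ⟩
        sum (λ v → 𝟙 (hit v) * x v + 𝟙 (off ρ v) * sign s v * x v)
          ≡⟨ ∑-distrib-+ (λ v → 𝟙 (hit v) * x v) (λ v → 𝟙 (off ρ v) * sign s v * x v) ⟩
        mass + signedNoise ρ s ∎
        where open ≡-Reasoning

    estimate≡ : ∀ ω c → Counts ω c → estimate ω p c ≡ mass + error ω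
    estimate≡ ((ρ₁ , ρ₂) , s) c counts
      rewrite counts (false ∷ bit w s p ∷ hash ρ₁ p) | counts (false ∷ not (bit w s p) ∷ hash ρ₁ p)
            | counts (true ∷ bit w s p ∷ hash ρ₂ p) | counts (true ∷ not (bit w s p) ∷ hash ρ₂ p)
            | bucket-sum ρ₁ s | bucket-sum ρ₂ s | bucket-difference ρ₁ s | bucket-difference ρ₂ s
      = push (lighter ρ₁ ρ₂)
      where
      push : ∀ b → (if b then mass + signedNoise ρ₁ s else mass + signedNoise ρ₂ s) ≡
                   mass + (if b then signedNoise ρ₁ s else signedNoise ρ₂ s)
      push true  = refl
      push false = refl

    module Bounds (0≤x : ∀ v → 0# ≤ x v) (key< : ∀ v → key v ℕ.< 2 ℕ.^ w) (p< : p ℕ.< 2 ℕ.^ w) where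

      0≤noise : ∀ ρ → 0# ≤ noise ρ
      0≤noise ρ = sum-nonNegative (λ v → *-nonNegative (0≤𝟙 (off ρ v)) (0≤x v))

      noise≤size : ∀ ρ → noise ρ ≤ sum x
      noise≤size ρ = sum-mono (λ v → subst (𝟙 (off ρ v) * x v ≤_) (*-identityˡ _) (*-monoʳ-≤ (0≤x v) (𝟙≤1 (off ρ v))))

      ∣signedNoise∣≤ : ∀ ρ s → ∣ signedNoise ρ s ∣ ≤ noise ρ
      ∣signedNoise∣≤ ρ s = ∣∣≤
        (sum-mono (λ v → *-monoʳ-≤ (0≤x v) (proj₁ (bound (off ρ v) (bit w s (key v)) (bit w s p)))))
        (subst (_≤ noise ρ) (trans (sym (*-distribˡ-sum (- 1#) (λ v → 𝟙 (off ρ v) * sign s v * x v)))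
            (solve 1 (λ a → (:- con 1) :* a := :- a) refl (signedNoise ρ s)))
          (sum-mono (λ v → subst (_≤ 𝟙 (off ρ v) * x v)
            (solve 2 (λ a x → (:- a) :* x := (:- con 1) :* (a :* x)) refl (𝟙 (off ρ v) * sign s v) (x v))
            (*-monoʳ-≤ (0≤x v) (proj₂ (bound (off ρ v) (bit w s (key v)) (bit w s p)))))))
        where
        -1≤1 : - 1# ≤ 1#
        -1≤1 = ≤-trans (subst (- 1# ≤_) -0#≈0# (neg-mono-≤ 0≤1)) 0≤1
        ±χ≤1 : ∀ a b → χ a * χ b ≤ 1# × - (χ a * χ b) ≤ 1#
        ±χ≤1 a b rewrite sym (χ-xor a b) with a xor b
        ... | true  = -1≤1 , ≤-reflexive (-‿involutive 1#)
        ... | false = ≤-refl , -1≤1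
        bound : ∀ o a b → 𝟙 o * (χ a * χ b) ≤ 𝟙 o × - (𝟙 o * (χ a * χ b)) ≤ 𝟙 o
        bound o a b =
          subst (𝟙 o * (χ a * χ b) ≤_) (*-identityʳ _) (*-monoˡ-≤ (0≤𝟙 o) (proj₁ (±χ≤1 a b))) ,
          subst₂ _≤_ (solve 2 (λ o c → o :* (:- c) := :- (o :* c)) refl (𝟙 o) (χ a * χ b)) (*-identityʳ _)
            (*-monoˡ-≤ (0≤𝟙 o) (proj₂ (±χ≤1 a b)))

      ∣error∣≤size : ∀ ω → ∣ error ω ∣ ≤ sum x
      ∣error∣≤size ((ρ₁ , ρ₂) , s) with lighter ρ₁ ρ₂
      ... | true  = ≤-trans (∣signedNoise∣≤ ρ₁ s) (noise≤size ρ₁)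
      ... | false = ≤-trans (∣signedNoise∣≤ ρ₂ s) (noise≤size ρ₂)

      -- The error is at most the smaller noise, and min(a , b)² ≤ a b. The gain lies in the
      -- product: its factors are independent, so its mean is the product of two means of size ‖x‖₁
      -- / 2 ^ k.
      error²≤ : ∀ ρ₁ ρ₂ s → error ((ρ₁ , ρ₂) , s) * error ((ρ₁ , ρ₂) , s) ≤ noise ρ₁ * noise ρ₂
      error²≤ ρ₁ ρ₂ s with mass + noise ρ₁ ≤? mass + noise ρ₂
      ... | yes ≤₁₂ = ≤-trans (∣∣≤⇒²≤² (∣signedNoise∣≤ ρ₁ s)) (*-monoˡ-≤ (0≤noise ρ₁) (0≤-⇒≤ (subst (0# ≤_)
              (solve 3 (λ m a b → m :+ b :- (m :+ a) := b :- a) refl mass (noise ρ₁) (noise ρ₂)) (≤⇒0≤- ≤₁₂))))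
      ... | no  ≰₁₂ = ≤-trans (∣∣≤⇒²≤² (∣signedNoise∣≤ ρ₂ s)) (*-monoʳ-≤ (0≤noise ρ₂) (0≤-⇒≤ (subst (0# ≤_)
              (solve 3 (λ m a b → m :+ a :- (m :+ b) := a :- b) refl mass (noise ρ₁) (noise ρ₂)) (≤⇒0≤- (≰⇒≥ ≰₁₂)))))

      -- Only keys different from `p` contribute noise, and their signs are orthogonal to that of
      -- `p`. Since `ρ` is held fixed, so is the row that `lighter` chooses.
      total-signedNoise : ∀ ρ → total word (signedNoise ρ) ≡ 0#
      total-signedNoise ρ = begin
        total word (signedNoise ρ)
          ≡⟨ total-sum word (λ s v → 𝟙 (off ρ v) * sign s v * x v) ⟩
        sum (λ v → total word (λ s → 𝟙 (off ρ v) * sign s v * x v))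
          ≡⟨ sum-cong (λ v → trans (total-*ʳ word (x v) (λ s → 𝟙 (off ρ v) * sign s v))
               (trans (cong (_* x v) (trans (total-*ˡ word (𝟙 (off ρ v)) (λ s → sign s v)) (vanish v))) (zeroˡ (x v)))) ⟩
        sum {U} (λ v → 0#)
          ≡⟨ sum-replicate-zero U ⟩
        0# ∎
        where
        open ≡-Reasoning
        vanish : ∀ v → 𝟙 (off ρ v) * total word (λ s → sign s v) ≡ 0#
        vanish v with active v
        ... | false = zeroˡ _
        ... | true with key v ℕ.≡ᵇ p | proof (key v ℕ.≟ p)
        ...   | true  | _ = zeroˡ _
        ...   | false | ofⁿ k≢p = trans (cong (𝟙 (hash ρ (key v) ==ᵥ hash ρ p) *_) (bit-orthogonal w (key v) p (key< v) p< k≢p)) (zeroʳ _)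

      total-error : total levelSpace error ≡ 0#
      total-error = begin
        total levelSpace error
          ≡⟨ total-⊗ (hashSpace ⊗ hashSpace) word error ⟩
        total (hashSpace ⊗ hashSpace) (λ ρ → total word (λ s → error (ρ , s)))
          ≡⟨ total-cong (hashSpace ⊗ hashSpace) (λ { (ρ₁ , ρ₂) → vanish ρ₁ ρ₂ (lighter ρ₁ ρ₂) }) ⟩
        total (hashSpace ⊗ hashSpace) (λ _ → 0#)
          ≡⟨ trans (total-const (hashSpace ⊗ hashSpace) 0#) (zeroʳ _) ⟩
        0# ∎
        where
        open ≡-Reasoning
        vanish : ∀ ρ₁ ρ₂ b → total word (λ s → if b then signedNoise ρ₁ s else signedNoise ρ₂ s) ≡ 0#
        vanish ρ₁ ρ₂ true  = total-signedNoise ρ₁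
        vanish ρ₁ ρ₂ false = total-signedNoise ρ₂

      total-noise : 2# ^ k * total hashSpace noise ≤ cardinality hashSpace * sum x
      total-noise = subst₂ _≤_ (sym lhs) (sym (*-distribˡ-sum (cardinality hashSpace) x))
        (sum-mono (λ v → *-monoʳ-≤ (0≤x v) (collide v)))
        where
        lhs : 2# ^ k * total hashSpace noise ≡ sum (λ v → 2# ^ k * total hashSpace (λ ρ → 𝟙 (off ρ v)) * x v)
        lhs = trans (cong (2# ^ k *_) (trans (total-sum hashSpace (λ ρ v → 𝟙 (off ρ v) * x v))
            (sum-cong (λ v → total-*ʳ hashSpace (x v) (λ ρ → 𝟙 (off ρ v))))))
          (trans (*-distribˡ-sum (2# ^ k) (λ v → total hashSpace (λ ρ → 𝟙 (off ρ v)) * x v))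
            (sum-cong (λ v → sym (*-assoc (2# ^ k) (total hashSpace (λ ρ → 𝟙 (off ρ v))) (x v)))))
        none : 2# ^ k * total hashSpace (λ _ → 0#) ≤ cardinality hashSpace
        none = subst (_≤ cardinality hashSpace) (sym (trans (cong (2# ^ k *_) (trans (total-const hashSpace 0#) (zeroʳ _))) (zeroʳ _)))
          (proj₁ (0<cardinality hashSpace))
        collide : ∀ v → 2# ^ k * total hashSpace (λ ρ → 𝟙 (off ρ v)) ≤ cardinality hashSpace
        collide v with active v
        ... | false = none
        ... | true with key v ℕ.≡ᵇ p | proof (key v ℕ.≟ p)
        ...   | true  | _ = none
        ...   | false | ofⁿ k≢p = ≤-reflexive (hash-collision k (key< v) p< k≢p)

      total-error² : 2# ^ k * 2# ^ k * total levelSpace (λ ω → error ω * error ω) ≤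
                     cardinality levelSpace * (sum x * sum x)
      total-error² = ≤-trans (*-monoˡ-≤ 0≤4ᵏ total≤) (subst₂ _≤_
        (solve 3 (λ p n t → (p :* t) :* (p :* t) :* n := p :* p :* (t :* t :* n)) refl P Nw S)
        (trans (solve 3 (λ a t n → (a :* t) :* (a :* t) :* n := (a :* a :* n) :* (t :* t)) refl Nh (sum x) Nw)
          (cong (_* (sum x * sum x)) (sym (trans (cardinality-⊗ (hashSpace ⊗ hashSpace) word)
            (cong (_* Nw) (cardinality-⊗ hashSpace hashSpace))))))
        (*-monoʳ-≤ (proj₁ (0<cardinality word)) (square-mono (*-nonNegative 0≤2ᵏ 0≤S) total-noise)))
        where
        P  = 2# ^ k
        S  = total hashSpace noise
        Nw = cardinality word
        Nh = cardinality hashSpace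
        0≤2ᵏ = ^-nonNegative 0≤2 k
        0≤4ᵏ = *-nonNegative 0≤2ᵏ 0≤2ᵏ
        0≤S = total-nonNegative hashSpace 0≤noise
        HH = hashSpace ⊗ hashSpace
        total≤ : total levelSpace (λ ω → error ω * error ω) ≤ S * S * Nw
        total≤ = ≤-trans (total-mono levelSpace (λ { ((ρ₁ , ρ₂) , s) → error²≤ ρ₁ ρ₂ s })) (≤-reflexive (begin
          total levelSpace (λ { ((ρ₁ , ρ₂) , s) → noise ρ₁ * noise ρ₂ })
            ≡⟨ total-⊗ HH word (λ { ((ρ₁ , ρ₂) , s) → noise ρ₁ * noise ρ₂ }) ⟩
          total HH (λ { (ρ₁ , ρ₂) → total word (λ s → noise ρ₁ * noise ρ₂) })
            ≡⟨ total-cong HH (λ { (ρ₁ , ρ₂) → trans (total-const word (noise ρ₁ * noise ρ₂)) (*-comm Nw _) }) ⟩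
          total HH (λ { (ρ₁ , ρ₂) → noise ρ₁ * noise ρ₂ * Nw })
            ≡⟨ total-*ʳ HH Nw (λ { (ρ₁ , ρ₂) → noise ρ₁ * noise ρ₂ }) ⟩
          total HH (λ { (ρ₁ , ρ₂) → noise ρ₁ * noise ρ₂ }) * Nw
            ≡⟨ cong (_* Nw) (total-⊗ hashSpace hashSpace (λ { (ρ₁ , ρ₂) → noise ρ₁ * noise ρ₂ })) ⟩
          total hashSpace (λ ρ₁ → total hashSpace (λ ρ₂ → noise ρ₁ * noise ρ₂)) * Nw
            ≡⟨ cong (_* Nw) (trans (total-cong hashSpace (λ ρ₁ → total-*ˡ hashSpace (noise ρ₁) noise))
                 (total-*ʳ hashSpace S noise)) ⟩
          S * S * Nw ∎))
          where open ≡-Reasoning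

-- Arithmetic of dyadic intervals.

T⇔T⇒≡ : ∀ {a b} → (T a → T b) → (T b → T a) → a ≡ b
T⇔T⇒≡ {true}  {true}  f g = refl
T⇔T⇒≡ {true}  {false} f g = contradiction (f tt) (λ ())
T⇔T⇒≡ {false} {true}  f g = contradiction (g tt) (λ ())
T⇔T⇒≡ {false} {false} f g = refl

block : ℕ → ℕ → ℕ
block h v = ℕ._/_ v (2 ℕ.^ h) {{ℕ.m^n≢0 2 h}}

<ᵇ-block : ∀ h v k → (v ℕ.<ᵇ k ℕ.* 2 ℕ.^ h) ≡ (block h v ℕ.<ᵇ k)
<ᵇ-block h v k = T⇔T⇒≡
  (λ v< → ℕ.<⇒<ᵇ (ℕ.m<n*o⇒m/o<n {v} {k} (ℕ.<ᵇ⇒< v (k ℕ.* 2 ℕ.^ h) v<)))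
  (λ d< → ℕ.<⇒<ᵇ (v<k*2ʰ (ℕ.<ᵇ⇒< (block h v) k d<)))
  where
  instance 2ʰ≢0 = ℕ.m^n≢0 2 h
  v<k*2ʰ : block h v ℕ.< k → v ℕ.< k ℕ.* 2 ℕ.^ h
  v<k*2ʰ d<k = begin-strict
    v                                               ≡⟨ ℕ.m≡m%n+[m/n]*n v (2 ℕ.^ h) ⟩
    v ℕ.% 2 ℕ.^ h ℕ.+ block h v ℕ.* 2 ℕ.^ h         <⟨ ℕ.+-monoˡ-< _ (ℕ.m%n<n v (2 ℕ.^ h)) ⟩
    suc (block h v) ℕ.* 2 ℕ.^ h                     ≤⟨ ℕ.*-monoˡ-≤ (2 ℕ.^ h) d<k ⟩
    k ℕ.* 2 ℕ.^ h                                   ∎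
    where open ℕ.≤-Reasoning

*2*2^≡ : ∀ p h → p ℕ.* 2 ℕ.* 2 ℕ.^ h ≡ p ℕ.* 2 ℕ.^ suc h
*2*2^≡ p h = ℕ.*-assoc p 2 (2 ℕ.^ h)

child : Bool → ℕ → ℕ
child true  p = suc (p ℕ.* 2)
child false p = p ℕ.* 2

-- The boundary between the two children of the node `p` of height `suc h`; `h` is the height of the
-- children.
middle : ℕ → ℕ → ℕ
middle h p = suc (p ℕ.* 2) ℕ.* 2 ℕ.^ h

-- The node p at height h stands for the interval [p * 2 ^ h , suc p * 2 ^ h).
child-end≤ : ∀ b p h → suc (child b p) ℕ.* 2 ℕ.^ h ℕ.≤ suc p ℕ.* 2 ℕ.^ suc h
child-end≤ true  p h = ℕ.≤-reflexive (*2*2^≡ (suc p) h)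
child-end≤ false p h = ℕ.≤-trans (ℕ.*-monoˡ-≤ (2 ℕ.^ h) (ℕ.n≤1+n (suc (p ℕ.* 2)))) (child-end≤ true p h)

child-start≥ : ∀ b p h → p ℕ.* 2 ℕ.^ suc h ℕ.≤ child b p ℕ.* 2 ℕ.^ h
child-start≥ false p h = ℕ.≤-reflexive (sym (*2*2^≡ p h))
child-start≥ true  p h = ℕ.≤-trans (child-start≥ false p h) (ℕ.*-monoˡ-≤ (2 ℕ.^ h) (ℕ.n≤1+n (p ℕ.* 2)))

-- Keys are nodes of positive height, so a tree with `2 ^ suc w` leaves still has keys of `w` bits.
-- A tree of this size occurs because the least power of two strictly above `U ≤ 2 ^ w` can be
-- `2 ^ suc w`.
node< : ∀ {w} p h → suc p ℕ.* 2 ℕ.^ suc h ℕ.≤ 2 ℕ.^ suc w → p ℕ.< 2 ℕ.^ w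
node< {w} p h end≤ = ℕ.≤-trans
  (ℕ.m≤m*n (suc p) (2 ℕ.^ h) {{ℕ.m^n≢0 2 h}})
  (ℕ.*-cancelˡ-≤ 2 (subst (ℕ._≤ 2 ℕ.^ suc w) rearrange end≤))
  where
  rearrange : suc p ℕ.* 2 ℕ.^ suc h ≡ 2 ℕ.* (suc p ℕ.* 2 ℕ.^ h)
  rearrange = trans (sym (*2*2^≡ (suc p) h)) (trans (cong (ℕ._* 2 ℕ.^ h) (ℕ.*-comm (suc p) 2)) (ℕ.*-assoc 2 (suc p) (2 ℕ.^ h)))

-- Ranks and accumulated errors along a path of the tree.

module Dyadic (R : RealField) (w k : ℕ) {U : ℕ} where
  open OrderedField R
  open Indicator R
  open Logarithm R
  open Probability R w
  open Streaming R using (rank; index)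
  open LevelSketch R w k
  open Space

  -- At height h, the nodes p of length 2 ^ suc h are split; an element is
  -- active if it lies in the left half of its node.
  active : ℕ → Fin U → Bool
  active h v = not (odd (block h (toℕ v)))

  key : ℕ → Fin U → ℕ
  key h v = ⌊ block h (toℕ v) /2⌋

  -- A block number below 2 p + 1 is either below 2 p or equal to 2 p. The second case says that it
  -- is even with half `p`, which is the condition counted by `mass`.
  rank-split : ∀ (x : Vector ℝ U) h p →
    rank x (middle h p) ≡ rank x (p ℕ.* 2 ℕ.^ suc h) + Error.mass x (active h) (key h) p
  -- `does (index v ℕ.≤? k)` computes to `toℕ v ℕ.<ᵇ k`. So `rank x k` adds up the zero-based
  -- positions below `k`, and ranks at multiples of 2 ^ h match the node boundaries without a shift.
  rank-split x h p = trans (sum-cong (λ v → split (toℕ v) (x v)))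
    (∑-distrib-+ (λ v → if toℕ v ℕ.<ᵇ p ℕ.* 2 ℕ.^ suc h then x v else 0#) _)
    where
    halves : ∀ d p → 𝟙 (d ℕ.<ᵇ suc (p ℕ.* 2)) ≡ 𝟙 (d ℕ.<ᵇ p ℕ.* 2) + 𝟙 (not (odd d) ∧ (⌊ d /2⌋ ℕ.≡ᵇ p))
    halves zero          zero    = sym (+-identityˡ _)
    halves (suc zero)    zero    = sym (+-identityˡ _)
    halves (suc (suc d)) zero    = sym (trans (+-identityˡ _) (cong 𝟙 (∧-false (not (odd d)))))
      where
      ∧-false : ∀ b → b ∧ false ≡ false
      ∧-false true  = refl
      ∧-false false = refl
    halves zero          (suc p) = sym (+-identityʳ _)
    halves (suc zero)    (suc p) = sym (+-identityʳ _)
    halves (suc (suc d)) (suc p) = halves d p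
    split : ∀ v y → (if v ℕ.<ᵇ middle h p then y else 0#) ≡
      (if v ℕ.<ᵇ p ℕ.* 2 ℕ.^ suc h then y else 0#) + 𝟙 (not (odd (block h v)) ∧ (⌊ block h v /2⌋ ℕ.≡ᵇ p)) * y
    split v y = begin
      (if v ℕ.<ᵇ middle h p then y else 0#)           ≡⟨ 𝟙-* (v ℕ.<ᵇ middle h p) y ⟨
      𝟙 (v ℕ.<ᵇ middle h p) * y                       ≡⟨ cong (λ b → 𝟙 b * y) (<ᵇ-block h v (suc (p ℕ.* 2))) ⟩
      𝟙 (d ℕ.<ᵇ suc (p ℕ.* 2)) * y                    ≡⟨ cong (_* y) (halves d p) ⟩
      (𝟙 (d ℕ.<ᵇ p ℕ.* 2) + H) * y                    ≡⟨ distribʳ y _ _ ⟩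
      𝟙 (d ℕ.<ᵇ p ℕ.* 2) * y + H * y                  ≡⟨ cong (λ b → 𝟙 b * y + H * y) (trans (sym (<ᵇ-block h v (p ℕ.* 2)))
                                                           (cong (v ℕ.<ᵇ_) (*2*2^≡ p h))) ⟩
      𝟙 (v ℕ.<ᵇ p ℕ.* 2 ℕ.^ suc h) * y + H * y        ≡⟨ cong (_+ H * y) (𝟙-* (v ℕ.<ᵇ p ℕ.* 2 ℕ.^ suc h) y) ⟩
      (if v ℕ.<ᵇ p ℕ.* 2 ℕ.^ suc h then y else 0#) + H * y ∎
      where
      open ≡-Reasoning
      d = block h v
      H = 𝟙 (not (odd d) ∧ (⌊ d /2⌋ ℕ.≡ᵇ p))

  -- Seeds and cells of a path below a node of height h, from the top down.
  selectsAt : ∀ {h} → Vec LevelSeed h → Fin U → Fin h → Cell → Bool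
  selectsAt {suc h} (ω ∷ ωs) v zero    c = active h v ∧ selects ω (key h v) c
  selectsAt         (ω ∷ ωs) v (suc i) c = selectsAt ωs v i c

  CountsAt : ∀ {h} → Vector ℝ U → Vec LevelSeed h → (Fin h → Cell → ℝ) → Set
  CountsAt x ωs cs = ∀ i c → cs i c ≡ sum (λ v → 𝟙 (selectsAt ωs v i c) * x v)

  module Path (x : Vector ℝ U) (λ# : ℝ) (right : ℕ → Bool) where

    error : ℕ → ℕ → LevelSeed → ℝ
    error h p = Error.error x (active h) (key h) p

    -- On the path that goes to the right where `right` says so, the error c
    -- of the accumulated rank and the errors of the estimates stay within λ#.
    Accurate : ∀ {h} → Vec LevelSeed h → ℕ → ℝ → Set
    Accurate         []       p c = ∣ c ∣ ≤ λ#
    Accurate {suc h} (ω ∷ ωs) p c = ∣ c ∣ ≤ λ# × ∣ ε ∣ ≤ λ# × Accurate ωs (child b p) (c + 𝟙 b * ε)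
      where
      ε = error h p ω
      b = right (middle h p)

    accurate? : ∀ {h} (ωs : Vec LevelSeed h) p c → Dec (Accurate ωs p c)
    accurate?         []       p c = ∣ c ∣ ≤? λ#
    accurate? {suc h} (ω ∷ ωs) p c = ∣ c ∣ ≤? λ# ×-dec (_ ≤? _ ×-dec accurate? ωs _ _)

    inaccurate : ∀ {h} → Vec LevelSeed h → ℕ → ℝ → ℝ
    inaccurate ωs p c = 𝟙 (not (does (accurate? ωs p c)))

    module _ (0≤x : ∀ v → 0# ≤ x v) (U≤ : U ℕ.≤ 2 ℕ.^ w) (0≤λ : 0# ≤ λ#) where

      key< : ∀ h v → key h v ℕ.< 2 ℕ.^ w
      key< h v = ℕ.≤-<-trans (ℕ.≤-trans (ℕ.⌊n/2⌋≤n (block h (toℕ v))) (ℕ.m/n≤m (toℕ v) (2 ℕ.^ h) {{ℕ.m^n≢0 2 h}}))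
        (ℕ.<-≤-trans (Fin.toℕ<n v) U≤)

      module ErrorBounds h {p} (end≤ : suc p ℕ.* 2 ℕ.^ suc h ℕ.≤ 2 ℕ.^ suc w) =
        Error.Bounds x (active h) (key h) p 0≤x (key< h) (node< {w} p h end≤)

      -- The Kolmogorov bound, with `λ#` a multiple of ‖x‖₁, is void if ‖x‖₁ = 0. In that case every
      -- error is zero.
      accurate-if-empty : sum x ≡ 0# → ∀ {h} (ωs : Vec LevelSeed h) p → suc p ℕ.* 2 ℕ.^ h ℕ.≤ 2 ℕ.^ suc w →
        ∀ c → c ≡ 0# → Accurate ωs p c
      accurate-if-empty Σ≡0 []       p end≤ c refl = ∣∣≤ 0≤λ (subst (_≤ λ#) (sym -0#≈0#) 0≤λ)
      accurate-if-empty Σ≡0 {suc h} (ω ∷ ωs) p end≤ c refl =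
        ∣∣≤ 0≤λ (subst (_≤ λ#) (sym -0#≈0#) 0≤λ) ,
        ≤-trans ∣ε∣≤0 0≤λ ,
        accurate-if-empty Σ≡0 ωs (child b p) (ℕ.≤-trans (child-end≤ b p h) end≤) _
          (trans (+-identityˡ _) (trans (cong (𝟙 b *_) ε≡0) (zeroʳ _)))
        where
        b = right (middle h p)
        ε = error h p ω
        ∣ε∣≤0 : ∣ ε ∣ ≤ 0#
        ∣ε∣≤0 = subst (∣ ε ∣ ≤_) Σ≡0 (ErrorBounds.∣error∣≤size h end≤ ω)
        ε≡0 : ε ≡ 0#
        ε≡0 = ≤-antisym (≤-trans (≤⊔ˡ ε (- ε)) ∣ε∣≤0)
          (subst₂ _≤_ -0#≈0# (-‿involutive ε) (neg-mono-≤ (≤-trans (≤⊔ʳ ε (- ε)) ∣ε∣≤0)))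

      -- Kolmogorov's maximal inequality, by induction on the number of levels:
      -- as long as ∣ c ∣ ≤ λ#, the mean of c ² grows by the variance of a level.
      total-inaccurate : ∀ h p → suc p ℕ.* 2 ℕ.^ h ℕ.≤ 2 ℕ.^ suc w → ∀ c →
        2# ^ k * 2# ^ k * (λ# * λ#) * total (levelSpace ⋆ h) (λ ωs → inaccurate ωs p c) ≤
        cardinality (levelSpace ⋆ h) * (2# ^ k * 2# ^ k * (c * c) + fromℕ h * (2# * (sum x * sum x)))
      total-inaccurate h p end≤ c = helper h p end≤ c (∣ c ∣ ≤? λ#)
        where
        P = 2# ^ k * 2# ^ k
        Λ = λ# * λ#
        -- The factor 2 arises because each level pays its variance twice: for the growth of
        -- `c * c`, and in Chebyshev's inequality for its own error.
        V = 2# * (sum x * sum x)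
        0≤P : 0# ≤ P
        0≤P = *-nonNegative (^-nonNegative 0≤2 k) (^-nonNegative 0≤2 k)
        0≤V : 0# ≤ V
        0≤V = *-nonNegative 0≤2 (0≤x² (sum x))
        -- The stopped case: once `∣ c ∣` exceeds `λ#`, the term `P * (c * c)` alone outweighs the
        -- trivial bound 1 on the failure probability.
        escaped : ∀ h p c → ¬ ∣ c ∣ ≤ λ# → P * Λ * total (levelSpace ⋆ h) (λ ωs → inaccurate ωs p c) ≤
          cardinality (levelSpace ⋆ h) * (P * (c * c) + fromℕ h * V)
        escaped h p c ∣c∣≰λ = ≤-trans
          (*-monoˡ-≤ (*-nonNegative 0≤P (0≤x² λ#)) (≤-trans (total-mono (levelSpace ⋆ h) (λ ωs → 𝟙≤1 (not (does (accurate? ωs p c)))))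
            (≤-reflexive (trans (total-const (levelSpace ⋆ h) 1#) (*-identityʳ _)))))
          (subst (_≤ N * (P * (c * c) + fromℕ h * V)) (*-comm N (P * Λ)) (*-monoˡ-≤ (proj₁ (0<cardinality (levelSpace ⋆ h)))
            (subst (_≤ P * (c * c) + fromℕ h * V) (+-identityʳ _)
              (+-mono-≤ (*-monoˡ-≤ 0≤P (∣∣≰⇒²≤² 0≤λ ∣c∣≰λ)) (*-nonNegative (0≤fromℕ h) 0≤V)))))
          where N = cardinality (levelSpace ⋆ h)
        helper : ∀ h p → suc p ℕ.* 2 ℕ.^ h ℕ.≤ 2 ℕ.^ suc w → ∀ c → Dec (∣ c ∣ ≤ λ#) →
          P * Λ * total (levelSpace ⋆ h) (λ ωs → inaccurate ωs p c) ≤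
          cardinality (levelSpace ⋆ h) * (P * (c * c) + fromℕ h * V)
        helper h p end≤ c (no ∣c∣≰λ) = escaped h p c ∣c∣≰λ
        helper zero p end≤ c (yes ∣c∣≤λ) = subst (_≤ N * (P * (c * c) + 0# * V))
          (sym (trans (cong (λ b → P * Λ * (𝟙 (not b) + 0#)) (dec-true (∣ c ∣ ≤? λ#) ∣c∣≤λ))
            (trans (cong (P * Λ *_) (+-identityʳ 0#)) (zeroʳ _))))
          (*-nonNegative (0≤fromℕ 1) (0≤+ (*-nonNegative 0≤P (0≤x² c)) (*-nonNegative ≤-refl 0≤V)))
          where N = cardinality (levelSpace ⋆ 0)
        helper (suc h) p end≤ c (yes ∣c∣≤λ) = begin
          P * Λ * total (levelSpace ⋆ suc h) (λ ωs → inaccurate ωs p c)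
            ≡⟨ cong (P * Λ *_) (total-∷ levelSpace h (λ ωs → inaccurate ωs p c)) ⟩
          P * Λ * total levelSpace (λ ω → total (levelSpace ⋆ h) (λ ωs → inaccurate (ω ∷ ωs) p c))
            ≡⟨ total-*ˡ levelSpace (P * Λ) (λ ω → total (levelSpace ⋆ h) (λ ωs → inaccurate (ω ∷ ωs) p c)) ⟨
          total levelSpace (λ ω → P * Λ * total (levelSpace ⋆ h) (λ ωs → inaccurate (ω ∷ ωs) p c))
            ≤⟨ total-mono levelSpace step ⟩
          total levelSpace (λ ω → N * (2# * P * (ε ω * ε ω) + (2# * P * c * 𝟙 b * ε ω + (P * (c * c) + fromℕ h * V))))
            ≡⟨ total-*ˡ levelSpace N (λ ω → 2# * P * (ε ω * ε ω) + (2# * P * c * 𝟙 b * ε ω + (P * (c * c) + fromℕ h * V))) ⟩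
          N * total levelSpace (λ ω → 2# * P * (ε ω * ε ω) + (2# * P * c * 𝟙 b * ε ω + (P * (c * c) + fromℕ h * V)))
            ≡⟨ cong (N *_) expand ⟩
          N * (2# * P * Σε² + (2# * P * c * 𝟙 b * 0# + N₁ * (P * (c * c) + fromℕ h * V)))
            ≤⟨ *-monoˡ-≤ (proj₁ (0<cardinality (levelSpace ⋆ h))) (+-monoˡ-≤ _ (subst (_≤ N₁ * V)
                 (sym (*-assoc 2# P Σε²)) (subst (2# * (P * Σε²) ≤_)
                   (solve 3 (λ a n s → a :* (n :* s) := n :* (a :* s)) refl 2# N₁ (sum x * sum x))
                   (*-monoˡ-≤ 0≤2 (ErrorBounds.total-error² h end≤))))) ⟩
          N * (N₁ * V + (2# * P * c * 𝟙 b * 0# + N₁ * (P * (c * c) + fromℕ h * V)))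
            ≡⟨ solve 6 (λ N N₁ V z C h → N :* (N₁ :* V :+ (z :* con 0 :+ N₁ :* (C :+ h :* V))) :=
                 N₁ :* N :* (C :+ (con 1 :+ h) :* V)) refl N N₁ V (2# * P * c * 𝟙 b) (P * (c * c)) (fromℕ h) ⟩
          N₁ * N * (P * (c * c) + fromℕ (suc h) * V)
            ≡⟨ cong (_* (P * (c * c) + fromℕ (suc h) * V)) (cardinality-⊗ levelSpace (levelSpace ⋆ h)) ⟨
          cardinality (levelSpace ⋆ suc h) * (P * (c * c) + fromℕ (suc h) * V) ∎
          where
          open ≤-Reasoning
          N  = cardinality (levelSpace ⋆ h)
          N₁ = cardinality levelSpace
          ε  = error h p
          b  = right (middle h p)
          Σε² = total levelSpace (λ ω → ε ω * ε ω)
          -- The cross term, linear in `ε ω`, becomes a multiple of the mean error, which is 0. Here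
          -- unbiasedness makes the variances add up.
          expand : total levelSpace (λ ω → 2# * P * (ε ω * ε ω) + (2# * P * c * 𝟙 b * ε ω + (P * (c * c) + fromℕ h * V)))
                   ≡ 2# * P * Σε² + (2# * P * c * 𝟙 b * 0# + N₁ * (P * (c * c) + fromℕ h * V))
          expand = trans (total-+ levelSpace (λ ω → 2# * P * (ε ω * ε ω)) (λ ω → 2# * P * c * 𝟙 b * ε ω + (P * (c * c) + fromℕ h * V)))
            (cong₂ _+_ (total-*ˡ levelSpace (2# * P) (λ ω → ε ω * ε ω))
              (trans (total-+ levelSpace (λ ω → 2# * P * c * 𝟙 b * ε ω) (λ _ → P * (c * c) + fromℕ h * V))
                (cong₂ _+_ (trans (total-*ˡ levelSpace (2# * P * c * 𝟙 b) ε)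
                              (cong (2# * P * c * 𝟙 b *_) (ErrorBounds.total-error h end≤)))
                           (total-const levelSpace (P * (c * c) + fromℕ h * V)))))
          𝟙²≤1 : ∀ b → 𝟙 b * 𝟙 b ≤ 1#
          𝟙²≤1 true  = ≤-reflexive (*-identityˡ 1#)
          𝟙²≤1 false = subst (_≤ 1#) (sym (zeroˡ 0#)) 0≤1
          -- The error of the level is charged separately from the rest of the path, because on a
          -- turn to the left it does not enter the accumulated error, although it influenced the
          -- decision to turn.
          union : ∀ ω ωs → inaccurate (ω ∷ ωs) p c ≤
            𝟙 (not (does (∣ ε ω ∣ ≤? λ#))) + inaccurate ωs (child b p) (c + 𝟙 b * ε ω)
          union ω ωs = subst (λ a → 𝟙 (not (a ∧ (does (∣ ε ω ∣ ≤? λ#) ∧ does rest))) ≤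
              𝟙 (not (does (∣ ε ω ∣ ≤? λ#))) + 𝟙 (not (does rest)))
            (sym (dec-true (∣ c ∣ ≤? λ#) ∣c∣≤λ)) (or (does (∣ ε ω ∣ ≤? λ#)) (does rest))
            where
            rest = accurate? ωs (child b p) (c + 𝟙 b * ε ω)
            or : ∀ e r → 𝟙 (not (e ∧ r)) ≤ 𝟙 (not e) + 𝟙 (not r)
            or true  r = ≤-reflexive (sym (+-identityˡ _))
            or false r = ≤-by (𝟙 (not r)) (0≤𝟙 (not r)) refl
          chebyshev : ∀ z → Λ * 𝟙 (not (does (∣ z ∣ ≤? λ#))) ≤ z * z
          chebyshev z with ∣ z ∣ ≤? λ#
          ... | yes _   = subst (_≤ z * z) (sym (zeroʳ _)) (0≤x² z)
          ... | no  ∣z∣≰λ = subst (_≤ z * z) (sym (*-identityʳ _)) (∣∣≰⇒²≤² 0≤λ ∣z∣≰λ)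
          step : ∀ ω → P * Λ * total (levelSpace ⋆ h) (λ ωs → inaccurate (ω ∷ ωs) p c) ≤
            N * (2# * P * (ε ω * ε ω) + (2# * P * c * 𝟙 b * ε ω + (P * (c * c) + fromℕ h * V)))
          step ω = begin
            P * Λ * total (levelSpace ⋆ h) (λ ωs → inaccurate (ω ∷ ωs) p c)
              ≤⟨ *-monoˡ-≤ (*-nonNegative 0≤P (0≤x² λ#)) (total-mono (levelSpace ⋆ h) (union ω)) ⟩
            P * Λ * total (levelSpace ⋆ h) (λ ωs → e + inaccurate ωs (child b p) c′)
              ≡⟨ cong (P * Λ *_) (trans (total-+ (levelSpace ⋆ h) (λ _ → e) (λ ωs → inaccurate ωs (child b p) c′))
                   (cong (_+ F) (total-const (levelSpace ⋆ h) e))) ⟩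
            P * Λ * (N * e + F)
              ≡⟨ solve 5 (λ P Λ N e F → P :* Λ :* (N :* e :+ F) := N :* (P :* (Λ :* e)) :+ P :* Λ :* F) refl P Λ N e F ⟩
            N * (P * (Λ * e)) + P * Λ * F
              ≤⟨ +-mono-≤ (*-monoˡ-≤ (proj₁ (0<cardinality (levelSpace ⋆ h))) (*-monoˡ-≤ 0≤P (chebyshev (ε ω))))
                   (helper h (child b p) (ℕ.≤-trans (child-end≤ b p h) end≤) c′ (∣ c′ ∣ ≤? λ#)) ⟩
            N * (P * (ε ω * ε ω)) + N * (P * (c′ * c′) + fromℕ h * V)
              ≡⟨ solve 7 (λ N P e c d h V → N :* (P :* (e :* e)) :+ N :* (P :* ((c :+ d :* e) :* (c :+ d :* e)) :+ h :* V) :=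
                   N :* (P :* (e :* e) :+ P :* (e :* e) :* (d :* d) :+ (con 2 :* P :* c :* d :* e :+ (P :* (c :* c) :+ h :* V))))
                   refl N P (ε ω) c (𝟙 b) (fromℕ h) V ⟩
            N * (P * (ε ω * ε ω) + P * (ε ω * ε ω) * (𝟙 b * 𝟙 b) + (2# * P * c * 𝟙 b * ε ω + (P * (c * c) + fromℕ h * V)))
              ≤⟨ *-monoˡ-≤ (proj₁ (0<cardinality (levelSpace ⋆ h))) (+-monoˡ-≤ _ (+-monoʳ-≤ (P * (ε ω * ε ω))
                   (*-monoˡ-≤ (*-nonNegative 0≤P (0≤x² (ε ω))) (𝟙²≤1 b)))) ⟩
            N * (P * (ε ω * ε ω) + P * (ε ω * ε ω) * 1# + (2# * P * c * 𝟙 b * ε ω + (P * (c * c) + fromℕ h * V)))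
              ≡⟨ cong (λ a → N * (a + (2# * P * c * 𝟙 b * ε ω + (P * (c * c) + fromℕ h * V))))
                   (solve 2 (λ P e → P :* (e :* e) :+ P :* (e :* e) :* con 1 := con 2 :* P :* (e :* e)) refl P (ε ω)) ⟩
            N * (2# * P * (ε ω * ε ω) + (2# * P * c * 𝟙 b * ε ω + (P * (c * c) + fromℕ h * V))) ∎
            where
            e  = 𝟙 (not (does (∣ ε ω ∣ ≤? λ#)))
            c′ = c + 𝟙 b * ε ω
            F  = total (levelSpace ⋆ h) (λ ωs → inaccurate ωs (child b p) c′)

-- Majorities, medians and amplification by repetition.

does-true : {P : Set} (P? : Dec P) → does P? ≡ true → P
does-true (yes p) _ = p

countᵇ : ∀ {n} → (Fin n → Bool) → ℕ
countᵇ {zero}  b = 0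
countᵇ {suc n} b = (if b zero then 1 else 0) ℕ.+ countᵇ (b ∘ suc)

Majority : ∀ {n} → (Fin n → Bool) → Set
Majority {n} b = 2 ℕ.* countᵇ (not ∘ b) ℕ.< n

majority? : ∀ {n} (b : Fin n → Bool) → Dec (Majority b)
majority? {n} b = 2 ℕ.* countᵇ (not ∘ b) ℕ.<? n

countᵇ-mono : ∀ {n} {b c : Fin n → Bool} → (∀ i → b i ≡ true → c i ≡ true) → countᵇ (not ∘ c) ℕ.≤ countᵇ (not ∘ b)
countᵇ-mono {zero}  b⇒c = ℕ.z≤n
countᵇ-mono {suc n} {b} {c} b⇒c = ℕ.+-mono-≤ (first (b zero) (c zero) (b⇒c zero)) (countᵇ-mono (b⇒c ∘ suc))
  where
  first : ∀ x y → (x ≡ true → y ≡ true) → (if not y then 1 else 0) ℕ.≤ (if not x then 1 else 0)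
  first x     true  _ = ℕ.z≤n
  first false false _ = ℕ.≤-refl
  first true  false h = contradiction (h refl) (λ ())

Majority-mono : ∀ {n} {b c : Fin n → Bool} → (∀ i → b i ≡ true → c i ≡ true) → Majority b → Majority c
Majority-mono b⇒c maj = ℕ.≤-<-trans (ℕ.*-monoʳ-≤ 2 (countᵇ-mono b⇒c)) maj

countᵇ-overlap : ∀ {n} (b c : Fin n → Bool) → countᵇ (not ∘ b) ℕ.+ countᵇ (not ∘ c) ℕ.< n →
  ∃[ i ] b i ≡ true × c i ≡ true
countᵇ-overlap {zero}  b c ()
countᵇ-overlap {suc n} b c lt with b zero in b₀ | c zero in c₀
... | true  | true  = zero , b₀ , c₀
... | false | _     = Product.map suc (λ z → z) (countᵇ-overlap (b ∘ suc) (c ∘ suc)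
  (ℕ.≤-<-trans (ℕ.+-monoʳ-≤ (countᵇ (not ∘ b ∘ suc)) (ℕ.m≤n+m _ _)) (ℕ.s<s⁻¹ lt)))
... | true  | false = Product.map suc (λ z → z) (countᵇ-overlap (b ∘ suc) (c ∘ suc)
  (ℕ.s<s⁻¹ (subst (ℕ._< suc n) (ℕ.+-suc (countᵇ (not ∘ b ∘ suc)) _) lt)))

Majority-overlap : ∀ {n} (b c : Fin n → Bool) → Majority b → Majority c → ∃[ i ] b i ≡ true × c i ≡ true
Majority-overlap {n} b c majᵇ majᶜ = countᵇ-overlap b c (ℕ.*-cancelˡ-< 2 _ _
  (subst₂ ℕ._<_ (sym (ℕ.*-distribˡ-+ 2 (countᵇ (not ∘ b)) _)) (cong (n ℕ.+_) (sym (ℕ.+-identityʳ n))) (ℕ.+-mono-< majᵇ majᶜ)))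

module Median (R : RealField) where
  open OrderedField R

  median : ∀ {n} → Vector ℝ n → ℝ
  median e = sup λ z → Majority (λ i → does (z ≤? e i))

  median-between : ∀ {n} (e : Vector ℝ n) (b : Fin n → Bool) {lo hi} → Majority b →
    (∀ i → b i ≡ true → lo ≤ e i × e i ≤ hi) → lo ≤ median e × median e ≤ hi
  median-between e b {lo} {hi} maj within =
    sup-upper _ (lo , lo∈) (hi , below) lo lo∈ , sup-least _ (lo , lo∈) hi below
    where
    lo∈ : Majority (λ i → does (lo ≤? e i))
    lo∈ = Majority-mono (λ i bᵢ → dec-true (lo ≤? e i) (proj₁ (within i bᵢ))) maj
    below : ∀ z → Majority (λ i → does (z ≤? e i)) → z ≤ hi
    below z maj-z with Majority-overlap b (λ i → does (z ≤? e i)) maj maj-z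
    ... | i , bᵢ , z≤ᵇ = ≤-trans (does-true (z ≤? e i) z≤ᵇ) (proj₂ (within i bᵢ))

module Amplification (R : RealField) (w : ℕ) where
  open OrderedField R
  open Indicator R
  open Logarithm R
  open Probability R w
  open Space

  module _ {X : Set} (S : Space X) (good : X → Bool)
    (rare : fromℕ 16 * total S (λ ω → 𝟙 (not (good ω))) ≤ cardinality S) where

    failures : ∀ {t} → Vec X t → ℕ
    failures ωs = countᵇ (λ r → not (good (lookup ωs r)))

    private
      weight : ∀ {t} → Vec X t → ℝ
      weight ωs = fromℕ (16 ℕ.^ failures ωs)

    -- An exponential moment of the number of failures. One repetition contributes a factor of mean
    -- at most 1 + 16 / 16 = 2, and the repetitions are independent.
    total-weight : ∀ t → total (S ⋆ t) weight ≤ 2# ^ t * cardinality (S ⋆ t)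
    total-weight zero    = ≤-reflexive (trans (+-identityʳ _) (sym (*-identityˡ _)))
    total-weight (suc t) = begin
      total (S ⋆ suc t) weight
        ≡⟨ total-∷ S t weight ⟩
      total S (λ ω → total (S ⋆ t) (λ ωs → weight (ω ∷ ωs)))
        ≡⟨ total-cong S (λ ω → trans (total-cong (S ⋆ t) (factor ω)) (total-*ˡ (S ⋆ t) (g ω) weight)) ⟩
      total S (λ ω → g ω * W)
        ≡⟨ total-*ʳ S W g ⟩
      total S g * W
        ≤⟨ *-monoʳ-≤ (total-nonNegative (S ⋆ t) (λ ωs → 0≤fromℕ (16 ℕ.^ failures ωs))) total-g ⟩
      2# * N * W
        ≤⟨ *-monoˡ-≤ (*-nonNegative 0≤2 (proj₁ (0<cardinality S))) (total-weight t) ⟩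
      2# * N * (2# ^ t * Nₜ)
        ≡⟨ solve 4 (λ a n p m → a :* n :* (p :* m) := a :* p :* (n :* m)) refl 2# N (2# ^ t) Nₜ ⟩
      2# * 2# ^ t * (N * Nₜ)
        ≡⟨ cong (2# * 2# ^ t *_) (cardinality-⊗ S (S ⋆ t)) ⟨
      2# ^ suc t * cardinality (S ⋆ suc t) ∎
      where
      open ≤-Reasoning
      N  = cardinality S
      Nₜ = cardinality (S ⋆ t)
      W  = total (S ⋆ t) weight
      g : X → ℝ
      g ω = if not (good ω) then fromℕ 16 else 1#
      factor : ∀ ω ωs → weight (ω ∷ ωs) ≡ g ω * weight ωs
      factor ω ωs with good ω
      ... | true  = sym (*-identityˡ _)
      ... | false = fromℕ-* 16 (16 ℕ.^ failures ωs)
      g≤ : ∀ ω → g ω ≤ 1# + fromℕ 16 * 𝟙 (not (good ω))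
      g≤ ω with good ω
      ... | true  = ≤-reflexive (sym (trans (cong (1# +_) (zeroʳ _)) (+-identityʳ _)))
      ... | false = ≤-by 1# 0≤1 (trans (cong (1# +_) (*-identityʳ _)) (+-comm _ _))
      total-g : total S g ≤ 2# * N
      total-g = ≤-trans (total-mono S g≤) (subst₂ _≤_
        (sym (trans (total-+ S (λ _ → 1#) (λ ω → fromℕ 16 * 𝟙 (not (good ω))))
          (cong₂ _+_ (trans (total-const S 1#) (*-identityʳ N)) (total-*ˡ S (fromℕ 16) (λ ω → 𝟙 (not (good ω)))))))
        (solve 1 (λ n → n :+ n := con 2 :* n) refl N)
        (+-monoʳ-≤ N rare))

    -- Without a majority at least half of the `t` repetitions fail, so the weight is at least 16 ^
    -- (t / 2) = 4 ^ t. Its mean is at most 2 ^ t, and Markov's inequality leaves a probability of 2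
    -- ^ -t.
    total-no-majority : ∀ t →
      2# ^ t * total (S ⋆ t) (λ ωs → 𝟙 (not (does (majority? (λ r → good (lookup ωs r)))))) ≤ cardinality (S ⋆ t)
    total-no-majority t = *-cancelˡ-≤ (^-positive (0<fromℕ 2) t) (begin
      2# ^ t * (2# ^ t * total (S ⋆ t) bad)      ≡⟨ *-assoc _ _ _ ⟨
      2# ^ t * 2# ^ t * total (S ⋆ t) bad        ≡⟨ total-*ˡ (S ⋆ t) (2# ^ t * 2# ^ t) bad ⟨
      total (S ⋆ t) (λ ωs → 2# ^ t * 2# ^ t * bad ωs) ≤⟨ total-mono (S ⋆ t) markov ⟩
      total (S ⋆ t) weight                       ≤⟨ total-weight t ⟩
      2# ^ t * cardinality (S ⋆ t)               ∎)
      where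
      open ≤-Reasoning
      bad : Vec X t → ℝ
      bad ωs = 𝟙 (not (does (majority? (λ r → good (lookup ωs r)))))
      4ᵗ : 2# ^ t * 2# ^ t ≡ fromℕ (4 ℕ.^ t)
      4ᵗ = trans (sym (^-distrib-* 2# 2# t)) (trans (cong (_^ t) (sym (fromℕ-* 2 2))) (sym (fromℕ-^ 4 t)))
      markov : ∀ ωs → 2# ^ t * 2# ^ t * bad ωs ≤ weight ωs
      markov ωs = cases (majority? good-at)
        where
        good-at = λ r → good (lookup ωs r)
        cases : Dec (Majority good-at) → 2# ^ t * 2# ^ t * bad ωs ≤ weight ωs
        cases (yes maj) = subst (λ b → 2# ^ t * 2# ^ t * 𝟙 (not b) ≤ weight ωs) (sym (dec-true (majority? good-at) maj))
          (subst (_≤ weight ωs) (sym (zeroʳ _)) (0≤fromℕ (16 ℕ.^ failures ωs)))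
        cases (no ¬maj) = subst (λ b → 2# ^ t * 2# ^ t * 𝟙 (not b) ≤ weight ωs) (sym (dec-false (majority? good-at) ¬maj))
          (subst (_≤ weight ωs) (sym (trans (*-identityʳ _) 4ᵗ)) (fromℕ-mono
            (ℕ.≤-trans (ℕ.^-monoʳ-≤ 4 (ℕ.≮⇒≥ ¬maj)) (ℕ.≤-reflexive (sym (ℕ.^-*-assoc 4 2 (failures ωs)))))))

-- The failure probability of one repetition.

module Reliability (R : RealField) (w k : ℕ) {U : ℕ} where
  open OrderedField R
  open Indicator R
  open Logarithm R
  open Probability R w
  open LevelSketch R w k
  open Dyadic R w k {U}
  open Space

  module _ (x : Vector ℝ U) (0≤x : ∀ v → 0# ≤ x v) (U≤ : U ℕ.≤ 2 ℕ.^ w)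
    (L : ℕ) .{{_ : NonZero L}} (L≤ : 2 ℕ.^ L ℕ.≤ 2 ℕ.^ suc w)
    {β : ℝ} (0≤β : 0# ≤ β) (wide : fromℕ (32 ℕ.* L) ≤ 2# ^ k * 2# ^ k * (β * β)) (right : ℕ → Bool) where

    open Path x (β * sum x) right

    reliable : Vec LevelSeed L → Bool
    reliable ωs = does (accurate? ωs 0 0#)

    private
      0≤T : 0# ≤ sum x
      0≤T = sum-nonNegative 0≤x
      root≤ : 1 ℕ.* 2 ℕ.^ L ℕ.≤ 2 ℕ.^ suc w
      root≤ = subst (ℕ._≤ 2 ℕ.^ suc w) (sym (ℕ.*-identityˡ (2 ℕ.^ L))) L≤

    -- Kolmogorov's bound with λ = β‖x‖₁ is 2 L / (4 ^ k β²), at most 2 L / (32 L) = 1/16: hence the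
    -- 32 in `wide`. A factor ‖x‖₁² is cancelled on the way, so a vanishing ‖x‖₁ is treated apart.
    rarely-unreliable : fromℕ 16 * total (levelSpace ⋆ L) (λ ωs → 𝟙 (not (reliable ωs))) ≤ cardinality (levelSpace ⋆ L)
    rarely-unreliable with 0# ≟ᵣ sum x
    ... | yes 0≡T = subst (_≤ N) (sym (trans (cong (fromℕ 16 *_) (trans
        (total-cong (levelSpace ⋆ L) (λ ωs → cong (λ b → 𝟙 (not b)) (dec-true (accurate? ωs 0 0#)
          (accurate-if-empty 0≤x U≤ (*-nonNegative 0≤β 0≤T) (sym 0≡T) ωs 0 root≤ 0# refl))))
        (trans (total-const (levelSpace ⋆ L) 0#) (zeroʳ _)))) (zeroʳ _))) (proj₁ (0<cardinality (levelSpace ⋆ L)))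
      where N = cardinality (levelSpace ⋆ L)
    ... | no 0≢T = *-cancelˡ-≤ (*-positive (*-positive (0<fromℕ 2) (0<fromℕ L)) (*-positive 0<T 0<T)) (begin
        2# * fromℕ L * (T₀ * T₀) * (fromℕ 16 * B)
          ≡⟨ solve 5 (λ a l s t b → a :* l :* (t :* t) :* (s :* b) := s :* a :* l :* (t :* t :* b)) refl 2# (fromℕ L) (fromℕ 16) T₀ B ⟩
        fromℕ 16 * 2# * fromℕ L * (T₀ * T₀ * B)
          ≡⟨ cong (_* (T₀ * T₀ * B)) (trans (cong (_* fromℕ L) (sym (fromℕ-* 16 2))) (sym (fromℕ-* 32 L))) ⟩
        fromℕ (32 ℕ.* L) * (T₀ * T₀ * B)
          ≤⟨ *-monoʳ-≤ (*-nonNegative (0≤x² T₀) (total-nonNegative (levelSpace ⋆ L) (λ ωs → 0≤𝟙 (not (reliable ωs))))) wide ⟩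
        P * (β * β) * (T₀ * T₀ * B)
          ≡⟨ solve 4 (λ P b t B → P :* (b :* b) :* (t :* t :* B) := P :* (b :* t :* (b :* t)) :* B) refl P β T₀ B ⟩
        P * (β * T₀ * (β * T₀)) * B
          ≤⟨ total-inaccurate 0≤x U≤ (*-nonNegative 0≤β 0≤T) L 0 root≤ 0# ⟩
        N * (P * (0# * 0#) + fromℕ L * (2# * (T₀ * T₀)))
          ≡⟨ solve 5 (λ N P l a t → N :* (P :* (con 0 :* con 0) :+ l :* (a :* (t :* t))) := a :* l :* (t :* t) :* N) refl
               N P (fromℕ L) 2# T₀ ⟩
        2# * fromℕ L * (T₀ * T₀) * N ∎)
      where
      open ≤-Reasoning
      T₀ = sum x
      0<T : 0# < T₀
      0<T = 0≤T , 0≢T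
      N = cardinality (levelSpace ⋆ L)
      P = 2# ^ k * 2# ^ k
      B = total (levelSpace ⋆ L) (λ ωs → 𝟙 (not (reliable ωs)))

-- Addresses of counters, and elementary properties of ranks.

fromBits : ∀ {k} → Vec Bool k → Fin (2 ℕ.^ k)
fromBits []       = zero
fromBits (b ∷ bs) = combine {2} (if b then suc zero else zero) (fromBits bs)

toBits : ∀ k → Fin (2 ℕ.^ k) → Vec Bool k
toBits zero    _ = []
toBits (suc k) i = uncurry (λ b j → isOne b ∷ toBits k j) (remQuot {2} (2 ℕ.^ k) i)

toBits-fromBits : ∀ {k} (bs : Vec Bool k) → toBits k (fromBits bs) ≡ bs
toBits-fromBits []               = refl
toBits-fromBits {suc k} (b ∷ bs) = trans
  (cong (uncurry (λ b j → isOne b ∷ toBits k j)) (Fin.remQuot-combine {2} {2 ℕ.^ k} (if b then suc zero else zero) (fromBits bs)))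
  (cong₂ _∷_ (isOne-if b) (toBits-fromBits bs))
  where
  isOne-if : ∀ b → isOne (if b then suc zero else zero) ≡ b
  isOne-if true  = refl
  isOne-if false = refl

module Rank (R : RealField) {U : ℕ} where
  open OrderedField R
  open Streaming R

  stays⇒nonNegative : ∀ (x : Vector ℝ U) σ → StaysNonNegative x σ → NonNegative (foldl apply x σ)
  stays⇒nonNegative x []      0≤x       = 0≤x
  stays⇒nonNegative x (e ∷ σ) (_ , ok) = stays⇒nonNegative (apply x e) σ ok

  ‖‖₁≡sum : ∀ {x : Vector ℝ U} → NonNegative x → ‖ x ‖₁ ≡ sum x
  ‖‖₁≡sum 0≤x = sum-cong (0≤⇒∣∣≡ ∘ 0≤x)

  rank-0 : ∀ (x : Vector ℝ U) → rank x 0 ≡ 0#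
  rank-0 x = sum-replicate-zero U

  rank-all : ∀ (x : Vector ℝ U) k → U ℕ.≤ k → rank x k ≡ sum x
  rank-all x k U≤k = sum-cong λ v → cong (λ b → if b then x v else 0#)
    (dec-true (index v ℕ.≤? k) (ℕ.≤-trans (Fin.toℕ<n v) U≤k))

  rank-mono : ∀ {x : Vector ℝ U} → NonNegative x → ∀ {j k} → j ℕ.≤ k → rank x j ≤ rank x k
  rank-mono {x} 0≤x {j} {k} j≤k = sum-mono λ v → term v (index v ℕ.≤? j)
    where
    term : ∀ v → Dec (index v ℕ.≤ j) →
      (if does (index v ℕ.≤? j) then x v else 0#) ≤ (if does (index v ℕ.≤? k) then x v else 0#)
    term v (yes v≤j) = ≤-reflexive (cong (λ b → if b then x v else 0#)
      (trans (dec-true (index v ℕ.≤? j) v≤j) (sym (dec-true (index v ℕ.≤? k) (ℕ.≤-trans v≤j j≤k)))))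
    term v (no v≰j) = subst (λ b → (if b then x v else 0#) ≤ (if does (index v ℕ.≤? k) then x v else 0#)) (sym (dec-false (index v ℕ.≤? j) v≰j))
      (0≤if (does (index v ℕ.≤? k)))
      where
      0≤if : ∀ b → 0# ≤ (if b then x v else 0#)
      0≤if true  = 0≤x v
      0≤if false = ≤-refl

  rank≤sum : ∀ {x : Vector ℝ U} → NonNegative x → ∀ k → rank x k ≤ sum x
  rank≤sum {x} 0≤x k = ≤-trans (rank-mono 0≤x {k} {k ℕ.+ U} (ℕ.m≤m+n k U)) (≤-reflexive (rank-all x (k ℕ.+ U) (ℕ.m≤n+m U k)))

  0≤rank : ∀ {x : Vector ℝ U} → NonNegative x → ∀ k → 0# ≤ rank x k
  0≤rank {x} 0≤x k = subst (_≤ rank x k) (rank-0 x) (rank-mono 0≤x {0} {k} ℕ.z≤n)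

-- The whole sketch, and descents through the tree.

module DyadicSketch (R : RealField) (w k : ℕ) {U : ℕ} (L t : ℕ) where
  open OrderedField R
  open Indicator R
  open Logarithm R
  open Median R
  open Probability R w
  open Streaming R
  open LevelSketch R w k
  open Dyadic R w k {U}
  open Rank R {U}
  open Space

  Seed : Set
  Seed = Vec (Vec LevelSeed L) t

  seedSpace : Space Seed
  seedSpace = levelSpace ⋆ L ⋆ t

  cells : ℕ
  cells = t ℕ.* (L ℕ.* 2 ℕ.^ (2 ℕ.+ k))

  address : Fin cells → Fin t × Fin L × Cell
  address = Product.map₂ (Product.map₂ (toBits (2 ℕ.+ k)) ∘ remQuot {L} (2 ℕ.^ (2 ℕ.+ k))) ∘
            remQuot {t} (L ℕ.* 2 ℕ.^ (2 ℕ.+ k))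

  select : Seed → Fin U → Fin cells → Bool
  select ωss v i = let r , l , c = address i in selectsAt (lookup ωss r) v l c

  cell : Vector ℝ cells → Fin t → Fin L → Cell → ℝ
  cell cs r l c = cs (combine r (combine l (fromBits c)))

  cell-counts : ∀ (x : Vector ℝ U) ωss {cs} → (∀ i → cs i ≡ sum (λ v → 𝟙 (select ωss v i) * x v)) →
    ∀ r → CountsAt x (lookup ωss r) (cell cs r)
  cell-counts x ωss counts r l c = trans (counts _) (sum-cong (λ v → cong (λ b → 𝟙 b * x v) (select-cell v)))
    where
    address-cell : address (combine r (combine l (fromBits c))) ≡ (r , l , c)
    address-cell = trans
      (cong (Product.map₂ (Product.map₂ (toBits (2 ℕ.+ k)) ∘ remQuot {L} (2 ℕ.^ (2 ℕ.+ k)))) (Fin.remQuot-combine {t} r (combine l (fromBits c))))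
      (cong (r ,_) (trans
        (cong (Product.map₂ (toBits (2 ℕ.+ k))) (Fin.remQuot-combine {L} l (fromBits c)))
        (cong (l ,_) (toBits-fromBits c))))
    select-cell : ∀ v → select ωss v (combine r (combine l (fromBits c))) ≡ selectsAt (lookup ωss r) v l c
    select-cell v = cong (λ { (r , l , c) → selectsAt (lookup ωss r) v l c }) address-cell

  pathSum : (ℕ → Bool) → ∀ {h} → Vec LevelSeed h → (Fin h → Cell → ℝ) → ℕ → ℝ → ℝ
  pathSum right         []       cs p a = a
  pathSum right {suc h} (ω ∷ ωs) cs p a =
    pathSum right ωs (cs ∘ suc) (child b p) (a + 𝟙 b * estimate ω p (cs zero))
    where b = right (middle h p)

  -- All repetitions descend together, guided by the median estimate of the
  -- rank at the middle of the node.
  walk : ℝ → ∀ {h} → (Fin t → Vec LevelSeed h) → (Fin t → Fin h → Cell → ℝ) → ℕ → Vector ℝ t → ℕ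
  walk q {zero}  ωs cs p a = p
  walk q {suc h} ωs cs p a =
    walk q (tail ∘ ωs) (λ r → cs r ∘ suc) (child b p) (λ r → a r + 𝟙 b * estimate (head (ωs r)) p (cs r zero))
    where b = not (does (q ≤? median (λ r → a r + estimate (head (ωs r)) p (cs r zero))))

  walk-bounds : ∀ q {h} ωs cs p a → p ℕ.* 2 ℕ.^ h ℕ.≤ walk q {h} ωs cs p a ×
    walk q {h} ωs cs p a ℕ.< suc p ℕ.* 2 ℕ.^ h
  walk-bounds q {zero}  ωs cs p a = ℕ.≤-reflexive (ℕ.*-identityʳ p) , ℕ.≤-reflexive (sym (ℕ.*-identityʳ (suc p)))
  walk-bounds q {suc h} ωs cs p a = ℕ.≤-trans (child-start≥ b p h) (proj₁ below) , ℕ.≤-trans (proj₂ below) (child-end≤ b p h)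
    where
    b = not (does (q ≤? median (λ r → a r + estimate (head (ωs r)) p (cs r zero))))
    below = walk-bounds q {h} (tail ∘ ωs) (λ r → cs r ∘ suc) (child b p)
      (λ r → a r + 𝟙 b * estimate (head (ωs r)) p (cs r zero))

  -- The turn `b` at the boundary `m` settles the matter: whichever leaf on the chosen side is
  -- reached later, it is good.
  Turned : (ℕ → Set) → ℕ → Bool → Set
  Turned Good m b = ∀ z → (b ≡ true → m ℕ.≤ z) → (b ≡ false → z ℕ.< m) → Good z

  module Descent (x : Vector ℝ U) (λ# : ℝ) (right : ℕ → Bool) where
    open Path x λ# right

    estimate≡mass+error : ∀ {h} ω (ωs : Vec LevelSeed h) cs p → CountsAt x (ω ∷ ωs) cs →
      estimate ω p (cs zero) ≡ Error.mass x (active h) (key h) p + error h p ω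
    estimate≡mass+error {h} ω ωs cs p counts = Error.estimate≡ x (active h) (key h) p ω (cs zero) (counts zero)

    boundary-estimate : ∀ {h} ω (ωs : Vec LevelSeed h) cs p a c → CountsAt x (ω ∷ ωs) cs →
      a ≡ rank x (p ℕ.* 2 ℕ.^ suc h) + c → a + estimate ω p (cs zero) ≡ rank x (middle h p) + (c + error h p ω)
    boundary-estimate {h} ω ωs cs p a c counts refl
      rewrite estimate≡mass+error ω ωs cs p counts | rank-split x h p =
      solve 4 (λ r c m e → r :+ c :+ (m :+ e) := r :+ m :+ (c :+ e)) refl
        (rank x (p ℕ.* 2 ℕ.^ suc h)) c (Error.mass x (active h) (key h) p) (error h p ω)

    advance : ∀ {h} ω (ωs : Vec LevelSeed h) cs p b a c → CountsAt x (ω ∷ ωs) cs →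
      a ≡ rank x (p ℕ.* 2 ℕ.^ suc h) + c →
      a + 𝟙 b * estimate ω p (cs zero) ≡ rank x (child b p ℕ.* 2 ℕ.^ h) + (c + 𝟙 b * error h p ω)
    advance {h} ω ωs cs p true  a c counts a≡ = trans (cong (a +_) (*-identityˡ _))
      (trans (boundary-estimate ω ωs cs p a c counts a≡) (cong (λ e → rank x (middle h p) + (c + e)) (sym (*-identityˡ _))))
    advance {h} ω ωs cs p false a c counts a≡ = begin
      a + 0# * estimate ω p (cs zero)                        ≡⟨ solve 2 (λ a e → a :+ con 0 :* e := a) refl a (estimate ω p (cs zero)) ⟩
      a                                                      ≡⟨ a≡ ⟩
      rank x (p ℕ.* 2 ℕ.^ suc h) + c                         ≡⟨ cong₂ (λ b c → rank x b + c) (sym (*2*2^≡ p h))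
                                                                  (solve 2 (λ c e → c := c :+ con 0 :* e) refl c (error h p ω)) ⟩
      rank x (p ℕ.* 2 ℕ.* 2 ℕ.^ h) + (c + 0# * error h p ω)  ∎
      where open ≡-Reasoning

    -- The path keeps `τ` inside the current node and so ends at the leaf `τ`. There the exact part
    -- of the sum is `rank x τ`, and the rest is the error that `Accurate` bounds.
    pathSum-accurate : ∀ τ → (∀ b → right b ≡ does (b ℕ.≤? τ)) → ∀ {h} (ωs : Vec LevelSeed h) cs p a c →
      CountsAt x ωs cs → a ≡ rank x (p ℕ.* 2 ℕ.^ h) + c →
      p ℕ.* 2 ℕ.^ h ℕ.≤ τ → τ ℕ.< suc p ℕ.* 2 ℕ.^ h → Accurate ωs p c →
      ∣ pathSum right ωs cs p a - rank x τ ∣ ≤ λ#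
    pathSum-accurate τ right≡ [] cs p a c counts refl p≤τ τ<p ∣c∣≤λ
      with refl ← ℕ.≤-antisym p≤τ (ℕ.≤-trans (ℕ.s≤s⁻¹ (subst (τ ℕ.<_) (ℕ.*-identityʳ (suc p)) τ<p))
             (ℕ.≤-reflexive (sym (ℕ.*-identityʳ p)))) =
      subst (λ e → ∣ e ∣ ≤ λ#) (solve 2 (λ r c → c := r :+ c :- r) refl (rank x (p ℕ.* 1)) c) ∣c∣≤λ
    pathSum-accurate τ right≡ {suc h} (ω ∷ ωs) cs p a c counts a≡ p≤τ τ<p (_ , _ , acc) =
      pathSum-accurate τ right≡ ωs (cs ∘ suc) (child b p) (a + 𝟙 b * estimate ω p (cs zero)) (c + 𝟙 b * error h p ω)
        (counts ∘ suc) (advance ω ωs cs p b a c counts a≡) (proj₁ bounds) (proj₂ bounds) acc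
      where
      b = right (middle h p)
      cases : ∀ b → b ≡ does (middle h p ℕ.≤? τ) → Dec (middle h p ℕ.≤ τ) →
        child b p ℕ.* 2 ℕ.^ h ℕ.≤ τ × τ ℕ.< suc (child b p) ℕ.* 2 ℕ.^ h
      cases true  eq (yes m≤τ) = m≤τ , ℕ.<-≤-trans τ<p (ℕ.≤-reflexive (sym (*2*2^≡ (suc p) h)))
      cases false eq (yes m≤τ) = contradiction (trans eq (dec-true (middle h p ℕ.≤? τ) m≤τ)) (λ ())
      cases true  eq (no  m≰τ) = contradiction (trans eq (dec-false (middle h p ℕ.≤? τ) m≰τ)) (λ ())
      cases false eq (no  m≰τ) = ℕ.≤-trans (ℕ.≤-reflexive (*2*2^≡ p h)) p≤τ , ℕ.≰⇒> m≰τ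
      bounds = cases b (right≡ (middle h p)) (middle h p ℕ.≤? τ)

    -- Where the walk leaves the path of `right`, its answer is required to be
    -- good already; the estimates off that path are never used.
    module Walk (q : ℝ) (Good : ℕ → Set) (Invariant : ℕ → ℕ → Set)
      (leaf : ∀ p → Invariant p 0 → Good p)
      (descend : ∀ p h → Invariant p (suc h) → Invariant (child (right (middle h p)) p) h)
      (turn : ∀ m e → rank x m - (λ# + λ#) ≤ e → e ≤ rank x m + (λ# + λ#) →
        not (does (q ≤? e)) ≡ right m ⊎ Turned Good m (not (does (q ≤? e)))) where

      -- The majority consists of repetitions that are accurate along the entire path of `right`,
      -- which is fixed in advance. It therefore persists while the walk follows this path, and no
      -- union bound over nodes is taken although the walk itself depends on the seeds. A median at
      -- a boundary is off by at most 2 `λ#`, one `λ#` for the accumulated error and one for that of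
      -- the level.
      walk-good : ∀ {h} (ωs : Fin t → Vec LevelSeed h) cs p a (c : Vector ℝ t) → (∀ r → CountsAt x (ωs r) (cs r)) →
        (∀ r → a r ≡ rank x (p ℕ.* 2 ℕ.^ h) + c r) → Majority (λ r → does (accurate? (ωs r) p (c r))) →
        Invariant p h → Good (walk q {h} ωs cs p a)
      walk-good {zero}  ωs cs p a c counts a≡ maj inv = leaf p inv
      walk-good {suc h} ωs cs p a c counts a≡ maj inv =
        cases (turn (middle h p) (median est) (proj₁ med) (proj₂ med))
        where
        ε : Fin t → ℝ
        ε r = error h p (head (ωs r))
        est : Vector ℝ t
        est r = a r + estimate (head (ωs r)) p (cs r zero)
        good : Fin t → Bool
        good r = does (accurate? (ωs r) p (c r))
        counts∷ : ∀ r → CountsAt x (head (ωs r) ∷ tail (ωs r)) (cs r)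
        counts∷ r with ωs r | counts r
        ... | ω ∷ ωs′ | cnt = cnt
        accurate-parts : ∀ r → good r ≡ true →
          ∣ c r ∣ ≤ λ# × ∣ ε r ∣ ≤ λ# × Accurate (tail (ωs r)) (child (right (middle h p)) p) (c r + 𝟙 (right (middle h p)) * ε r)
        accurate-parts r gr with ωs r
        ... | ω ∷ ωs′ = does-true (accurate? (ω ∷ ωs′) p (c r)) gr
        med : rank x (middle h p) - (λ# + λ#) ≤ median est × median est ≤ rank x (middle h p) + (λ# + λ#)
        med = median-between est good maj λ r gr → let ∣c∣≤ , ∣ε∣≤ , _ = accurate-parts r gr in
          subst (λ e → rank x (middle h p) - (λ# + λ#) ≤ e × e ≤ rank x (middle h p) + (λ# + λ#))
            (sym (boundary-estimate (head (ωs r)) (tail (ωs r)) (cs r) p (a r) (c r) (counts∷ r) (a≡ r)))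
            ( subst (_≤ rank x (middle h p) + (c r + ε r))
                (solve 2 (λ R l → R :+ (:- l :+ :- l) := R :- (l :+ l)) refl (rank x (middle h p)) λ#)
                (+-monoʳ-≤ (rank x (middle h p)) (+-mono-≤ (lower {c r} ∣c∣≤) (lower {ε r} ∣ε∣≤)))
            , +-monoʳ-≤ (rank x (middle h p)) (+-mono-≤ (≤-trans (≤⊔ˡ (c r) _) ∣c∣≤) (≤-trans (≤⊔ˡ (ε r) _) ∣ε∣≤)) )
          where
          lower : ∀ {e} → ∣ e ∣ ≤ λ# → - λ# ≤ e
          lower {e} ∣e∣≤ = subst (- λ# ≤_) (-‿involutive e) (neg-mono-≤ (≤-trans (≤⊔ʳ e (- e)) ∣e∣≤))
        b = not (does (q ≤? median est))
        cases : b ≡ right (middle h p) ⊎ Turned Good (middle h p) b →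
          Good (walk q {suc h} ωs cs p a)
        cases (inj₁ b≡) = walk-good {h} (tail ∘ ωs) (λ r → cs r ∘ suc) (child b p)
          (λ r → a r + 𝟙 b * estimate (head (ωs r)) p (cs r zero)) (λ r → c r + 𝟙 b * ε r)
          (λ r → counts∷ r ∘ suc)
          (λ r → advance (head (ωs r)) (tail (ωs r)) (cs r) p b (a r) (c r) (counts∷ r) (a≡ r))
          (Majority-mono (λ r gr → dec-true (accurate? (tail (ωs r)) (child b p) (c r + 𝟙 b * ε r))
            (subst (λ b → Accurate (tail (ωs r)) (child b p) (c r + 𝟙 b * ε r)) (sym b≡) (proj₂ (proj₂ (accurate-parts r gr))))) maj)
          (subst (λ b → Invariant (child b p) h) (sym b≡) (descend p h inv))
        cases (inj₂ good) = good (walk q {suc h} ωs cs p a)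
          (λ b≡true → ℕ.≤-trans (ℕ.≤-reflexive (cong (λ b → child b p ℕ.* 2 ℕ.^ h) (sym b≡true))) (proj₁ range))
          (λ b≡false → ℕ.<-≤-trans (proj₂ range) (ℕ.≤-reflexive (cong (λ b → suc (child b p) ℕ.* 2 ℕ.^ h) b≡false)))
          where
          range = walk-bounds q {h} (tail ∘ ωs) (λ r → cs r ∘ suc) (child b p) (λ r → a r + 𝟙 b * estimate (head (ωs r)) p (cs r zero))

-- Answering rank queries.

module Answers (R : RealField) (w : ℕ) {U : ℕ} where
  open OrderedField R
  open Indicator R
  open Logarithm R
  open Median R
  open Probability R w
  open Streaming R
  open Rank R {U}
  open Space

  -- Applied with `P` = 2 ^ t, and with `s` the number of fixed paths on which a majority has to be
  -- accurate: one for a rank, two for a quantile.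
  total-good : ∀ {X} (S : Space X) (good : X → Bool) {P q s} → 0# < P →
    P * total S (λ ω → 𝟙 (not (good ω))) ≤ s * cardinality S → q * P ≤ P - s →
    q * cardinality S ≤ total S (λ ω → 𝟙 (good ω))
  total-good S good {P} {q} {s} 0<P bad≤ qP≤ = *-cancelˡ-≤ 0<P (begin
    P * (q * N)           ≡⟨ solve 3 (λ P q N → P :* (q :* N) := q :* P :* N) refl P q N ⟩
    q * P * N             ≤⟨ *-monoʳ-≤ (proj₁ (0<cardinality S)) qP≤ ⟩
    (P - s) * N           ≡⟨ solve 3 (λ P s N → (P :- s) :* N := P :* N :- s :* N) refl P s N ⟩
    P * N - s * N         ≤⟨ +-monoʳ-≤ (P * N) (neg-mono-≤ bad≤) ⟩
    P * N - P * B         ≡⟨ cong (λ N → P * N - P * B) (trans (sym (trans (total-const S 1#) (*-identityʳ N)))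
                               (trans (sym (total-cong S (λ ω → 𝟙-not (good ω)))) (total-+ S (𝟙 ∘ good) (𝟙 ∘ not ∘ good)))) ⟩
    P * (G + B) - P * B   ≡⟨ solve 3 (λ P G B → P :* (G :+ B) :- P :* B := P :* G) refl P G B ⟩
    P * G                 ∎)
    where
    open ≤-Reasoning
    N = cardinality S
    G = total S (𝟙 ∘ good)
    B = total S (𝟙 ∘ not ∘ good)

  cover : ∀ m {e η} → 0# ≤ e → e ≤ fromℕ (2 ℕ.* suc m) * η →
    Σ[ j ∈ Fin (suc m) ] fromℕ (2 ℕ.* toℕ j) * η ≤ e × e ≤ fromℕ (2 ℕ.* suc (toℕ j)) * η
  cover zero    {e} {η} 0≤e e≤ = zero , subst (_≤ e) (sym (zeroˡ η)) 0≤e , e≤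
  cover (suc m) {e} {η} 0≤e e≤ = cases (e ≤? fromℕ (2 ℕ.* suc m) * η)
    where
    cases : Dec (e ≤ fromℕ (2 ℕ.* suc m) * η) →
      Σ[ j ∈ Fin (suc (suc m)) ] fromℕ (2 ℕ.* toℕ j) * η ≤ e × e ≤ fromℕ (2 ℕ.* suc (toℕ j)) * η
    cases (yes e≤′) = let j , lo , hi = cover m 0≤e e≤′ in inject₁ j ,
      subst (λ i → fromℕ (2 ℕ.* i) * η ≤ e) (sym (Fin.toℕ-inject₁ j)) lo ,
      subst (λ i → e ≤ fromℕ (2 ℕ.* suc i) * η) (sym (Fin.toℕ-inject₁ j)) hi
    cases (no e≰) = Fin.fromℕ (suc m) ,
      subst (λ i → fromℕ (2 ℕ.* i) * η ≤ e) (sym (Fin.toℕ-fromℕ (suc m))) (≰⇒≥ e≰) ,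
      subst (λ i → e ≤ fromℕ (2 ℕ.* suc i) * η) (sym (Fin.toℕ-fromℕ (suc m))) e≤

  -- For δ close to 1 only few words are available.  Then ranks are estimated
  -- with the larger error m ε, and the coin j guesses which of m intervals of
  -- length 2 ε contains the rank.
  module GuessedRank {cells : ℕ} (m-1 : ℕ) (ε : ℝ) {X : Set} (Ω : Space X)
    (select : X → Fin U → Fin cells → Bool) (estimateRank : X → Vector ℝ cells → ℝ → Fin U → ℝ) where

    m : ℕ
    m = suc m-1

    -- The midpoint of the interval number `j` when [-m η , m η] is cut into `m` intervals of length
    -- 2 η.
    shift : Fin m → ℝ → ℝ
    shift j η = fromℕ (suc (2 ℕ.* toℕ j)) * η - fromℕ m * η

    open Sketch {m = m} _ Ω select (λ ω cs s j u → estimateRank ω cs s u + shift j (ε * s)) public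

    shift-covers : ∀ {a r η} → ∣ a - r ∣ ≤ fromℕ m * η → ∃[ j ] ∣ a + shift j η - r ∣ ≤ η
    shift-covers {a} {r} {η} ∣a-r∣≤ = j , ∣∣≤
      (≤-by (e - fromℕ (2 ℕ.* toℕ j) * η) (≤⇒0≤- lo)
        (solve 5 (λ a r M η J → η := (a :+ ((con 1 :+ J) :* η :- M :* η) :- r) :+ (r :- a :+ M :* η :- J :* η)) refl
          a r (fromℕ m) η (fromℕ (2 ℕ.* toℕ j))))
      (≤-by (fromℕ (2 ℕ.* suc (toℕ j)) * η - e) (≤⇒0≤- hi)
        (trans (solve 5 (λ a r M η J → η := :- (a :+ ((con 1 :+ J) :* η :- M :* η) :- r) :+ ((con 2 :+ J) :* η :- (r :- a :+ M :* η)))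
            refl a r (fromℕ m) η (fromℕ (2 ℕ.* toℕ j)))
          (cong (λ K → - (a + shift j η - r) + (K * η - e)) (sym 2j+2))))
      where
      e = r - a + fromℕ m * η
      0≤e : 0# ≤ e
      0≤e = subst (0# ≤_) (solve 3 (λ a r M → M :- (a :- r) := r :- a :+ M) refl a r (fromℕ m * η))
        (≤⇒0≤- (≤-trans (≤⊔ˡ (a - r) _) ∣a-r∣≤))
      e≤ : e ≤ fromℕ (2 ℕ.* m) * η
      e≤ = ≤-by (fromℕ m * η - (- (a - r))) (≤⇒0≤- (≤-trans (≤⊔ʳ (a - r) _) ∣a-r∣≤))
        (trans (cong (_* η) (fromℕ-* 2 m)) (solve 4 (λ a r M η → con 2 :* M :* η :=
          r :- a :+ M :* η :+ (M :* η :- (:- (a :- r)))) refl a r (fromℕ m) η))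
      covered = cover m-1 0≤e e≤
      j  = proj₁ covered
      lo = proj₁ (proj₂ covered)
      hi = proj₂ (proj₂ covered)
      2j+2 : fromℕ (2 ℕ.* suc (toℕ j)) ≡ 2# + fromℕ (2 ℕ.* toℕ j)
      2j+2 = trans (cong fromℕ (ℕ.*-suc 2 (toℕ j))) (fromℕ-+ 2 (2 ℕ.* toℕ j))

    solvesAR : ∀ {δ} → 0# ≤ ε →
      (∀ x → NonNegative x → ∀ u → Σ[ good ∈ (X → Bool) ]
        (∀ ω cs → Counts ω x cs → good ω ≡ true →
          ∣ estimateRank ω cs (sum x) u - rank x (index u) ∣ ≤ fromℕ m * (ε * sum x)) ×
        (1# - δ) * fromℕ m * cardinality Ω ≤ total Ω (λ ω → 𝟙 (good ω))) →
      SolvesAR ε δ algorithm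
    solvesAR {δ} 0≤ε reliable σ n strict (size≤n , _) u with reliable (produced σ) 0≤x u
      where 0≤x = stays⇒nonNegative 0ᵥ σ strict
    ... | good , accurate , likely = answersWithProbability (1# - δ) σ u (isApproxRank? ε n (produced σ) u) (T? ∘ good)
      (λ ω cs counts g → let j , close = shift-covers (accurate ω cs counts (Equivalence.to T-≡ g)) in
        j , ≤-trans close (*-monoˡ-≤ 0≤ε (subst (_≤ fromℕ n) (‖‖₁≡sum (stays⇒nonNegative 0ᵥ σ strict)) size≤n)))
      (subst (_≤ total Ω (λ ω → 𝟙 (good ω)))
        (solve 3 (λ p m N → p :* m :* N := p :* (N :* m)) refl (1# - δ) (fromℕ m) (cardinality Ω)) likely)

  module TotalOnly where

    noCells : ⊤ → Fin U → Fin 0 → Bool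
    noCells _ _ ()

    certain : ∀ {p : ℝ} → p ≤ 1# → p * cardinality trivial ≤ total trivial (λ _ → 𝟙 true)
    certain p≤1 = subst₂ _≤_ (cong (_ *_) (sym fromℕ-1)) (sym (+-identityʳ 1#)) (subst (_≤ 1#) (sym (*-identityʳ _)) p≤1)

  -- The estimate 0 has error at most ‖x‖₁.
  module CoarseRank (m-1 : ℕ) (ε : ℝ) where
    open TotalOnly
    open GuessedRank m-1 ε trivial noCells (λ _ _ _ _ → 0#) public

    coarse-solvesAR : ∀ {δ} → 0# ≤ ε → 1# ≤ fromℕ m * ε → (1# - δ) * fromℕ m ≤ 1# → SolvesAR ε δ algorithm
    coarse-solvesAR 0≤ε 1≤mε p≤1 = solvesAR 0≤ε λ x 0≤x u → (λ _ → true) ,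
      (λ _ _ _ _ → ≤-trans
        (∣∣≤ (≤-trans (≤-by (rank x (index u)) (0≤rank 0≤x (index u))
               (solve 1 (λ r → con 0 := con 0 :- r :+ r) refl (rank x (index u)))) (sum-nonNegative 0≤x))
             (subst (_≤ sum x) (solve 1 (λ r → r := :- (con 0 :- r)) refl (rank x (index u))) (rank≤sum 0≤x (index u))))
        (subst₂ _≤_ (*-identityˡ _) (*-assoc _ _ _) (*-monoʳ-≤ (sum-nonNegative 0≤x) 1≤mε))) ,
      certain p≤1

  -- For one element log U is 0, so a constant number of words has to do. The only rank is the
  -- total, which counter zero holds exactly.
  module SingletonRank (U≡1 : U ≡ 1) (ε : ℝ) where
    open TotalOnly
    open GuessedRank 0 ε trivial noCells (λ _ _ s _ → s) public

    singleton-solvesAR : ∀ {δ} → 0# ≤ ε → 0# ≤ δ → SolvesAR ε δ algorithm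
    singleton-solvesAR {δ} 0≤ε 0≤δ = solvesAR 0≤ε λ x 0≤x u → (λ _ → true) ,
      (λ _ _ _ _ → subst (λ r → ∣ sum x - r ∣ ≤ fromℕ 1 * (ε * sum x))
        (sym (rank-all x (index u) (ℕ.≤-trans (ℕ.≤-reflexive U≡1) (ℕ.s≤s ℕ.z≤n))))
        (subst (λ e → ∣ e ∣ ≤ fromℕ 1 * (ε * sum x)) (sym (-‿inverseʳ (sum x)))
          (∣∣≤ (bound x 0≤x) (subst (_≤ fromℕ 1 * (ε * sum x)) (sym -0#≈0#) (bound x 0≤x))))) ,
      certain (≤-by δ 0≤δ (trans (solve 1 (λ δ → con 1 := (con 1 :- δ) :* con 1 :+ δ) refl δ)
        (cong (λ u → (1# - δ) * u + δ) (sym fromℕ-1))))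
      where
      bound : ∀ x → NonNegative x → 0# ≤ fromℕ 1 * (ε * sum x)
      bound x 0≤x = *-nonNegative (0≤fromℕ 1) (*-nonNegative 0≤ε (sum-nonNegative 0≤x))

  module DyadicRank (k L t : ℕ) .{{_ : NonZero L}} (m-1 : ℕ) (ε : ℝ) where
    open LevelSketch R w k
    open Dyadic R w k {U}
    open DyadicSketch R w k {U} L t
    open Reliability R w k {U}
    open Amplification R w

    toward : Fin U → ℕ → Bool
    toward u b = does (b ℕ.≤? index u)

    estimates : Seed → Vector ℝ cells → Fin U → Vector ℝ t
    estimates ωss cs u r = pathSum (toward u) (lookup ωss r) (cell cs r) 0 0#

    open GuessedRank m-1 ε seedSpace select (λ ωss cs _ u → median (estimates ωss cs u)) public

    -- The bound `U < 2 ^ L` is strict because the path for the last element aims at the leaf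
    -- `index u` = `U`. The factor `m` in the budget pays for the coin, which is right in one of `m`
    -- cases.
    dyadic-solvesAR : ∀ {δ} → 0# ≤ ε → U ℕ.≤ 2 ℕ.^ w → U ℕ.< 2 ℕ.^ L → 2 ℕ.^ L ℕ.≤ 2 ℕ.^ suc w →
      fromℕ (32 ℕ.* L) ≤ 2# ^ k * 2# ^ k * (fromℕ m * ε * (fromℕ m * ε)) →
      (1# - δ) * fromℕ m * 2# ^ t ≤ 2# ^ t - 1# → SolvesAR ε δ algorithm
    dyadic-solvesAR {δ} 0≤ε U≤ U<2ᴸ 2ᴸ≤ wide budget = solvesAR 0≤ε λ x 0≤x u →
      majorityGood x 0≤x u , accurate x 0≤x u , likely x 0≤x u
      where
      0≤mε = *-nonNegative (0≤fromℕ m) 0≤ε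
      good : ∀ x → NonNegative x → Fin U → Vec LevelSeed L → Bool
      good x 0≤x u = reliable x 0≤x U≤ L 2ᴸ≤ 0≤mε wide (toward u)
      majorityGood : ∀ x → NonNegative x → Fin U → Seed → Bool
      majorityGood x 0≤x u ωss = does (majority? (λ r → good x 0≤x u (lookup ωss r)))
      within : ∀ {a r d} → r - d ≤ a × a ≤ r + d → ∣ a - r ∣ ≤ d
      within {a} {r} {d} (lo , hi) = ∣∣≤
        (≤-by (r + d - a) (≤⇒0≤- hi) (solve 3 (λ a r d → d := a :- r :+ (r :+ d :- a)) refl a r d))
        (≤-by (a - (r - d)) (≤⇒0≤- lo) (solve 3 (λ a r d → d := :- (a :- r) :+ (a :- (r :- d))) refl a r d))
      unwithin : ∀ {a r d} → ∣ a - r ∣ ≤ d → r - d ≤ a × a ≤ r + d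
      unwithin {a} {r} {d} close =
        ≤-by (d - (- (a - r))) (≤⇒0≤- (≤-trans (≤⊔ʳ (a - r) _) close))
          (solve 3 (λ a r d → a := r :- d :+ (d :- (:- (a :- r)))) refl a r d) ,
        ≤-by (d - (a - r)) (≤⇒0≤- (≤-trans (≤⊔ˡ (a - r) _) close))
          (solve 3 (λ a r d → r :+ d := a :+ (d :- (a :- r))) refl a r d)
      accurate : ∀ x 0≤x u ωss cs → Counts ωss x cs → majorityGood x 0≤x u ωss ≡ true →
        ∣ median (estimates ωss cs u) - rank x (index u) ∣ ≤ fromℕ m * (ε * sum x)
      accurate x 0≤x u ωss cs counts maj = subst (∣ median (estimates ωss cs u) - rank x (index u) ∣ ≤_)
        (*-assoc (fromℕ m) ε (sum x))
        (within (median-between (estimates ωss cs u) (λ r → good x 0≤x u (lookup ωss r))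
          (does-true (majority? (λ r → good x 0≤x u (lookup ωss r))) maj) λ r gr →
          unwithin (Descent.pathSum-accurate x λ# (toward u) (index u) (λ _ → refl) (lookup ωss r) (cell cs r) 0 0# 0#
            (cell-counts x ωss counts r)
            (sym (trans (+-identityʳ _) (rank-0 x))) ℕ.z≤n
            (subst (index u ℕ.<_) (sym (ℕ.*-identityˡ (2 ℕ.^ L))) (ℕ.≤-<-trans (Fin.toℕ<n u) U<2ᴸ))
            (does-true (Path.accurate? x λ# (toward u) (lookup ωss r) 0 0#) gr))))
        where λ# = fromℕ m * ε * sum x
      likely : ∀ x 0≤x u → (1# - δ) * fromℕ m * cardinality seedSpace ≤ total seedSpace (λ ωss → 𝟙 (majorityGood x 0≤x u ωss))
      likely x 0≤x u = total-good seedSpace (majorityGood x 0≤x u) (^-positive (0<fromℕ 2) t)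
        (subst (2# ^ t * total seedSpace (λ ωss → 𝟙 (not (majorityGood x 0≤x u ωss))) ≤_) (sym (*-identityˡ _))
          (total-no-majority (levelSpace ⋆ L) (good x 0≤x u) (rarely-unreliable x 0≤x U≤ L 2ᴸ≤ 0≤mε wide (toward u)) t))
        budget

-- Answering quantile queries.

module Quantiles (R : RealField) (w : ℕ) {U-1 : ℕ} where
  private
    U : ℕ
    U = suc U-1
  open OrderedField R
  open Indicator R
  open Logarithm R
  open Median R
  open Probability R w
  open Streaming R
  open Rank R {U}
  open Answers R w {U}
  open Space

  -- The tree may have more than `U` leaves. Beyond `U` the rank is constant, so returning the last
  -- element there does not spoil the answer.
  clamp : ℕ → Fin U
  clamp z with z ℕ.<? U
  ... | yes z<U = fromℕ< z<U
  ... | no  _   = Fin.fromℕ U-1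

  clamp≤ : ∀ z → toℕ (clamp z) ℕ.≤ z
  clamp≤ z with z ℕ.<? U
  ... | yes z<U = ℕ.≤-reflexive (Fin.toℕ-fromℕ< z<U)
  ... | no  z≮U = ℕ.≤-trans (ℕ.≤-reflexive (Fin.toℕ-fromℕ U-1)) (ℕ.≤-trans (ℕ.n≤1+n U-1) (ℕ.≮⇒≥ z≮U))

  rank-clamp : ∀ x z → rank x (suc z) ≡ rank x (index (clamp z))
  rank-clamp x z with z ℕ.<? U
  ... | yes z<U = cong (λ j → rank x (suc j)) (sym (Fin.toℕ-fromℕ< z<U))
  ... | no  z≮U = trans (rank-all x (suc z) (ℕ.≤-trans (ℕ.≮⇒≥ z≮U) (ℕ.n≤1+n z)))
    (sym (rank-all x _ (ℕ.≤-reflexive (cong suc (sym (Fin.toℕ-fromℕ U-1))))))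

  -- For ε ≥ 1/2 the first element answers every query q ≤ n / 2, and the last
  -- one every other query.
  module Extremes where
    open TotalOnly

    extreme : ℝ → ℕ → Fin U
    extreme s q = if does (fromℕ q + fromℕ q ≤? s) then zero else Fin.fromℕ U-1

    open Sketch {m = 1} _ trivial noCells (λ _ _ s _ q → extreme s q) public

    extremes-solvesAQ : ∀ {ε δ} → 0# ≤ δ → U ≡ 1 ⊎ 1# ≤ ε + ε → SolvesAQ ε δ algorithm
    extremes-solvesAQ {ε} {δ} 0≤δ trivial⊎half σ n strict (size≤n , _) q 1≤q q≤n (u , answer) =
      answersWithProbability (1# - δ) σ q (isApproxQuantile? ε n x q) (λ _ → T? true) (λ _ _ _ _ → zero , good trivial⊎half)
        (subst (_≤ total trivial (λ _ → 𝟙 true)) (cong ((1# - δ) *_) (sym (trans (cong (cardinality trivial *_) fromℕ-1) (*-identityʳ _))))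
          (certain (≤-by δ 0≤δ (solve 1 (λ δ → con 1 := con 1 :- δ :+ δ) refl δ))))
      where
      x = produced σ
      0≤x = stays⇒nonNegative 0ᵥ σ strict
      s = sum x
      Q = fromℕ q
      s≤n : s ≤ fromℕ n
      s≤n = subst (_≤ fromℕ n) (‖‖₁≡sum 0≤x) size≤n
      singleton : ∀ {U} → U ≡ 1 → (i j : Fin U) → i ≡ j
      singleton refl zero zero = refl
      good : U ≡ 1 ⊎ 1# ≤ ε + ε → IsApproxQuantile ε n x q (extreme s q)
      good (inj₁ U≡1) = subst (IsApproxQuantile ε n x q) (singleton U≡1 u (extreme s q)) answer
      good (inj₂ half) with fromℕ q + fromℕ q ≤? s
      ... | yes 2q≤s = ≤-trans (≤-by (εn - Q) (≤⇒0≤- Q≤εn) (solve 2 (λ Q e → con 0 := Q :- e :+ (e :- Q)) refl Q εn)) (0≤rank 0≤x 1) ,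
                       subst (_≤ Q + εn) (sym (rank-0 x)) (0≤+ (0≤fromℕ q) (≤-trans (0≤fromℕ q) Q≤εn))
        where
        εn = ε * fromℕ n
        Q≤εn : Q ≤ εn
        Q≤εn = *-cancelˡ-≤ (0<fromℕ 2) (subst₂ _≤_ (solve 1 (λ q → q :+ q := con 2 :* q) refl Q)
          (solve 2 (λ e n → (e :+ e) :* n := con 2 :* (e :* n)) refl ε (fromℕ n))
          (≤-trans 2q≤s (≤-trans s≤n (subst (_≤ (ε + ε) * fromℕ n) (*-identityˡ _) (*-monoʳ-≤ (0≤fromℕ n) half)))))
      -- That an answer exists gives Q - εn ≤ ‖x‖₁, the rank of the last element. The other
      -- condition follows by averaging s ≤ 2 Q and s ≤ 2 εn.
      ... | no  2q≰s = ≤-trans (proj₁ answer) (≤-trans (rank≤sum 0≤x (index u))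
                         (≤-reflexive (sym (rank-all x _ (ℕ.≤-reflexive (cong suc (sym (Fin.toℕ-fromℕ U-1)))))))) ,
                       ≤-trans (rank≤sum 0≤x (toℕ (Fin.fromℕ U-1))) s≤Q+εn
        where
        εn = ε * fromℕ n
        s≤Q+εn : s ≤ Q + εn
        s≤Q+εn = *-cancelˡ-≤ (0<fromℕ 2) (subst₂ _≤_ (solve 1 (λ s → s :+ s := con 2 :* s) refl s)
          (solve 3 (λ q e n → q :+ q :+ (e :+ e) :* n := con 2 :* (q :+ e :* n)) refl Q ε (fromℕ n))
          (+-mono-≤ (≰⇒≥ 2q≰s) (≤-trans s≤n (subst (_≤ (ε + ε) * fromℕ n) (*-identityˡ _) (*-monoʳ-≤ (0≤fromℕ n) half)))))

  module DyadicQuantile (k L t : ℕ) .{{_ : NonZero L}} where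
    open LevelSketch R w k
    open Dyadic R w k {U}
    open DyadicSketch R w k {U} L t
    open Reliability R w k {U}
    open Amplification R w

    leafFor : Seed → Vector ℝ cells → ℕ → ℕ
    leafFor ωss cs q = walk (fromℕ q) {L} (lookup ωss) (cell cs) 0 (λ _ → 0#)

    open Sketch {m = 1} _ seedSpace select (λ ωss cs _ _ q → clamp (leafFor ωss cs q)) public

    -- The accuracy doubles from β because a median at a boundary carries two errors of size up to
    -- β‖x‖₁. The two paths depend on the stream and on `q` but not on the seed, so the bound for a
    -- fixed path applies to each, and the two failure probabilities are added.
    dyadic-solvesAQ : ∀ {β δ} → 0# ≤ β → U ℕ.≤ 2 ℕ.^ w → U ℕ.≤ 2 ℕ.^ L → 2 ℕ.^ L ℕ.≤ 2 ℕ.^ suc w →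
      fromℕ (32 ℕ.* L) ≤ 2# ^ k * 2# ^ k * (β * β) →
      (1# - δ) * 2# ^ t ≤ 2# ^ t - 2# → SolvesAQ (β + β) δ algorithm
    dyadic-solvesAQ {β} {δ} 0≤β U≤ U≤2ᴸ 2ᴸ≤ wide budget σ n strict (size≤n , _) q 1≤q q≤n (u , answer) =
      answersWithProbability (1# - δ) σ q (isApproxQuantile? (β + β) n x q) (T? ∘ good)
        (λ ωss cs counts g → zero , accurate ωss cs counts (Equivalence.to T-≡ g))
        (subst (_≤ total seedSpace (𝟙 ∘ good)) (cong ((1# - δ) *_) (sym (trans (cong (cardinality seedSpace *_) fromℕ-1) (*-identityʳ _)))) likely)
      where
      x = produced σ
      0≤x = stays⇒nonNegative 0ᵥ σ strict
      s = sum x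
      λ# = β * s
      Q = fromℕ q
      εn = (β + β) * fromℕ n
      lo = Q - εn
      hi = Q + εn
      0≤εn : 0# ≤ εn
      0≤εn = *-nonNegative (0≤+ 0≤β 0≤β) (0≤fromℕ n)
      2λ≤εn : λ# + λ# ≤ εn
      2λ≤εn = subst (_≤ εn) (distribʳ s β β) (*-monoˡ-≤ (0≤+ 0≤β 0≤β) (subst (_≤ fromℕ n) (‖‖₁≡sum 0≤x) size≤n))
      -- The exact paths to the first leaf whose rank reaches lo and to the
      -- last leaf in front of which the rank is at most hi.
      toLo toHi : ℕ → Bool
      toLo m = not (does (lo ≤? rank x m))
      toHi m = does (rank x m ≤? hi)
      goodFor : (ℕ → Bool) → Seed → Bool
      goodFor right ωss = does (majority? (λ r → reliable x 0≤x U≤ L 2ᴸ≤ 0≤β wide right (lookup ωss r)))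
      good : Seed → Bool
      good ωss = goodFor toLo ωss ∧ goodFor toHi ωss

      rank-end : ∀ p h → U ℕ.≤ suc p ℕ.* 2 ℕ.^ h → rank x (suc p ℕ.* 2 ℕ.^ h) ≡ s
      rank-end p h = rank-all x (suc p ℕ.* 2 ℕ.^ h)

      module _ (ωss : Seed) (cs : Vector ℝ cells) (counts : Counts ωss x cs) where
        z = leafFor ωss cs q
        start≡ : ∀ r → 0# ≡ rank x 0 + 0#
        start≡ r = sym (trans (+-identityʳ _) (rank-0 x))

        -- With `above`: a boundary whose rank lies outside [lo , hi] is always compared correctly
        -- with `Q`. A wrong comparison needs a rank within [lo , hi], and then either turn can only
        -- lead to acceptable leaves.
        below : ∀ {m e} → rank x m - (λ# + λ#) ≤ e → hi < rank x m → Q ≤ e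
        below {m} {e} e≥ hi<r = ≤-trans
          (≤-by ((rank x m - hi) + (εn - (λ# + λ#))) (0≤+ (≤⇒0≤- (proj₁ hi<r)) (≤⇒0≤- 2λ≤εn))
            (solve 4 (λ r l Q e → r :- l := Q :+ (r :- (Q :+ e) :+ (e :- l))) refl (rank x m) (λ# + λ#) Q εn)) e≥

        above : ∀ {m e} → e ≤ rank x m + (λ# + λ#) → rank x m < lo → ¬ Q ≤ e
        above {m} {e} e≤ r<lo Q≤e = <⇒≱ r<lo
          (≤-by ((e - Q) + (rank x m + (λ# + λ#) - e) + (εn - (λ# + λ#)))
            (0≤+ (0≤+ (≤⇒0≤- Q≤e) (≤⇒0≤- e≤)) (≤⇒0≤- 2λ≤εn))
            (solve 5 (λ r l Q n e → r := Q :- n :+ (e :- Q :+ (r :+ l :- e) :+ (n :- l))) refl (rank x m) (λ# + λ#) Q εn e))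

        reaches-lo : goodFor toLo ωss ≡ true → lo ≤ rank x (suc z)
        reaches-lo g = walk-good {L} (lookup ωss) (cell cs) 0 (λ _ → 0#) (λ _ → 0#)
          (cell-counts x ωss counts) start≡
          (does-true (majority? (λ r → reliable x 0≤x U≤ L 2ᴸ≤ 0≤β wide toLo (lookup ωss r))) g)
          -- The invariant holds at the root because some answer `u` exists: `lo` is at most its
          -- rank and thus at most ‖x‖₁, the rank at the end of the tree.
          (≤-trans (proj₁ answer) (≤-trans (rank≤sum 0≤x (index u)) (≤-reflexive (sym
            (rank-end 0 L (ℕ.≤-trans U≤2ᴸ (ℕ.≤-reflexive (sym (ℕ.*-identityˡ (2 ℕ.^ L))))))))))
          where
          descend : ∀ p h → lo ≤ rank x (suc p ℕ.* 2 ℕ.^ suc h) →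
            lo ≤ rank x (suc (child (toLo (middle h p)) p) ℕ.* 2 ℕ.^ h)
          descend p h inv with lo ≤? rank x (middle h p)
          ... | yes lo≤ = lo≤
          ... | no  _   = subst (λ m → lo ≤ rank x m) (sym (*2*2^≡ (suc p) h)) inv
          turn : ∀ m e → rank x m - (λ# + λ#) ≤ e → e ≤ rank x m + (λ# + λ#) →
            not (does (Q ≤? e)) ≡ toLo m ⊎ Turned (λ z → lo ≤ rank x (suc z)) m (not (does (Q ≤? e)))
          turn m e e≥ e≤ with lo ≤? rank x m | Q ≤? e
          ... | yes lo≤ | yes _   = inj₁ refl
          ... | yes lo≤ | no  _   = inj₂ λ z m≤z _ → ≤-trans lo≤ (rank-mono 0≤x {m} {suc z} (ℕ.≤-trans (m≤z refl) (ℕ.n≤1+n z)))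
          ... | no  lo≰ | yes Q≤e = contradiction Q≤e (above {m} {e} e≤ (≰⇒> lo≰))
          ... | no  _   | no  _   = inj₁ refl
          open Descent.Walk x λ# toLo Q (λ z → lo ≤ rank x (suc z)) (λ p h → lo ≤ rank x (suc p ℕ.* 2 ℕ.^ h))
            (λ p → subst (λ j → lo ≤ rank x j) (ℕ.*-identityʳ (suc p))) descend turn

        stays-below-hi : goodFor toHi ωss ≡ true → rank x z ≤ hi
        stays-below-hi g = walk-good {L} (lookup ωss) (cell cs) 0 (λ _ → 0#) (λ _ → 0#)
          (cell-counts x ωss counts) start≡
          (does-true (majority? (λ r → reliable x 0≤x U≤ L 2ᴸ≤ 0≤β wide toHi (lookup ωss r))) g)
          (subst (_≤ hi) (sym (rank-0 x)) (0≤+ (0≤fromℕ q) 0≤εn))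
          where
          descend : ∀ p h → rank x (p ℕ.* 2 ℕ.^ suc h) ≤ hi → rank x (child (toHi (middle h p)) p ℕ.* 2 ℕ.^ h) ≤ hi
          descend p h inv with rank x (middle h p) ≤? hi
          ... | yes ≤hi = ≤hi
          ... | no  _   = subst (λ m → rank x m ≤ hi) (sym (*2*2^≡ p h)) inv
          turn : ∀ m e → rank x m - (λ# + λ#) ≤ e → e ≤ rank x m + (λ# + λ#) →
            not (does (Q ≤? e)) ≡ toHi m ⊎ Turned (λ z → rank x z ≤ hi) m (not (does (Q ≤? e)))
          turn m e e≥ e≤ with rank x m ≤? hi | Q ≤? e
          ... | yes _   | no  _   = inj₁ refl
          ... | yes ≤hi | yes _   = inj₂ λ z _ z<m → ≤-trans (rank-mono 0≤x {z} {m} (ℕ.<⇒≤ (z<m refl))) ≤hi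
          ... | no  ≰hi | no  Q≰e = contradiction (below {m} {e} e≥ (≰⇒> ≰hi)) Q≰e
          ... | no  _   | yes _   = inj₁ refl
          open Descent.Walk x λ# toHi Q (λ z → rank x z ≤ hi) (λ p h → rank x (p ℕ.* 2 ℕ.^ h) ≤ hi)
            (λ p → subst (λ j → rank x j ≤ hi) (ℕ.*-identityʳ p)) descend turn

        accurate : good ωss ≡ true → IsApproxQuantile (β + β) n x q (clamp z)
        accurate g with goodFor toLo ωss in g₁ | goodFor toHi ωss in g₂
        ... | true | true =
          subst (lo ≤_) (rank-clamp x z) (reaches-lo g₁) ,
          ≤-trans (rank-mono 0≤x {toℕ (clamp z)} {z} (clamp≤ z)) (stays-below-hi g₂)

      rarely-bad : ∀ right → 2# ^ t * total seedSpace (λ ωss → 𝟙 (not (goodFor right ωss))) ≤ cardinality seedSpace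
      rarely-bad right = total-no-majority (levelSpace ⋆ L) (reliable x 0≤x U≤ L 2ᴸ≤ 0≤β wide right)
        (rarely-unreliable x 0≤x U≤ L 2ᴸ≤ 0≤β wide right) t

      likely : (1# - δ) * cardinality seedSpace ≤ total seedSpace (𝟙 ∘ good)
      likely = total-good seedSpace good (^-positive (0<fromℕ 2) t) (begin
        P * total seedSpace (λ ωss → 𝟙 (not (good ωss)))
          ≤⟨ *-monoˡ-≤ 0≤P (total-mono seedSpace (λ ωss → or (goodFor toLo ωss) (goodFor toHi ωss))) ⟩
        P * total seedSpace (λ ωss → 𝟙 (not (goodFor toLo ωss)) + 𝟙 (not (goodFor toHi ωss)))
          ≡⟨ cong (P *_) (total-+ seedSpace (λ ωss → 𝟙 (not (goodFor toLo ωss))) (λ ωss → 𝟙 (not (goodFor toHi ωss)))) ⟩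
        P * (total seedSpace (λ ωss → 𝟙 (not (goodFor toLo ωss))) + total seedSpace (λ ωss → 𝟙 (not (goodFor toHi ωss))))
          ≡⟨ distribˡ P _ _ ⟩
        P * total seedSpace (λ ωss → 𝟙 (not (goodFor toLo ωss))) + P * total seedSpace (λ ωss → 𝟙 (not (goodFor toHi ωss)))
          ≤⟨ +-mono-≤ (rarely-bad toLo) (rarely-bad toHi) ⟩
        N + N
          ≡⟨ solve 1 (λ n → n :+ n := con 2 :* n) refl N ⟩
        2# * N ∎) budget
        where
        open ≤-Reasoning
        P = 2# ^ t
        N = cardinality seedSpace
        0≤P = ^-nonNegative 0≤2 t
        or : ∀ a b → 𝟙 (not (a ∧ b)) ≤ 𝟙 (not a) + 𝟙 (not b)
        or true  b = ≤-reflexive (sym (+-identityˡ _))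
        or false b = ≤-by (𝟙 (not b)) (0≤𝟙 (not b)) refl

-- Choice of the parameters, and the word count.

n<2^n : ∀ n → n ℕ.< 2 ℕ.^ n
n<2^n zero    = ℕ.s≤s ℕ.z≤n
n<2^n (suc n) = ℕ.≤-trans (ℕ.+-mono-≤ (ℕ.m^n>0 2 n) (n<2^n n))
  (ℕ.≤-reflexive (cong (2 ℕ.^ n ℕ.+_) (sym (ℕ.+-identityʳ (2 ℕ.^ n)))))

module Parameters (R : RealField) where
  open OrderedField R
  open Logarithm R

  inverse-of-positive : ∀ {x} → 0# < x → x * x ⁻¹ ≡ 1#
  inverse-of-positive (_ , 0≢x) = ⁻¹-inverseʳ _ (0≢x ∘ sym)

  ≤⁻¹ : ∀ {x y} → 0# < x → y * x ≤ 1# → y ≤ x ⁻¹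
  ≤⁻¹ {x} {y} 0<x yx≤1 = *-cancelˡ-≤ 0<x (subst₂ _≤_ (*-comm y x) (sym (inverse-of-positive 0<x)) yx≤1)

  2*≡+ : ∀ x → 2# * x ≡ x + x
  2*≡+ = solve 1 (λ x → con 2 :* x := x :+ x) refl

  arbitrarily-large : ∀ a {x} → 0# < x → ∃[ n ] a ≤ 2# ^ n * x
  arbitrarily-large a {x} 0<x = n , subst (_≤ 2# ^ n * x)
    (trans (*-assoc _ _ _) (trans (cong (a *_) (⁻¹-inverseˡ 0<x)) (*-identityʳ a)))
    (*-monoʳ-≤ (proj₁ 0<x) (≤-trans (proj₂ (archimedean (a * x ⁻¹))) (fromℕ≤2^ n)))
    where n = proj₁ (archimedean (a * x ⁻¹))

  -- Failure at the predecessor gives 2 ^ l ≤ `U`, so `l` is at most log U. The last level is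
  -- absorbed by 1 ≤ log U, valid for `U` ≥ 2.
  depth : ∀ U w → 2 ℕ.≤ U → U ℕ.≤ 2 ℕ.^ w → ∃[ l ] U ℕ.< 2 ℕ.^ suc l × 2 ℕ.^ suc l ℕ.≤ 2 ℕ.^ suc w ×
    fromℕ (suc l) ≤ 2# * log₂ (fromℕ U)
  depth U w 2≤U U≤2ʷ with first-from (λ L → U ℕ.<? 2 ℕ.^ L) U (n<2^n U)
  ... | zero  , U<1 , _ = contradiction 2≤U (ℕ.<⇒≱ (ℕ.<-≤-trans U<1 (ℕ.s≤s ℕ.z≤n)))
  ... | suc l , U<2ᴸ , ¬U<2ˡ = l , U<2ᴸ , ℕ.*-monoʳ-≤ 2 (ℕ.≤-trans 2ˡ≤U U≤2ʷ) ,
    subst (fromℕ (suc l) ≤_) (sym (2*≡+ (log₂ (fromℕ U))))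
      (+-mono-≤ (1≤log₂ (fromℕ-mono 2≤U)) (log₂-lower-ℕ l (0≤fromℕ U) (subst (_≤ fromℕ U) (fromℕ-^ 2 l) (fromℕ-mono 2ˡ≤U))))
    where
    2ˡ≤U : 2 ℕ.^ l ℕ.≤ U
    2ˡ≤U = ℕ.≮⇒≥ (¬U<2ˡ l refl)

  -- Enough repetitions for a failure probability of at most δ / s.
  repetitions : ∀ {s δ y} → 0# < δ → s * y ≤ δ → 2# * y ≤ 1# → 0# < y → δ < s →
    ∃[ t ] s ≤ 2# ^ t * δ × fromℕ t ≤ 2# * log₂ (y ⁻¹)
  repetitions {s} {δ} {y} 0<δ sy≤δ 2y≤1 0<y δ<s
    with first-from (λ t → s ≤? 2# ^ t * δ) (proj₁ large) (proj₂ large)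
    where large = arbitrarily-large s 0<δ
  ... | zero  , s≤δ , _ = contradiction (subst (s ≤_) (*-identityˡ δ) s≤δ) (<⇒≱ δ<s)
  ... | suc t , s≤ , s≰ = suc t , s≤ , subst (fromℕ (suc t) ≤_) (sym (2*≡+ (log₂ (y ⁻¹))))
    (+-mono-≤ (1≤log₂ (≤⁻¹ 0<y 2y≤1)) (log₂-lower-ℕ t (⁻¹-nonNegative 0<y) (≤⁻¹ 0<y 2ᵗy≤1)))
    where
    -- s y ≤ δ gives 2 ^ t y ≤ 1 from 2 ^ t δ ≤ s.
    2ᵗy≤1 : 2# ^ t * y ≤ 1#
    2ᵗy≤1 = *-cancelˡ-≤ (<-≤-trans 0<δ (proj₁ δ<s)) (subst₂ _≤_
      (solve 3 (λ p s y → p :* (s :* y) := s :* (p :* y)) refl (2# ^ t) s y) (sym (*-identityʳ s))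
      (≤-trans (*-monoˡ-≤ (^-nonNegative 0≤2 t) sy≤δ) (≰⇒≥ (s≰ t refl))))

  -- For δ ≤ 1/2 there is no guessing, m = 1. For δ > 1/2, one repetition succeeds with probability
  -- at least 1/2, and m is taken of order 1 / (1 - δ) with 2 (1 - δ) m ≤ 1, so that guessing as
  -- well still succeeds with probability 1 - δ. As m (1 - δ) is bounded below, `1-δ≤log₂` makes m
  -- log (1/δ) large enough to pay for t = 1.
  guesses : ∀ {δ} → 0# < δ → δ < 1# → ∃[ m-1 ] ∃[ t ] let m = fromℕ (suc m-1) in
    (1# - δ) * m * 2# ^ t ≤ 2# ^ t - 1# × fromℕ t ≤ fromℕ 8 * (m * log₂ (δ ⁻¹))
  guesses {δ} 0<δ δ<1 with 2# * δ ≤? 1#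
  ... | yes 2δ≤1 =
    let t , 1≤2ᵗδ , t≤ = repetitions {1#} 0<δ (≤-reflexive (*-identityˡ δ)) 2δ≤1 0<δ δ<1 in
    0 , t ,
    ≤-by (2# ^ t * δ - 1#) (≤⇒0≤- 1≤2ᵗδ) (trans
      (solve 2 (λ p d → p :- con 1 := (con 1 :- d) :* con 1 :* p :+ (p :* d :- con 1)) refl (2# ^ t) δ)
      (cong (λ u → (1# - δ) * u * 2# ^ t + (2# ^ t * δ - 1#)) (sym fromℕ-1))) ,
    ≤-trans t≤ (*-mono-≤ 0≤2 (*-nonNegative (0≤fromℕ 1) 0≤log) (fromℕ-mono {2} {8} (ℕ.s≤s (ℕ.s≤s ℕ.z≤n)))
      (≤-reflexive (sym (trans (cong (_* log₂ (δ ⁻¹)) fromℕ-1) (*-identityˡ _)))))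
    where
    0≤log : 0# ≤ log₂ (δ ⁻¹)
    0≤log = log₂-nonNegative (≤⁻¹ 0<δ (subst (_≤ 1#) (sym (*-identityˡ δ)) (proj₁ δ<1)))
  ... | no 2δ≰1 = few (first-from (λ n → 1# ≤? 2# * e * fromℕ n) (proj₁ large) (proj₂ large))
    where
    e = 1# - δ
    0<e = 0<1-δ δ<1
    double<1 : ¬ 1# ≤ 2# * e
    double<1 1≤2e = 2δ≰1 (≤-by (2# * e - 1#) (≤⇒0≤- 1≤2e)
      (solve 1 (λ δ → con 1 := con 2 :* δ :+ (con 2 :* (con 1 :- δ) :- con 1)) refl δ))
    large : ∃[ n ] 1# ≤ 2# * e * fromℕ n
    large = n , subst (_≤ 2# * e * fromℕ n) (inverse-of-positive 0<2e) (*-monoˡ-≤ (proj₁ 0<2e) (proj₂ (archimedean ((2# * e) ⁻¹))))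
      where
      0<2e = *-positive (0<fromℕ 2) 0<e
      n = proj₁ (archimedean ((2# * e) ⁻¹))
    few : (∃[ n ] 1# ≤ 2# * e * fromℕ n × (∀ k → n ≡ suc k → ¬ 1# ≤ 2# * e * fromℕ k)) →
      ∃[ m-1 ] ∃[ t ] let m = fromℕ (suc m-1) in e * m * 2# ^ t ≤ 2# ^ t - 1# × fromℕ t ≤ fromℕ 8 * (m * log₂ (δ ⁻¹))
    few (zero , 1≤0 , _) = contradiction (subst (1# ≤_) (zeroʳ _) 1≤0) (<⇒≱ 0<1)
    few (suc zero , 1≤2e , _) = contradiction (subst (1# ≤_) (trans (cong (2# * e *_) fromℕ-1) (*-identityʳ _)) 1≤2e) double<1
    few (suc (suc m-1) , 1≤ , 1≰) = m-1 , 1 ,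
      ≤-by (1# - 2# * e * m) (≤⇒0≤- (≰⇒≥ (1≰ (suc m-1) refl)))
        (solve 2 (λ e m → con 2 :* con 1 :- con 1 := e :* m :* (con 2 :* con 1) :+ (con 1 :- con 2 :* e :* m)) refl e m) ,
      subst (_≤ fromℕ 8 * (m * log₂ (δ ⁻¹))) (sym fromℕ-1) (begin
        1#                                     ≤⟨ 1≤ ⟩
        2# * e * (1# + m)                      ≤⟨ *-monoˡ-≤ (*-nonNegative 0≤2 (proj₁ 0<e)) (+-monoˡ-≤ m (1≤fromℕ (suc m-1))) ⟩
        2# * e * (m + m)                       ≡⟨ solve 2 (λ e m → con 2 :* e :* (m :+ m) := con 4 :* m :* e) refl e m ⟩
        fromℕ 4 * m * e                        ≤⟨ *-monoˡ-≤ (*-nonNegative (0≤fromℕ 4) (0≤fromℕ (suc m-1))) (1-δ≤log₂ 0<δ δ<1) ⟩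
        fromℕ 4 * m * (2# * log₂ (δ ⁻¹))       ≡⟨ solve 2 (λ m l → con 4 :* m :* (con 2 :* l) := con 8 :* (m :* l)) refl m (log₂ (δ ⁻¹)) ⟩
        fromℕ 8 * (m * log₂ (δ ⁻¹))            ∎)
      where
      open ≤-Reasoning
      m = fromℕ (suc m-1)

  -- Failure at the predecessor `j` gives (2 ^ j η)² ≤ 32 L ≤ 64 ℓ, so 2 ^ j η is at most 8 √ ℓ, and
  -- one more doubling gives 16.
  bucketBits : ∀ {η ℓ} L → 0# < η → η ≤ 1# → 1# ≤ ℓ → fromℕ L ≤ 2# * ℓ →
    ∃[ k ] fromℕ (32 ℕ.* L) ≤ 2# ^ k * 2# ^ k * (η * η) × 2# ^ k * η ≤ fromℕ 16 * √ ℓ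
  bucketBits {η} {ℓ} L 0<η η≤1 1≤ℓ L≤ =
    minimal (first-from (λ k → fromℕ (32 ℕ.* L) ≤? 2# ^ k * 2# ^ k * (η * η)) K wide)
    where
    0≤ℓ = ≤-trans 0≤1 1≤ℓ
    1≤√ : 1# ≤ √ ℓ
    1≤√ = √-lower 0≤ℓ (subst (_≤ ℓ) (sym (*-identityˡ 1#)) 1≤ℓ)
    0<η² = *-positive 0<η 0<η
    K = proj₁ (arbitrarily-large (fromℕ (32 ℕ.* L)) 0<η²)
    wide : fromℕ (32 ℕ.* L) ≤ 2# ^ K * 2# ^ K * (η * η)
    wide = ≤-trans (proj₂ (arbitrarily-large (fromℕ (32 ℕ.* L)) 0<η²))
      (*-monoʳ-≤ (proj₁ 0<η²) (subst (_≤ 2# ^ K * 2# ^ K) (*-identityˡ _)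
        (*-monoʳ-≤ (^-nonNegative 0≤2 K) (1≤^ (1≤fromℕ 2) K))))
    minimal : (∃[ k ] fromℕ (32 ℕ.* L) ≤ 2# ^ k * 2# ^ k * (η * η) ×
        (∀ j → k ≡ suc j → ¬ fromℕ (32 ℕ.* L) ≤ 2# ^ j * 2# ^ j * (η * η))) →
      ∃[ k ] fromℕ (32 ℕ.* L) ≤ 2# ^ k * 2# ^ k * (η * η) × 2# ^ k * η ≤ fromℕ 16 * √ ℓ
    minimal (zero , wide , _) = 0 , wide , (begin
      1# * η             ≡⟨ *-identityˡ η ⟩
      η                  ≤⟨ ≤-trans η≤1 1≤√ ⟩
      √ ℓ                ≡⟨ *-identityˡ _ ⟨
      1# * √ ℓ           ≤⟨ *-monoʳ-≤ (≤-trans 0≤1 1≤√) (1≤fromℕ 16) ⟩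
      fromℕ 16 * √ ℓ     ∎)
      where open ≤-Reasoning
    minimal (suc j , wide , narrow) = suc j , wide , (begin
      2# * 2# ^ j * η              ≡⟨ *-assoc _ _ _ ⟩
      2# * a                       ≡⟨ cong (2# *_) 8z≡a ⟨
      2# * (fromℕ 8 * z)           ≡⟨ solve 1 (λ z → con 2 :* (con 8 :* z) := con 16 :* z) refl z ⟩
      fromℕ 16 * z                 ≤⟨ *-monoˡ-≤ (0≤fromℕ 16) (√-lower 0≤ℓ z²≤ℓ) ⟩
      fromℕ 16 * √ ℓ               ∎)
      where
      open ≤-Reasoning
      a = 2# ^ j * η
      z = (fromℕ 8) ⁻¹ * a
      8z≡a : fromℕ 8 * z ≡ a
      8z≡a = trans (sym (*-assoc _ _ _)) (trans (cong (_* a) (inverse-of-positive (0<fromℕ 8))) (*-identityˡ a))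
      z²≤ℓ : z * z ≤ ℓ
      z²≤ℓ = *-cancelˡ-≤ (0<fromℕ 64) (begin
        fromℕ 64 * (z * z)                     ≡⟨ solve 1 (λ z → con 64 :* (z :* z) := (con 8 :* z) :* (con 8 :* z)) refl z ⟩
        fromℕ 8 * z * (fromℕ 8 * z)            ≡⟨ cong₂ _*_ 8z≡a 8z≡a ⟩
        a * a                                  ≡⟨ solve 2 (λ p η → p :* η :* (p :* η) := p :* p :* (η :* η)) refl (2# ^ j) η ⟩
        2# ^ j * 2# ^ j * (η * η)              ≤⟨ ≰⇒≥ (narrow j refl) ⟩
        fromℕ (32 ℕ.* L)                       ≡⟨ fromℕ-* 32 L ⟩
        fromℕ 32 * fromℕ L                     ≤⟨ *-monoˡ-≤ (0≤fromℕ 32) L≤ ⟩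
        fromℕ 32 * (2# * ℓ)                    ≡⟨ solve 1 (λ l → con 32 :* (con 2 :* l) := con 64 :* l) refl ℓ ⟩
        fromℕ 64 * ℓ                           ∎)

  -- A level of one repetition has 2 k + 1 ≤ 2 · 2 ^ k seed words and 4 · 2 ^ k counters, whence the
  -- 6. The summand 1 is the counter of all updates.
  space≤ : ∀ t L k → t ℕ.* (L ℕ.* (k ℕ.* 1 ℕ.+ k ℕ.* 1 ℕ.+ 1)) ℕ.+ suc (t ℕ.* (L ℕ.* 2 ℕ.^ (2 ℕ.+ k)))
    ℕ.≤ 1 ℕ.+ 6 ℕ.* (t ℕ.* L ℕ.* 2 ℕ.^ k)
  space≤ t L k = ℕ.≤-trans (ℕ.+-monoˡ-≤ _ (ℕ.*-monoʳ-≤ t (ℕ.*-monoʳ-≤ L seed≤)))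
    (ℕ.≤-reflexive (collect t L (2 ℕ.^ k)))
    where
    double : ∀ k → suc (k ℕ.* 1 ℕ.+ k ℕ.* 1 ℕ.+ 1) ≡ 2 ℕ.* suc k
    double = solve-∀
    seed≤ : k ℕ.* 1 ℕ.+ k ℕ.* 1 ℕ.+ 1 ℕ.≤ 2 ℕ.* 2 ℕ.^ k
    seed≤ = ℕ.≤-trans (ℕ.n≤1+n _) (ℕ.≤-trans (ℕ.≤-reflexive (double k)) (ℕ.*-monoʳ-≤ 2 (n<2^n k)))
    collect : ∀ t L P → t ℕ.* (L ℕ.* (2 ℕ.* P)) ℕ.+ suc (t ℕ.* (L ℕ.* (2 ℕ.* (2 ℕ.* P)))) ≡ 1 ℕ.+ 6 ℕ.* (t ℕ.* L ℕ.* P)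
    collect = solve-∀

  -- 3072 = 6 · 8 · 2 · 32, the product of the constants of `space≤` and of
  -- the hypotheses of `enough-space`.
  abstract
    C : ℕ
    C = 3072

    C≥1 : 1 ℕ.≤ C
    C≥1 = ℕ.s≤s ℕ.z≤n

    fromℕ-C : fromℕ C ≡ fromℕ 96 * fromℕ 32
    fromℕ-C = fromℕ-* 96 32

  -- The factor `m` allowed for `t` cancels against the factor 1 / m that the coarser accuracy m ε
  -- saves in 2 ^ k.
  enough-space : ∀ {S} t L k m {D ℓ ε g} → .{{NonZero m}} → 0# < ε → 0# ≤ D → 1# ≤ ℓ → 0# ≤ g →
    S ℕ.≤ 1 ℕ.+ 6 ℕ.* (t ℕ.* L ℕ.* 2 ℕ.^ k) →
    fromℕ t ≤ fromℕ 8 * (fromℕ m * D) → fromℕ L ≤ 2# * ℓ → 2# ^ k * (fromℕ m * ε) ≤ fromℕ 32 * √ ℓ →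
    fromℕ S ≤ fromℕ C * (1# + (ℓ * √ ℓ * D * ε ⁻¹ + g))
  enough-space {S} t L k m {D} {ℓ} {ε} {g} 0<ε 0≤D 1≤ℓ 0≤g S≤ t≤ L≤ k≤ = begin
    fromℕ S
      ≤⟨ fromℕ-mono S≤ ⟩
    1# + fromℕ (6 ℕ.* (t ℕ.* L ℕ.* 2 ℕ.^ k))
      ≡⟨ cong (1# +_) (trans (fromℕ-* 6 (t ℕ.* L ℕ.* 2 ℕ.^ k)) (cong (fromℕ 6 *_)
           (trans (fromℕ-* (t ℕ.* L) (2 ℕ.^ k)) (cong₂ _*_ (fromℕ-* t L) (fromℕ-^ 2 k))))) ⟩
    1# + fromℕ 6 * (fromℕ t * fromℕ L * 2# ^ k)
      ≤⟨ +-monoʳ-≤ 1# (*-monoˡ-≤ (0≤fromℕ 6) (*-monoʳ-≤ (^-nonNegative 0≤2 k) (*-mono-≤ (0≤fromℕ t) (*-nonNegative 0≤2 0≤ℓ) t≤ L≤))) ⟩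
    1# + fromℕ 6 * (fromℕ 8 * (fromℕ m * D) * (2# * ℓ) * 2# ^ k)
      ≡⟨ cong (1# +_) (solve 4 (λ m D l p → con 6 :* (con 8 :* (m :* D) :* (con 2 :* l) :* p) := con 96 :* (l :* D) :* (p :* m))
           refl (fromℕ m) D ℓ (2# ^ k)) ⟩
    1# + fromℕ 96 * (ℓ * D) * (2# ^ k * fromℕ m)
      ≤⟨ +-monoʳ-≤ 1# (*-monoˡ-≤ (*-nonNegative (0≤fromℕ 96) (*-nonNegative 0≤ℓ 0≤D)) 2ᵏm≤) ⟩
    1# + fromℕ 96 * (ℓ * D) * (fromℕ 32 * √ ℓ * ε ⁻¹)
      ≡⟨ cong (1# +_) (trans (solve 6 (λ a b l D s e → a :* (l :* D) :* (b :* s :* e) := a :* b :* (l :* s :* D :* e)) refl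
           (fromℕ 96) (fromℕ 32) ℓ D (√ ℓ) (ε ⁻¹)) (cong (_* f) (sym fromℕ-C))) ⟩
    1# + fromℕ C * f
      ≤⟨ +-mono-≤ (subst (_≤ fromℕ C) fromℕ-1 (fromℕ-mono C≥1)) (*-monoˡ-≤ (0≤fromℕ C) (≤-by g 0≤g refl)) ⟩
    fromℕ C + fromℕ C * (f + g)
      ≡⟨ solve 2 (λ c f → c :+ c :* f := c :* (con 1 :+ f)) refl (fromℕ C) (f + g) ⟩
    fromℕ C * (1# + (f + g)) ∎
    where
    open ≤-Reasoning
    f = ℓ * √ ℓ * D * ε ⁻¹
    0≤ℓ = ≤-trans 0≤1 1≤ℓ
    2ᵏm≤ : 2# ^ k * fromℕ m ≤ fromℕ 32 * √ ℓ * ε ⁻¹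
    2ᵏm≤ = subst (_≤ fromℕ 32 * √ ℓ * ε ⁻¹)
      (trans (solve 4 (λ p m e i → p :* (m :* e) :* i := p :* m :* (e :* i)) refl (2# ^ k) (fromℕ m) ε (ε ⁻¹))
        (trans (cong (2# ^ k * fromℕ m *_) (inverse-of-positive 0<ε)) (*-identityʳ _)))
      (*-monoʳ-≤ (⁻¹-nonNegative 0<ε) k≤)

-- Assembling the algorithms for all ranges of the parameters.

module Solutions (R : RealField) where
  open OrderedField R
  open Logarithm R
  open Parameters R
  open Streaming R

  few-words : ∀ {f} → 0# ≤ f → fromℕ 1 ≤ fromℕ C * (1# + f)
  few-words {f} 0≤f = ≤-trans (fromℕ-mono {1} {C} C≥1)
    (subst (_≤ fromℕ C * (1# + f)) (*-identityʳ _) (*-monoˡ-≤ (0≤fromℕ C) (≤-by f 0≤f refl)))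

  0≤words : ∀ {U} → 1 ℕ.≤ U → ∀ {y ε} → 1# ≤ y → 0# < ε → 0# ≤ log₂ (fromℕ U) ^3/2 * log₂ y * ε ⁻¹
  0≤words {U} 1≤U 1≤y 0<ε =
    *-nonNegative (*-nonNegative (*-nonNegative 0≤log (√-nonNegative 0≤log))
      (log₂-nonNegative 1≤y)) (⁻¹-nonNegative 0<ε)
    where
    0≤log : 0# ≤ log₂ (fromℕ U)
    0≤log = log₂-nonNegative (subst (_≤ fromℕ U) fromℕ-1 (fromℕ-mono 1≤U))

  1≤⁻¹ : ∀ {x} → 0# < x → x ≤ 1# → 1# ≤ x ⁻¹
  1≤⁻¹ 0<x x≤1 = ≤⁻¹ 0<x (subst (_≤ 1#) (sym (*-identityˡ _)) x≤1)

  *-≤1 : ∀ {x y} → 0# ≤ x → x ≤ 1# → y ≤ 1# → x * y ≤ 1#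
  *-≤1 {x} {y} 0≤x x≤1 y≤1 = ≤-trans (*-monoˡ-≤ 0≤x y≤1) (subst (_≤ 1#) (sym (*-identityʳ x)) x≤1)

  module _ (w k L t : ℕ) where
    open Probability R w
    open LevelSketch R w k

    dyadic-space : Space.size (levelSpace ⋆ L ⋆ t) ℕ.+ suc (t ℕ.* (L ℕ.* 2 ℕ.^ (2 ℕ.+ k))) ℕ.≤
      1 ℕ.+ 6 ℕ.* (t ℕ.* L ℕ.* 2 ℕ.^ k)
    dyadic-space = subst (λ s → s ℕ.+ suc (t ℕ.* (L ℕ.* 2 ℕ.^ (2 ℕ.+ k))) ℕ.≤ 1 ℕ.+ 6 ℕ.* (t ℕ.* L ℕ.* 2 ℕ.^ k))
      (sym (trans (size-⋆ (levelSpace ⋆ L) t) (cong (t ℕ.*_) (trans (size-⋆ levelSpace L)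
        (cong (L ℕ.*_) (cong₂ (λ a b → a ℕ.+ b ℕ.+ 1) (size-⋆ word k) (size-⋆ word k)))))))
      (space≤ t L k)

  -- The sketch runs at accuracy m ε, with m and t from `guesses`. If m ε ≥ 1, the estimate 0 is
  -- already that accurate and constantly many words suffice; otherwise m ε ≤ 1, as `bucketBits`
  -- demands.
  approximateRank : ∀ U w .{{_ : NonZero U}} → U ℕ.≤ 2 ℕ.^ w → ∀ ε δ → 0# < ε → ε < 1# → 0# < δ → δ < 1# →
    Σ[ A ∈ Algorithm U w (Fin U) ℝ ] SolvesAR ε δ A × UsesO C A (log₂ (fromℕ U) ^3/2 * log₂ (δ ⁻¹) * ε ⁻¹)
  approximateRank U w U≤2ʷ ε δ 0<ε ε<1 0<δ δ<1 = cases (U ℕ.≤? 1)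
    where
    ℓ = log₂ (fromℕ U)
    D = log₂ (δ ⁻¹)
    1≤U : 1 ℕ.≤ U
    1≤U = ℕ.>-nonZero⁻¹ U
    1≤δ⁻¹ : 1# ≤ δ ⁻¹
    1≤δ⁻¹ = 1≤⁻¹ 0<δ (proj₁ δ<1)
    Goal : Set
    Goal = Σ[ A ∈ Algorithm U w (Fin U) ℝ ] SolvesAR ε δ A × UsesO C A (ℓ ^3/2 * D * ε ⁻¹)
    module _ (U≡1 : U ≡ 1) where
      open Answers.SingletonRank R w U≡1 ε
      singleton : Goal
      singleton = algorithm , singleton-solvesAR (proj₁ 0<ε) (proj₁ 0<δ) , few-words (0≤words 1≤U 1≤δ⁻¹ 0<ε)
    module _ (m-1 : ℕ) where
      open Answers.CoarseRank R w {U} m-1 ε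
      coarse : 1# ≤ fromℕ (suc m-1) * ε → (1# - δ) * fromℕ (suc m-1) ≤ 1# → Goal
      coarse 1≤mε em≤1 = algorithm , coarse-solvesAR (proj₁ 0<ε) 1≤mε em≤1 , few-words (0≤words 1≤U 1≤δ⁻¹ 0<ε)
    module _ (l t k m-1 : ℕ) where
      open Answers.DyadicRank R w {U} k (suc l) t m-1 ε using (algorithm; dyadic-solvesAR)
      dyadic : 1# ≤ ℓ → U ℕ.< 2 ℕ.^ suc l → 2 ℕ.^ suc l ℕ.≤ 2 ℕ.^ suc w → fromℕ (suc l) ≤ 2# * ℓ →
        fromℕ (32 ℕ.* suc l) ≤ 2# ^ k * 2# ^ k * (fromℕ (suc m-1) * ε * (fromℕ (suc m-1) * ε)) →
        2# ^ k * (fromℕ (suc m-1) * ε) ≤ fromℕ 16 * √ ℓ →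
        (1# - δ) * fromℕ (suc m-1) * 2# ^ t ≤ 2# ^ t - 1# → fromℕ t ≤ fromℕ 8 * (fromℕ (suc m-1) * D) → Goal
      dyadic 1≤ℓ U<2ᴸ 2ᴸ≤ L≤ wide k≤ budget t≤ = algorithm ,
        dyadic-solvesAR (proj₁ 0<ε) U≤2ʷ U<2ᴸ 2ᴸ≤ wide budget ,
        subst (λ f → fromℕ (Algorithm.space algorithm) ≤ fromℕ C * (1# + f)) (+-identityʳ _)
          (enough-space t (suc l) k (suc m-1) 0<ε (log₂-nonNegative 1≤δ⁻¹) 1≤ℓ ≤-refl (dyadic-space w k (suc l) t) t≤ L≤
            (≤-trans k≤ (*-monoʳ-≤ (√-nonNegative (≤-trans 0≤1 1≤ℓ)) (fromℕ-mono {16} {32} (ℕ.m≤m+n 16 16)))))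
    cases : Dec (U ℕ.≤ 1) → Goal
    cases (yes U≤1) = singleton (ℕ.≤-antisym U≤1 1≤U)
    cases (no U≰1)  = guessed (guesses 0<δ δ<1)
      where
      1≤ℓ : 1# ≤ ℓ
      1≤ℓ = 1≤log₂ (fromℕ-mono (ℕ.≰⇒> U≰1))
      module _ (m-1 t : ℕ) (budget : (1# - δ) * fromℕ (suc m-1) * 2# ^ t ≤ 2# ^ t - 1#)
        (t≤ : fromℕ t ≤ fromℕ 8 * (fromℕ (suc m-1) * D)) where
        m = fromℕ (suc m-1)
        em≤1 : (1# - δ) * m ≤ 1#
        em≤1 = *-cancelˡ-≤ (^-positive (0<fromℕ 2) t) (subst₂ _≤_ (*-comm _ _) (sym (*-identityʳ _))
          (≤-trans budget (≤-by 1# 0≤1 (solve 1 (λ p → p := p :- con 1 :+ con 1) refl (2# ^ t)))))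
        sized : m * ε ≤ 1# → (∃[ l ] U ℕ.< 2 ℕ.^ suc l × 2 ℕ.^ suc l ℕ.≤ 2 ℕ.^ suc w × fromℕ (suc l) ≤ 2# * ℓ) → Goal
        sized mε≤1 (l , U<2ᴸ , 2ᴸ≤ , L≤) = fitted (bucketBits (suc l) (*-positive (0<fromℕ (suc m-1)) 0<ε) mε≤1 1≤ℓ L≤)
          where
          fitted : (∃[ k ] fromℕ (32 ℕ.* suc l) ≤ 2# ^ k * 2# ^ k * (m * ε * (m * ε)) × 2# ^ k * (m * ε) ≤ fromℕ 16 * √ ℓ) → Goal
          fitted (k , wide , k≤) = dyadic l t k m-1 1≤ℓ U<2ᴸ 2ᴸ≤ L≤ wide k≤ budget t≤
        accurate : Dec (1# ≤ m * ε) → Goal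
        accurate (yes 1≤mε) = coarse m-1 1≤mε em≤1
        accurate (no  1≰mε) = sized (≰⇒≥ 1≰mε) (depth U w (ℕ.≰⇒> U≰1) U≤2ʷ)
      guessed : (∃[ m-1 ] ∃[ t ] let m = fromℕ (suc m-1) in
        (1# - δ) * m * 2# ^ t ≤ 2# ^ t - 1# × fromℕ t ≤ fromℕ 8 * (m * D)) → Goal
      guessed (m-1 , t , budget , t≤) = accurate m-1 t budget t≤ (1# ≤? fromℕ (suc m-1) * ε)

  -- Once ε < 1/2, log (1/(εδ)) is at least 1 for every δ, so a repetition is always affordable and
  -- the coin carries no guess. The remaining ε are served by `Extremes`.
  approximateQuantile : ∀ U w .{{_ : NonZero U}} → U ℕ.≤ 2 ℕ.^ w → ∀ ε δ → 0# < ε → ε < 1# → 0# < δ → δ < 1# →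
    Σ[ A ∈ Algorithm U w ℕ (Fin U) ] SolvesAQ ε δ A ×
      UsesO C A (log₂ (fromℕ U) ^3/2 * log₂ ((ε * δ) ⁻¹) * ε ⁻¹ + loglog₂ U)
  approximateQuantile (suc U-1) w U≤2ʷ ε δ 0<ε ε<1 0<δ δ<1 = cases (U ℕ.≤? 1) (1# ≤? ε + ε)
    where
    U = suc U-1
    0<εδ = *-positive 0<ε 0<δ
    0≤loglog : 0# ≤ loglog₂ U
    0≤loglog = log₂-nonNegative (≤⊔ˡ 1# _)
    Goal : Set
    Goal = Σ[ A ∈ Algorithm U w ℕ (Fin U) ] SolvesAQ ε δ A ×
      UsesO C A (log₂ (fromℕ U) ^3/2 * log₂ ((ε * δ) ⁻¹) * ε ⁻¹ + loglog₂ U)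
    extremes : U ≡ 1 ⊎ 1# ≤ ε + ε → Goal
    extremes easy = algorithm , extremes-solvesAQ (proj₁ 0<δ) easy ,
        few-words (0≤+ (0≤words {U} (ℕ.s≤s ℕ.z≤n) (1≤⁻¹ 0<εδ (*-≤1 (proj₁ 0<ε) (proj₁ ε<1) (proj₁ δ<1))) 0<ε) 0≤loglog)
      where open Quantiles.Extremes R w {U-1}
    cases : Dec (U ℕ.≤ 1) → Dec (1# ≤ ε + ε) → Goal
    cases (yes U≤1) _          = extremes (inj₁ (ℕ.≤-antisym U≤1 (ℕ.s≤s ℕ.z≤n)))
    cases (no _)    (yes half) = extremes (inj₂ half)
    -- Each of the two paths may fail with probability δ / 2, hence `s` = 2. Taking `y` = ε δ bounds
    -- t by the logarithm in the claim, and 2 y ≤ 1 follows from ε < 1/2.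
    cases (no U≰1)  (no ¬half) = dyadic (depth U w (ℕ.≰⇒> U≰1) U≤2ʷ)
      (repetitions {2#} {δ} {ε * δ} 0<δ 2εδ≤δ (≤-trans 2εδ≤δ (proj₁ δ<1)) 0<εδ δ<2)
      where
      ℓ = log₂ (fromℕ U)
      D = log₂ ((ε * δ) ⁻¹)
      β = (2#) ⁻¹ * ε
      0<β = *-positive (⁻¹-positive (0<fromℕ 2)) 0<ε
      β+β≡ε : β + β ≡ ε
      β+β≡ε = trans (sym (2*≡+ β)) (trans (sym (*-assoc _ _ _))
        (trans (cong (_* ε) (inverse-of-positive (0<fromℕ 2))) (*-identityˡ ε)))
      β≤1 : β ≤ 1#
      β≤1 = ≤-trans (≤-by β (proj₁ 0<β) (sym β+β≡ε)) (proj₁ ε<1)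
      0≤D : 0# ≤ D
      0≤D = log₂-nonNegative (1≤⁻¹ 0<εδ (*-≤1 (proj₁ 0<ε) (proj₁ ε<1) (proj₁ δ<1)))
      2εδ≤δ : 2# * (ε * δ) ≤ δ
      2εδ≤δ = subst₂ _≤_ (solve 2 (λ e d → (e :+ e) :* d := con 2 :* (e :* d)) refl ε δ) (*-identityˡ δ)
        (*-monoʳ-≤ (proj₁ 0<δ) (≰⇒≥ ¬half))
      δ<2 : δ < 2#
      δ<2 = <-≤-trans δ<1 (1≤fromℕ 2)
      -- The buckets are sized for β = ε / 2, which turns the constant 16 of `bucketBits` into the
      -- 32 of `enough-space`.
      2ᵏε≤ : ∀ k → 2# ^ k * β ≤ fromℕ 16 * √ ℓ → 2# ^ k * (fromℕ 1 * ε) ≤ fromℕ 32 * √ ℓ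
      2ᵏε≤ k k≤ = subst₂ _≤_
        (trans (solve 2 (λ p b → con 2 :* (p :* b) := p :* (b :+ b)) refl (2# ^ k) β)
          (cong (2# ^ k *_) (trans β+β≡ε (sym (trans (cong (_* ε) fromℕ-1) (*-identityˡ ε))))))
        (solve 1 (λ s → con 2 :* (con 16 :* s) := con 32 :* s) refl (√ ℓ))
        (*-monoˡ-≤ 0≤2 k≤)
      1≤ℓ : 1# ≤ ℓ
      1≤ℓ = 1≤log₂ (fromℕ-mono (ℕ.≰⇒> U≰1))
      module _ (l t k : ℕ) where
        open Quantiles.DyadicQuantile R w {U-1} k (suc l) t using (algorithm; dyadic-solvesAQ) public
        solves : U ℕ.< 2 ℕ.^ suc l → 2 ℕ.^ suc l ℕ.≤ 2 ℕ.^ suc w → 2# ≤ 2# ^ t * δ →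
          fromℕ (32 ℕ.* suc l) ≤ 2# ^ k * 2# ^ k * (β * β) → SolvesAQ ε δ algorithm
        solves U<2ᴸ 2ᴸ≤ 2≤2ᵗδ wide = subst (λ ε → SolvesAQ ε δ algorithm) β+β≡ε
          (dyadic-solvesAQ {β} {δ} (proj₁ 0<β) U≤2ʷ (ℕ.<⇒≤ U<2ᴸ) 2ᴸ≤ wide
            (≤-by (2# ^ t * δ - 2#) (≤⇒0≤- 2≤2ᵗδ)
              (solve 2 (λ p d → p :- con 2 := (con 1 :- d) :* p :+ (p :* d :- con 2)) refl (2# ^ t) δ)))
        uses : fromℕ t ≤ 2# * D → fromℕ (suc l) ≤ 2# * ℓ → 2# ^ k * β ≤ fromℕ 16 * √ ℓ →
          UsesO C algorithm (ℓ ^3/2 * D * ε ⁻¹ + loglog₂ U)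
        uses t≤ L≤ k≤ = enough-space t (suc l) k 1 0<ε 0≤D 1≤ℓ 0≤loglog (dyadic-space w k (suc l) t)
          (≤-trans t≤ (*-mono-≤ 0≤2 (*-nonNegative (0≤fromℕ 1) 0≤D) (fromℕ-mono {2} {8} (ℕ.m≤m+n 2 6))
            (≤-reflexive (sym (trans (cong (_* D) fromℕ-1) (*-identityˡ D))))))
          L≤ (2ᵏε≤ k k≤)
      dyadic : (∃[ l ] U ℕ.< 2 ℕ.^ suc l × 2 ℕ.^ suc l ℕ.≤ 2 ℕ.^ suc w × fromℕ (suc l) ≤ 2# * ℓ) →
        (∃[ t ] 2# ≤ 2# ^ t * δ × fromℕ t ≤ 2# * D) → Goal
      dyadic (l , U<2ᴸ , 2ᴸ≤ , L≤) (t , 2≤2ᵗδ , t≤) = sized (bucketBits (suc l) 0<β β≤1 1≤ℓ L≤)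
        where
        sized : (∃[ k ] fromℕ (32 ℕ.* suc l) ≤ 2# ^ k * 2# ^ k * (β * β) × 2# ^ k * β ≤ fromℕ 16 * √ ℓ) → Goal
        sized (k , wide , k≤) = algorithm l t k , solves l t k U<2ᴸ 2ᴸ≤ 2≤2ᵗδ wide , uses l t k t≤ L≤ k≤

theorem4p2 : (R : RealField) → let open RealField R in let open Streaming R in
    (∃[ C ] ∀ (U w : ℕ) .{{_ : NonZero U}} → U ℕ.≤ 2 ℕ.^ w →
    ∀ (ε δ : ℝ) → 0# < ε → ε < 1# → 0# < δ → δ < 1# →
    Σ[ A ∈ Algorithm U w (Fin U) ℝ ]
    SolvesAR ε δ A ×
    UsesO C A (log₂ (fromℕ U) ^3/2 * log₂ (δ ⁻¹) * ε ⁻¹))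
    ×
    (∃[ C ] ∀ (U w : ℕ) .{{_ : NonZero U}} → U ℕ.≤ 2 ℕ.^ w →
    ∀ (ε δ : ℝ) → 0# < ε → ε < 1# → 0# < δ → δ < 1# →
    Σ[ A ∈ Algorithm U w ℕ (Fin U) ]
    SolvesAQ ε δ A ×
    UsesO C A (log₂ (fromℕ U) ^3/2 * log₂ ((ε * δ) ⁻¹) * ε ⁻¹ + loglog₂ U))
theorem4p2 R = (C , approximateRank) , (C , approximateQuantile)
  where
  open Parameters R using (C)
  open Solutions R
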